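{- Let $n\ge0$ and let $\sigma,\tau\in\mathrm{Typ}(n)$ be types of $n$. The coefficient of $P_\tau$ in the expansion of $E^+_\sigma$ in the basis $\{P_\rho:\rho\in\mathrm{Typ}(n)\}$ is $$\sum_{T\in \mathcal{PT}^{\mathrm{odoub}}(\sigma, \tau)} \frac{(-1)^{\ell_2(T)}}{z_{\tau}^\otimes}.$$
   Context: A type of $n$ is a sequence $\tau=(\tau|^1,\tau|^2,\dots)$ of (possibly empty) integer partitions with $\sum_{i\ge1} i\,|\tau|^i|=n$, where $|\tau|^i|$ is the size of the partition $\tau|^i$; $\mathrm{Typ}(n)$ is the set of types of $n$. Each part $d$ of $\tau|^r$ gives a block $d^r$ of $\tau$ (degree $d$, multiplicity $r$; not exponentiation). We list the blocks as $\tau=d_1^{r_1}d_2^{r_2}\cdots d_s^{r_s}$ with $r_1\le\cdots\le r_s$, blocks of equal multiplicity $r$ being listed in the (weakly decreasing) order of the parts of $\tau|^r$. For a partition $\lambda$, $z_\lambda=\prod_{i\ge1} i^{m_i(\lambda)}m_i(\lambda)!$, where $m_i(\lambda)$ is the number of parts of $\lambda$ equal to $i$. For a type $\tau$, $z_\tau^\otimes=\prod_{i\ge1} z_{\tau|^i}$. Let $x_{i,j}$ ($i,j\ge 1$) be indeterminates with $\deg x_{i,j}=i$; all series have rational coefficients. A monomial is square-free if every exponent is at most $1$. $E^+_d$ is the sum of all square-free monomials of degree $d$; for $d\ge1$, $P_d=\sum_{k\mid d}\sum_{j\ge1}k\,x_{k,j}^{d/k}$. For $F\in\{E^+,P\}$,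 $F_{d^r}$ is obtained from $F_d$ by replacing each $x_{i,j}$ by $x_{i,j}^r$, and $F_\tau=\prod F_{d^r}$ over all blocks $d^r$ of $\tau$ (counted with repetition; empty product $=1$). It is known that $\{F_\tau\}_{\tau\in\mathrm{Typ}(n)}$ is, for each such $F$, a $\mathbb{Q}$-basis of the space $\mathrm{PSym}(n)$ of polysymmetric functions of degree $n$ (power series homogeneous of degree $n$ that are symmetric separately in each variable set $\{x_{i,j}\}_{j\ge1}$). The diagram of a partition $\lambda$ has left-justified rows of $\lambda_1,\lambda_2,\dots$ cells; the tensor diagram of $\sigma$ is the sequence of diagrams of $\sigma|^1,\sigma|^2,\dots$, the $i$th one being called the $i$th tensor factor. A brick is a nonempty set of consecutive cells in one row; its length is its number of cells. A doublebrick is a brick of even length marked with a $+$ sign (and is distinguished from unmarked bricks, simply called bricks). An ordered double polybrick tabloid of shape $\sigma$ and content $\tau=d_1^{r_1}\cdots d_s^{r_s}$ is a decomposition of the tensor diagram of $\sigma$ into $s$ disjoint bricks and doublebricks, labeled bijectively by $1,\dots,s$, such that for each $1\le i\le s$ the object labeled $i$ is either a brick of length $d_i$ in the $r_i$th tensor factor, or (possible only if $r_i$ is even) a doublebrick of length $2d_i$ in the $(r_i/2)$th tensor factor, and the labels increase from left to right within each row. $\mathcal{PT}^{\mathrm{odoub}}(\sigma,\tau)$ is the set of these. For such $T$, $\ell_2(T)$ is the number of doublebricks in $T$. -}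

module Defs where

open import Data.Bool.Base using (Bool; true; false; if_then_else_)
import Data.Bool.Properties as Bool
open import Data.Empty using (⊥-elim)
open import Data.Fin.Base as Fin using (Fin; toℕ)
import Data.Fin.Properties as Fin
open import Data.Integer.Base as ℤ using (ℤ)
open import Data.List.Base as List using (List; []; _∷_; map; foldr; filter; length; concatMap; upTo; allFin; cartesianProduct; cartesianProductWith; mapMaybe)
import Data.List.Properties as List
open import Data.List.Membership.Propositional using (_∈_)
open import Data.List.Membership.Propositional.Properties using (∈-allFin; ∈-cartesianProduct⁺; ∈-cartesianProductWith⁺; ∈-cartesianProductWith⁻; ∈-filter⁺; ∈-map⁺; ∈-upTo⁺)
open import Data.List.Relation.Unary.All as All using (All; []; _∷_)
import Data.List.Relation.Unary.All.Properties as All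
open import Data.List.Relation.Unary.AllPairs using ([]; _∷_)
open import Data.List.Relation.Unary.Any using (here; there)
open import Data.List.Relation.Unary.Linked as Linked using (Linked)
open import Data.List.Relation.Unary.Unique.Propositional using (Unique)
import Data.List.Relation.Unary.Unique.Propositional.Properties as Unique
open import Data.Maybe.Base using (Maybe; just; nothing)
open import Data.Nat.Base
open import Data.Nat.Divisibility using (_∣?_)
open import Data.Nat.DivMod using (_/_)
open import Data.Nat.ListAction using (sum; product)
open import Data.Nat.ListAction.Properties using (product≢0)
open import Data.Nat.Properties
open import Data.Product.Base using (_×_; _,_; proj₁; proj₂; ∃-syntax)
open import Data.Rational.Base as ℚ using (ℚ; 0ℚ; 1ℚ)
open import Data.Vec.Base as Vec using (Vec; []; _∷_)
import Data.Vec.Properties as Vec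
open import Data.Vec.Relation.Unary.All as VecAll using ([]; _∷_)
import Data.Vec.Relation.Unary.All.Properties as VecAll
open import Function.Base using (_∘_)
open import Relation.Binary.PropositionalEquality
open import Relation.Nullary using (Dec; yes; no; does; ¬_)
open import Relation.Nullary.Decidable using (_×-dec_; _→-dec_)
open import Relation.Unary using (Decidable)

∑ : {A : Set} → List A → (A → ℚ) → ℚ
∑ xs f = foldr ℚ._+_ 0ℚ (map f xs)

infixr 5 ∑
syntax ∑ xs (λ x → e) = ∑[ x ∈ xs ] e

vectors : {A : Set} → List A → (k : ℕ) → List (Vec A k)
vectors xs zero    = [] ∷ []
vectors xs (suc k) = cartesianProductWith _∷_ xs (vectors xs k)

listsUpTo : {A : Set} → List A → ℕ → List (List A)
listsUpTo xs zero    = [] ∷ []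
listsUpTo xs (suc k) = [] ∷ cartesianProductWith _∷_ xs (listsUpTo xs k)

private
  variable
    A B : Set

vectors-complete : ∀ {xs : List A} {k} {v : Vec A k} → VecAll.All (_∈ xs) v → v ∈ vectors xs k
vectors-complete []         = here refl
vectors-complete (x∈ ∷ v∈) = ∈-cartesianProductWith⁺ _∷_ x∈ (vectors-complete v∈)

vectors-unique : ∀ {xs : List A} → Unique xs → ∀ k → Unique (vectors xs k)
vectors-unique u zero    = [] ∷ []
vectors-unique u (suc k) =
  Unique.cartesianProductWith⁺ _∷_ Vec.∷-injective u (vectors-unique u k)

listsUpTo-complete : ∀ {xs : List A} {k} {ys : List A} → length ys ≤ k → All (_∈ xs) ys → ys ∈ listsUpTo xs k
listsUpTo-complete {k = zero}  z≤n     []         = here refl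
listsUpTo-complete {k = suc k} z≤n     []         = here refl
listsUpTo-complete {k = suc k} (s≤s l) (y∈ ∷ ys∈) =
  there (∈-cartesianProductWith⁺ _∷_ y∈ (listsUpTo-complete l ys∈))

listsUpTo-unique : ∀ {xs : List A} → Unique xs → ∀ k → Unique (listsUpTo xs k)
listsUpTo-unique u zero = [] ∷ []
listsUpTo-unique {xs = xs} u (suc k) =
  All.tabulate (λ y∈ []≡y → nonempty (subst (_∈ _) (sym []≡y) y∈)) ∷
  Unique.cartesianProductWith⁺ _∷_ List.∷-injective u (listsUpTo-unique u k)
  where
  nonempty : ¬ ([] ∈ cartesianProductWith _∷_ xs (listsUpTo xs k))
  nonempty []∈ with ∈-cartesianProductWith⁻ _∷_ xs _ []∈
  ... | _ , _ , _ , _ , ()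

mapMaybe-complete : ∀ {f : A → Maybe B} {x y xs} → f x ≡ just y → x ∈ xs → y ∈ mapMaybe f xs
mapMaybe-complete {f = f} {x} eq (here refl) with f x
mapMaybe-complete refl (here refl) | just _ = here refl
mapMaybe-complete {f = f} {xs = x′ ∷ _} eq (there x∈) with f x′
... | just _  = there (mapMaybe-complete eq x∈)
... | nothing = mapMaybe-complete eq x∈

mapMaybe-sound : ∀ {f : A → Maybe B} {y} xs → y ∈ mapMaybe f xs → ∃[ x ] (x ∈ xs × f x ≡ just y)
mapMaybe-sound {f = f} (x ∷ xs) y∈ with f x in eq
mapMaybe-sound (x ∷ xs) (here refl) | just _ = x , here refl , eq
mapMaybe-sound (x ∷ xs) (there y∈)  | just _ with mapMaybe-sound xs y∈
... | x′ , x′∈ , eq′ = x′ , there x′∈ , eq′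
mapMaybe-sound (x ∷ xs) y∈ | nothing with mapMaybe-sound xs y∈
... | x′ , x′∈ , eq′ = x′ , there x′∈ , eq′

mapMaybe-unique : ∀ {f : A → Maybe B} → (∀ {x x′ y} → f x ≡ just y → f x′ ≡ just y → x ≡ x′) →
                  ∀ {xs} → Unique xs → Unique (mapMaybe f xs)
mapMaybe-unique inj [] = []
mapMaybe-unique {f = f} inj {x ∷ xs} (x∉ ∷ u) with f x in eq
... | nothing = mapMaybe-unique inj u
... | just y  = All.tabulate new ∷ mapMaybe-unique inj u
  where
  new : ∀ {y′} → y′ ∈ mapMaybe f xs → y ≢ y′
  new y′∈ refl with mapMaybe-sound xs y′∈
  ... | x′ , x′∈ , eq′ = All.lookup x∉ x′∈ (inj eq eq′)

record Partition : Set where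
  constructor partition
  field
    parts      : List ℕ
    positive   : All (1 ≤_) parts
    decreasing : Linked _≥_ parts

open Partition public

size : Partition → ℕ
size λ′ = sum (parts λ′)

m : ℕ → Partition → ℕ
m i λ′ = length (filter (_≟ i) (parts λ′))

-- Every part of λ lies in {1, …, |λ|}, so the factors with i > |λ| are 1.

z : Partition → ℕ
z λ′ = product (map (λ i → suc i ^ m (suc i) λ′ * m (suc i) λ′ !) (upTo (size λ′)))

-- Position k : Fin n of a type of n holds τ|ⁱ for i = suc (toℕ k).  For
-- i > n the condition Σ i |τ|ⁱ| = n forces τ|ⁱ to be empty, so it is not
-- recorded.

weight : ∀ {n} → Vec Partition n → ℕ
weight {n} τ = sum (map (λ k → suc (toℕ k) * size (Vec.lookup τ k)) (allFin n))

record Typ (n : ℕ) : Set where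
  constructor typ
  field
    components : Vec Partition n
    weight≡n   : weight components ≡ n

  component : Fin n → Partition
  component = Vec.lookup components

open Typ public

z⊗ : ∀ {n} → Typ n → ℕ
z⊗ {n} τ = product (map (λ k → z (component τ k)) (allFin n))

record Block : Set where
  constructor block
  field
    degree       : ℕ
    multiplicity : ℕ

open Block public

blocks : ∀ {n} → Typ n → List Block
blocks {n} τ = concatMap (λ k → map (λ d → block d (suc (toℕ k))) (parts (component τ k))) (allFin n)

z≢0 : ∀ λ′ → NonZero (z λ′)
z≢0 λ′ = product≢0 (All.map⁺ (All.universal
  (λ i → m*n≢0 _ _ {{m^n≢0 (suc i) (m (suc i) λ′)}} {{m (suc i) λ′ !≢0}}) (upTo (size λ′))))

z⊗≢0 : ∀ {n} (τ : Typ n) → NonZero (z⊗ τ)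
z⊗≢0 τ = product≢0 (All.map⁺ (All.universal (λ k → z≢0 (component τ k)) (allFin _)))

infixl 7 _/z⊗_
_/z⊗_ : ∀ {n} → ℤ → Typ n → ℚ
p /z⊗ τ = ℚ._/_ p (z⊗ τ) {{z⊗≢0 τ}}

toPartition : List ℕ → Maybe Partition
toPartition xs with All.all? (1 ≤?_) xs | Linked.linked? _≥?_ xs
... | yes p | yes d = just (partition xs p d)
... | yes _ | no _  = nothing
... | no _  | _     = nothing

toTyp : ∀ {n} → Vec Partition n → Maybe (Typ n)
toTyp {n} τ with weight τ ≟ n
... | yes p = just (typ τ p)
... | no _  = nothing

partitions : ℕ → List Partition
partitions n = mapMaybe toPartition (listsUpTo (upTo (suc n)) n)

types : ∀ n → List (Typ n)
types n = mapMaybe toTyp (vectors (partitions n) n)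

private

  toPartition-parts : ∀ {xs λ′} → toPartition xs ≡ just λ′ → parts λ′ ≡ xs
  toPartition-parts {xs} eq with All.all? (1 ≤?_) xs | Linked.linked? _≥?_ xs
  toPartition-parts refl | yes _ | yes _ = refl

  parts-toPartition : ∀ λ′ → toPartition (parts λ′) ≡ just λ′
  parts-toPartition (partition xs p d) with All.all? (1 ≤?_) xs | Linked.linked? _≥?_ xs
  ... | yes p′ | yes d′ = cong₂ (λ p d → just (partition xs p d))
                            (All.irrelevant ≤-irrelevant p′ p) (Linked.irrelevant ≤-irrelevant d′ d)
  ... | yes _  | no ¬d  = ⊥-elim (¬d d)
  ... | no ¬p  | _      = ⊥-elim (¬p p)

  toTyp-components : ∀ {n} {v : Vec Partition n} {τ} → toTyp v ≡ just τ → components τ ≡ v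
  toTyp-components {n} {v} eq with weight v ≟ n
  toTyp-components refl | yes _ = refl

  components-toTyp : ∀ {n} (τ : Typ n) → toTyp (components τ) ≡ just τ
  components-toTyp {n} (typ v p) with weight v ≟ n
  ... | yes p′ = cong (just ∘ typ v) (≡-irrelevant p′ p)
  ... | no ¬p  = ⊥-elim (¬p p)

  ≤sum : ∀ {x xs} → x ∈ xs → x ≤ sum xs
  ≤sum {xs = x ∷ xs} (here refl) = m≤m+n x (sum xs)
  ≤sum {xs = y ∷ xs} (there x∈)  = m≤n⇒m≤o+n y (≤sum x∈)

  length≤sum : ∀ {xs} → All (1 ≤_) xs → length xs ≤ sum xs
  length≤sum []       = z≤n
  length≤sum (p ∷ ps) = +-mono-≤ p (length≤sum ps)

  partitions-complete : ∀ {n} λ′ → size λ′ ≤ n → λ′ ∈ partitions n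
  partitions-complete λ′ s≤n = mapMaybe-complete (parts-toPartition λ′)
    (listsUpTo-complete (≤-trans (length≤sum (positive λ′)) s≤n)
      (All.tabulate λ x∈ → ∈-upTo⁺ (s≤s (≤-trans (≤sum x∈) s≤n))))

  partitions-unique : ∀ n → Unique (partitions n)
  partitions-unique n = mapMaybe-unique
    (λ eq eq′ → trans (sym (toPartition-parts eq)) (toPartition-parts eq′))
    (listsUpTo-unique (Unique.upTo⁺ _) n)

  size≤n : ∀ {n} (τ : Typ n) k → size (component τ k) ≤ n
  size≤n τ k = begin
    size (component τ k)                   ≤⟨ m≤m+n _ _ ⟩
    suc (toℕ k) * size (component τ k)     ≤⟨ ≤sum (∈-map⁺ _ (∈-allFin k)) ⟩
    weight (components τ)                  ≡⟨ weight≡n τ ⟩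
    _                                      ∎
    where open ≤-Reasoning

types-complete : ∀ {n} (τ : Typ n) → τ ∈ types n
types-complete τ = mapMaybe-complete (components-toTyp τ)
  (vectors-complete (VecAll.lookup⁻ λ k → partitions-complete _ (size≤n τ k)))

types-unique : ∀ n → Unique (types n)
types-unique n = mapMaybe-unique
  (λ eq eq′ → trans (sym (toTyp-components eq)) (toTyp-components eq′))
  (vectors-unique (partitions-unique n) n)

-- The matrix e : Monomial a b stands for the product of the powers
-- x_{i,j} ^ e_{i,j} over 1 ≤ i ≤ a and 1 ≤ j ≤ b; rows and columns are
-- numbered from zero, so that entry (k , l) belongs to x_{k+1,l+1}.  Every
-- monomial in the x_{i,j} arises in this way, once for every sufficiently
-- large a and b.

Monomial : ℕ → ℕ → Set
Monomial a b = Vec (Vec ℕ b) a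

Series : Set
Series = ∀ {a b} → Monomial a b → ℚ

infix 4 _≈_
_≈_ : Series → Series → Set
F ≈ G = ∀ {a b} (e : Monomial a b) → F e ≡ G e

_≟ᴹ_ : ∀ {a b} (e e′ : Monomial a b) → Dec (e ≡ e′)
_≟ᴹ_ = Vec.≡-dec (Vec.≡-dec _≟_)

_^ᴹ_ : ∀ {a b} → Monomial a b → ℕ → Monomial a b
e ^ᴹ r = Vec.map (Vec.map (r *_)) e

var^ : ∀ {a b} → Fin a → Fin b → ℕ → Monomial a b
var^ k l r = Vec.tabulate λ k′ → Vec.tabulate λ l′ →
  if does (k Fin.≟ k′) then (if does (l Fin.≟ l′) then r else 0) else 0

deg : ∀ {a b} → Monomial a b → ℕ
deg {a} e = sum (map (λ k → suc (toℕ k) * Vec.sum (Vec.lookup e k)) (allFin a))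

SquareFree : ∀ {a b} → Monomial a b → Set
SquareFree = VecAll.All (VecAll.All (_≤ 1))

squareFree? : ∀ {a b} → Decidable (SquareFree {a} {b})
squareFree? = VecAll.all? (VecAll.all? (_≤? 1))

splitVec : {A : Set} → (A → List (A × A)) → ∀ {k} → Vec A k → List (Vec A k × Vec A k)
splitVec split []       = ([] , []) ∷ []
splitVec split (x ∷ xs) =
  cartesianProductWith (λ (x₁ , x₂) (xs₁ , xs₂) → x₁ ∷ xs₁ , x₂ ∷ xs₂) (split x) (splitVec split xs)

factorisations : ∀ {a b} → Monomial a b → List (Monomial a b × Monomial a b)
factorisations = splitVec (splitVec (λ x → map (λ y → y , x ∸ y) (upTo (suc x))))

1ˢ : Series
1ˢ {a} {b} e = if does (e ≟ᴹ Vec.replicate a (Vec.replicate b 0)) then 1ℚ else 0ℚ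

infixl 7 _*ˢ_
_*ˢ_ : Series → Series → Series
(F *ˢ G) e = ∑[ p ∈ factorisations e ] F (proj₁ p) ℚ.* G (proj₂ p)

-- The series F with every x_{i,j} replaced by x_{i,j} ^ r, for r ≥ 1: the
-- coefficient at e is F e′ if e = e′ ^ r, and zero if there is no such e′.
-- Such an e′ is unique and divides e.

_[x^_] : Series → ℕ → Series
(F [x^ r ]) e = ∑[ p ∈ filter (λ p → (proj₁ p ^ᴹ r) ≟ᴹ e) (factorisations e) ] F (proj₁ p)

E⁺ : ℕ → Series
E⁺ d e = if does (squareFree? e ×-dec (deg e ≟ d)) then 1ℚ else 0ℚ

-- In P d, for d ≥ 1, the inner summand is the coefficient of e in
-- k x_{k,j}^{d/k}, where k and j are one more than the bound variables.  A
-- power x_{k,j}^{d/k} with k > a or j > b is never equal to e.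

P : ℕ → Series
P d {a} {b} e =
  ∑[ k ∈ filter (λ k → suc (toℕ k) ∣? d) (allFin a) ]
  ∑[ j ∈ allFin b ]
    (if does (e ≟ᴹ var^ k j (d / suc (toℕ k))) then (ℤ.+ suc (toℕ k)) ℚ./ 1 else 0ℚ)

blockProduct : (ℕ → Series) → List Block → Series
blockProduct F []               = 1ˢ
blockProduct F (block d r ∷ βs) = F d [x^ r ] *ˢ blockProduct F βs

infix 9 _⟦_⟧
_⟦_⟧ : (ℕ → Series) → ∀ {n} → Typ n → Series
F ⟦ τ ⟧ = blockProduct F (blocks τ)

-- The P_ρ with ρ ∈ Typ(n) form a basis of the polysymmetric functions of
-- degree n, so such a c is unique: c ρ is the coefficient of P_ρ in F.

IsPExpansion : ∀ n → Series → (Typ n → ℚ) → Set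
IsPExpansion n F c = F ≈ λ e → ∑[ ρ ∈ types n ] c ρ ℚ.* (P ⟦ ρ ⟧) e

nth : List ℕ → ℕ → ℕ
nth []       _       = 0
nth (x ∷ _)  zero    = x
nth (_ ∷ xs) (suc r) = nth xs r

-- Factors, rows and columns are all numbered from zero.  The length is zero
-- if there is no such row.

rowLength : ∀ {n} → Typ n → Fin n → Fin n → ℕ
rowLength σ f r = nth (parts (component σ f)) (toℕ r)

-- A tile is a brick or (if doubled) a doublebrick, given by the tensor
-- factor and row containing it and by its leftmost column.  Its length is
-- determined by its label.  For a type of n at most n factors, rows and
-- columns are needed.

record Tile (n : ℕ) : Set where
  constructor tile
  field
    doubled : Bool
    factor  : Fin n
    row     : Fin n
    column  : Fin n

open Tile public

tiles : ∀ n → List (Tile n)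
tiles n = cartesianProductWith (λ (b , f) (r , c) → tile b f r c)
  (cartesianProduct (false ∷ true ∷ []) (allFin n))
  (cartesianProduct (allFin n) (allFin n))

tiles-complete : ∀ {n} (t : Tile n) → t ∈ tiles n
tiles-complete (tile b f r c) = ∈-cartesianProductWith⁺ _
  (∈-cartesianProduct⁺ (b∈ b) (∈-allFin f)) (∈-cartesianProduct⁺ (∈-allFin r) (∈-allFin c))
  where
  b∈ : ∀ b → b ∈ false ∷ true ∷ []
  b∈ false = here refl
  b∈ true  = there (here refl)

tiles-unique : ∀ n → Unique (tiles n)
tiles-unique n = Unique.cartesianProductWith⁺ _ (λ { refl → refl , refl })
  (Unique.cartesianProduct⁺ (((λ ()) ∷ []) ∷ [] ∷ []) (Unique.allFin⁺ n))
  (Unique.cartesianProduct⁺ (Unique.allFin⁺ n) (Unique.allFin⁺ n))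

module _ {n : ℕ} (σ τ : Typ n) where

  Label : Set
  Label = Fin (length (blocks τ))

  Tiling : Set
  Tiling = Vec (Tile n) (length (blocks τ))

  module _ (T : Tiling) where

    private
      at : Label → Tile n
      at = Vec.lookup T

      blockOf : Label → Block
      blockOf = List.lookup (blocks τ)

    tileLength : Label → ℕ
    tileLength i = if doubled (at i) then 2 * degree (blockOf i) else degree (blockOf i)

    -- A brick labeled i lies in tensor factor r_i, a doublebrick in
    -- tensor factor r_i / 2.

    RightFactor : Label → Set
    RightFactor i = multiplicity (blockOf i) ≡ (if doubled (at i) then 2 else 1) * suc (toℕ (factor (at i)))

    InDiagram : Label → Set
    InDiagram i = toℕ (column (at i)) + tileLength i ≤ rowLength σ (factor (at i)) (row (at i))

    Occupies : Label → Fin n → Fin n → Fin n → Set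
    Occupies i f r c = factor (at i) ≡ f × row (at i) ≡ r × toℕ (column (at i)) ≤ toℕ c × toℕ c < toℕ (column (at i)) + tileLength i

    DisjointTiles : Set
    DisjointTiles = ∀ i j f r c → Occupies i f r c → Occupies j f r c → i ≡ j

    CoversDiagram : Set
    CoversDiagram = ∀ f r c → toℕ c < rowLength σ f r → ∃[ i ] Occupies i f r c

    LabelsIncrease : Set
    LabelsIncrease = ∀ i j → factor (at i) ≡ factor (at j) → row (at i) ≡ row (at j) → column (at i) Fin.< column (at j) → i Fin.< j

    IsTabloid : Set
    IsTabloid = (∀ i → RightFactor i) × (∀ i → InDiagram i) × DisjointTiles × CoversDiagram × LabelsIncrease

    occupies? : ∀ i f r c → Dec (Occupies i f r c)
    occupies? i f r c = (factor (at i) Fin.≟ f) ×-dec (row (at i) Fin.≟ r) ×-dec (_ ≤? _) ×-dec (_ <? _)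

    isTabloid? : Dec IsTabloid
    isTabloid? =
      Fin.all? (λ i → _ ≟ _) ×-dec
      Fin.all? (λ i → _ ≤? _) ×-dec
      Fin.all? (λ i → Fin.all? λ j → Fin.all? λ f → Fin.all? λ r → Fin.all? λ c →
        occupies? i f r c →-dec occupies? j f r c →-dec i Fin.≟ j) ×-dec
      Fin.all? (λ f → Fin.all? λ r → Fin.all? λ c →
        (_ <? _) →-dec Fin.any? λ i → occupies? i f r c) ×-dec
      Fin.all? (λ i → Fin.all? λ j →
        (_ Fin.≟ _) →-dec (_ Fin.≟ _) →-dec (_ Fin.<? _) →-dec (_ Fin.<? _))

  PTᵒᵈᵒᵘᵇ : List Tiling
  PTᵒᵈᵒᵘᵇ = filter isTabloid? (vectors (tiles n) (length (blocks τ)))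

  PTᵒᵈᵒᵘᵇ-unique : Unique PTᵒᵈᵒᵘᵇ
  PTᵒᵈᵒᵘᵇ-unique = Unique.filter⁺ isTabloid? (vectors-unique (tiles-unique n) _)

  PTᵒᵈᵒᵘᵇ-complete : ∀ {T} → IsTabloid T → T ∈ PTᵒᵈᵒᵘᵇ
  PTᵒᵈᵒᵘᵇ-complete = ∈-filter⁺ isTabloid? (vectors-complete (VecAll.universal tiles-complete _))

ℓ₂ : ∀ {n s} → Vec (Tile n) s → ℕ
ℓ₂ = Vec.count λ t → doubled t Bool.≟ true

{-# OPTIONS --safe #-}
module Submission where

-- Comparing ∏ (1 + x_{i,j} tⁱ) with its logarithm gives Newton's identity
--   d E⁺_d = Σ_k P_k E⁺_{d-k} - 2 Σ_k P_k[x²] E⁺_{d-2k},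
-- in which the first sum prepends a brick of length k to a row of length d
-- and the second one a doublebrick of length 2k.  The claimed expansion obeys
-- the same recursion for every row of σ: counting the cells of that row
-- according to the tile that contains them amounts to removing a block d^r
-- from the content τ, and d m_d(τ|^r) / z_τ = 1 / z_{τ - d^r}.  Since labels
-- increase along rows, tabloids are built by appending the tiles to the rows
-- in label order, which makes removing an arbitrary block possible.  The
-- theorem follows by induction on the number of cells to be filled.

open import Defs
open import Data.Integer.Base using (-1ℤ; _^_)
open import Data.Bool.Base using (Bool; true; false; if_then_else_)
open import Data.Empty using (⊥-elim)
open import Data.Fin.Base as Fin using (Fin; toℕ; zero; suc)
import Data.Fin.Properties as Fin
open import Data.Integer.Base as ℤ using (ℤ)
import Data.Integer.Properties as ℤ
open import Data.List.Base as List using (List; []; _∷_; _++_; map; filter; upTo; allFin; cartesianProduct; cartesianProductWith; length; concatMap; replicate; mapMaybe)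
import Data.List.Properties as List
open import Data.List.Membership.Propositional using (_∈_; find; lose)
open import Data.List.Membership.Propositional.Properties using (∈-allFin; ∈-cartesianProduct⁺; ∈-cartesianProduct⁻; ∈-cartesianProductWith⁺; ∈-cartesianProductWith⁻; ∈-filter⁺; ∈-filter⁻; ∈-lookup; ∈-map⁺; ∈-map⁻; ∈-upTo⁺; ∈-upTo⁻)
open import Data.List.Relation.Unary.All as All using (All; []; _∷_)
import Data.List.Relation.Unary.All.Properties as AllP
open import Data.List.Relation.Unary.AllPairs using ([]; _∷_)
open import Data.List.Relation.Unary.Any using (here; there; any?)
open import Data.List.Relation.Unary.Linked as Linked using (Linked; []; [-]; _∷_)
import Data.List.Relation.Unary.Linked.Properties as LinkedP
open import Data.List.Relation.Unary.Unique.Propositional using (Unique)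
import Data.List.Relation.Unary.Unique.Propositional.Properties as Unique
open import Data.Maybe.Base using (Maybe; just; nothing; maybe′)
open import Data.Nat.Base as ℕ hiding (_^_)
open import Data.Nat.Divisibility using (_∣_; _∣?_; divides)
open import Data.Nat.DivMod using (_/_; m*n/n≡m; m*[n/m]≡n; m/n≤m)
open import Data.Nat.ListAction using (sum; product)
open import Data.Nat.ListAction.Properties using (product-++; sum-++)
open import Data.Nat.Properties
open import Data.Nat.Solver using () renaming (module +-*-Solver to ℕSolver)
open import Data.Product.Base using (_×_; _,_; proj₁; proj₂; ∃-syntax; swap)
open import Data.Product.Properties using (≡-dec; ,-injective)
open import Data.Rational.Base as ℚ using (ℚ; 0ℚ; 1ℚ)
import Data.Rational.Properties as ℚ
open import Data.Rational.Solver using (module +-*-Solver)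
open import Data.Rational.Unnormalised.Base as ℚᵘ using (mkℚᵘ; *≡*)
import Data.Rational.Unnormalised.Properties as ℚᵘ
open import Data.Sum.Base using (_⊎_; inj₁; inj₂)
open import Data.Vec.Base as Vec using (Vec; []; _∷_)
import Data.Vec.Properties as Vec
import Data.Vec.Relation.Unary.All as VecAll
import Data.Vec.Relation.Unary.All.Properties as VecAll
open import Function.Base using (_∘_)
open import Relation.Binary.Definitions using (DecidableEquality)
open import Relation.Binary.PropositionalEquality
open import Relation.Nullary using (Dec; yes; no; does; ¬_)
open import Relation.Nullary.Decidable using (map′; toSum; ¬?; _×-dec_; _→-dec_)
open import Relation.Unary using (Decidable)

-- The logarithmic derivative of 1 + x tⁱ has alternating signs, whereas `P` collects all powers of
-- a variable with positive sign. Subtracting the even powers twice repairs this; hence the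
-- substitution x² and the coefficient -2. On the tabloid side the same number is the sign -1 of a
-- doublebrick times 2: it has 2d cells, and only the factor d is absorbed by z. Removing a tile
-- leaves a partly filled row, so the induction needs more general shapes than σ. Its state is a
-- function `O`: row ρ is filled up to length O ρ and has to reach R ρ, and the matching product of
-- series has a factor E⁺ of degree R ρ - O ρ for this row. The recursion only determines R ρ - O ρ
-- times the unknown, so it is applied to a row that lacks cells, while full and overfull rows are
-- settled directly. The content is handled as a multiset of blocks, given by how often each kind of
-- block occurs: removing a block is then an index shift that can be compared with 1/z. These
-- numbers are cut off at n, which is harmless because no filling exists unless the weights agree.

private variable
  A B C : Set

-- Indicators and finite rational sums.

𝟙 : {X : Set} → Dec X → ℚ
𝟙 d = if does d then 1ℚ else 0ℚ

module _ {X : Set} where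

  𝟙-yes : (d : Dec X) → X → 𝟙 d ≡ 1ℚ
  𝟙-yes (yes _) _ = refl
  𝟙-yes (no ¬x) x = ⊥-elim (¬x x)

  𝟙-no : (d : Dec X) → ¬ X → 𝟙 d ≡ 0ℚ
  𝟙-no (yes x) ¬x = ⊥-elim (¬x x)
  𝟙-no (no _)  _  = refl

  if-𝟙 : (d : Dec X) (c : ℚ) → (if does d then c else 0ℚ) ≡ 𝟙 d ℚ.* c
  if-𝟙 (yes _) c = sym (ℚ.*-identityˡ c)
  if-𝟙 (no _)  c = sym (ℚ.*-zeroˡ c)

  𝟙-*-cong : (d : Dec X) {p q : ℚ} → (X → p ≡ q) → 𝟙 d ℚ.* p ≡ 𝟙 d ℚ.* q
  𝟙-*-cong (yes x) p≡q = cong (1ℚ ℚ.*_) (p≡q x)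
  𝟙-*-cong (no _) {p} {q} _ = trans (ℚ.*-zeroˡ p) (sym (ℚ.*-zeroˡ q))

module _ {X Y : Set} where

  𝟙-⇔ : (d : Dec X) (d′ : Dec Y) → (X → Y) → (Y → X) → 𝟙 d ≡ 𝟙 d′
  𝟙-⇔ (yes x) d′ to from = sym (𝟙-yes d′ (to x))
  𝟙-⇔ (no ¬x) d′ to from = sym (𝟙-no d′ (¬x ∘ from))

  𝟙-× : (d : Dec X) (d′ : Dec Y) → 𝟙 (d ×-dec d′) ≡ 𝟙 d ℚ.* 𝟙 d′
  𝟙-× (yes _) (yes _) = refl
  𝟙-× (yes _) (no _)  = refl
  𝟙-× (no _)  d′      = sym (ℚ.*-zeroˡ (𝟙 d′))

∑-cong-∈ : ∀ (xs : List A) {f g : A → ℚ} → (∀ {x} → x ∈ xs → f x ≡ g x) → ∑ xs f ≡ ∑ xs g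
∑-cong-∈ []       f≡g = refl
∑-cong-∈ (x ∷ xs) f≡g = cong₂ ℚ._+_ (f≡g (here refl)) (∑-cong-∈ xs (f≡g ∘ there))

∑-cong : ∀ (xs : List A) {f g : A → ℚ} → (∀ x → f x ≡ g x) → ∑ xs f ≡ ∑ xs g
∑-cong xs f≡g = ∑-cong-∈ xs (λ {x} _ → f≡g x)

∑-zero : ∀ (xs : List A) {f : A → ℚ} → (∀ {x} → x ∈ xs → f x ≡ 0ℚ) → ∑ xs f ≡ 0ℚ
∑-zero []       f≡0 = refl
∑-zero (x ∷ xs) f≡0 = cong₂ ℚ._+_ (f≡0 (here refl)) (∑-zero xs (f≡0 ∘ there))

∑-++ : ∀ (xs ys : List A) (f : A → ℚ) → ∑ (xs ++ ys) f ≡ ∑ xs f ℚ.+ ∑ ys f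
∑-++ []       ys f = sym (ℚ.+-identityˡ _)
∑-++ (x ∷ xs) ys f = trans (cong (f x ℚ.+_) (∑-++ xs ys f)) (sym (ℚ.+-assoc (f x) _ _))

∑-map : ∀ (g : A → B) xs (f : B → ℚ) → ∑ (map g xs) f ≡ ∑ xs (f ∘ g)
∑-map g []       f = refl
∑-map g (x ∷ xs) f = cong (f (g x) ℚ.+_) (∑-map g xs f)

∑-+ : ∀ (xs : List A) (f g : A → ℚ) → (∑[ x ∈ xs ] f x ℚ.+ g x) ≡ ∑ xs f ℚ.+ ∑ xs g
∑-+ []       f g = refl
∑-+ (x ∷ xs) f g = trans (cong (f x ℚ.+ g x ℚ.+_) (∑-+ xs f g))
  (solve 4 (λ a b c d → (a :+ b) :+ (c :+ d) := (a :+ c) :+ (b :+ d)) refl (f x) (g x) (∑ xs f) (∑ xs g))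
  where open +-*-Solver

∑-*ˡ : ∀ (xs : List A) c (f : A → ℚ) → (∑[ x ∈ xs ] c ℚ.* f x) ≡ c ℚ.* ∑ xs f
∑-*ˡ []       c f = sym (ℚ.*-zeroʳ c)
∑-*ˡ (x ∷ xs) c f = trans (cong (c ℚ.* f x ℚ.+_) (∑-*ˡ xs c f)) (sym (ℚ.*-distribˡ-+ c (f x) _))

∑-*ʳ : ∀ (xs : List A) c (f : A → ℚ) → (∑[ x ∈ xs ] f x ℚ.* c) ≡ ∑ xs f ℚ.* c
∑-*ʳ xs c f = trans (∑-cong xs (λ x → ℚ.*-comm (f x) c)) (trans (∑-*ˡ xs c f) (ℚ.*-comm c _))

∑-swap : ∀ (xs : List A) (ys : List B) (f : A → B → ℚ) →
         (∑[ x ∈ xs ] ∑[ y ∈ ys ] f x y) ≡ (∑[ y ∈ ys ] ∑[ x ∈ xs ] f x y)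
∑-swap []       ys f = sym (∑-zero ys (λ _ → refl))
∑-swap (x ∷ xs) ys f = trans (cong (∑ ys (f x) ℚ.+_) (∑-swap xs ys f)) (sym (∑-+ ys (f x) _))

∑-concatMap : ∀ (g : A → List B) xs (f : B → ℚ) → ∑ (concatMap g xs) f ≡ (∑[ x ∈ xs ] ∑ (g x) f)
∑-concatMap g []       f = refl
∑-concatMap g (x ∷ xs) f =
  trans (∑-++ (g x) (concatMap g xs) f) (cong (∑ (g x) f ℚ.+_) (∑-concatMap g xs f))

∑-cartesianProductWith : ∀ (g : A → B → C) xs ys (f : C → ℚ) →
  ∑ (cartesianProductWith g xs ys) f ≡ (∑[ x ∈ xs ] ∑[ y ∈ ys ] f (g x y))
∑-cartesianProductWith g []       ys f = refl
∑-cartesianProductWith g (x ∷ xs) ys f = trans (∑-++ (map (g x) ys) _ f)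
  (cong₂ ℚ._+_ (∑-map (g x) ys f) (∑-cartesianProductWith g xs ys f))

∑-filter : {Q : A → Set} (Q? : Decidable Q) (xs : List A) (f : A → ℚ) →
           ∑ (filter Q? xs) f ≡ (∑[ x ∈ xs ] 𝟙 (Q? x) ℚ.* f x)
∑-filter Q? []       f = refl
∑-filter Q? (x ∷ xs) f with Q? x
... | yes _ = cong₂ ℚ._+_ (sym (ℚ.*-identityˡ (f x))) (∑-filter Q? xs f)
... | no _  = trans (∑-filter Q? xs f)
  (trans (sym (ℚ.+-identityˡ _)) (cong (ℚ._+ _) (sym (ℚ.*-zeroˡ (f x)))))

∑-mapMaybe : ∀ (g : A → Maybe B) xs (f : B → ℚ) → ∑ (mapMaybe g xs) f ≡ (∑[ x ∈ xs ] maybe′ f 0ℚ (g x))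
∑-mapMaybe g []       f = refl
∑-mapMaybe g (x ∷ xs) f with g x
... | just y  = cong (f y ℚ.+_) (∑-mapMaybe g xs f)
... | nothing = trans (∑-mapMaybe g xs f) (sym (ℚ.+-identityˡ _))

∑-single : ∀ {xs : List A} {x} (f : A → ℚ) → Unique xs → x ∈ xs →
           (∀ {y} → y ∈ xs → y ≢ x → f y ≡ 0ℚ) → ∑ xs f ≡ f x
∑-single {xs = x ∷ xs} f (x∉ ∷ u) (here refl) f≡0 =
  trans (cong (f x ℚ.+_) (∑-zero xs λ y∈ → f≡0 (there y∈) (λ y≡x → All.lookup x∉ y∈ (sym y≡x))))
        (ℚ.+-identityʳ (f x))
∑-single {xs = y ∷ xs} f (y∉ ∷ u) (there x∈) f≡0 =
  trans (cong₂ ℚ._+_ (f≡0 (here refl) (All.lookup y∉ x∈)) (∑-single f u x∈ (f≡0 ∘ there)))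
        (ℚ.+-identityˡ _)

-- Both sides are the sum of f x over the pairs (x , y) with x ≡ φ y.

∑-reindex : DecidableEquality A → ∀ {xs : List A} {ys : List B} {f : A → ℚ} (φ : B → A) →
            Unique xs → Unique ys →
            (∀ {y y′} → y ∈ ys → y′ ∈ ys → φ y ≡ φ y′ → y ≡ y′) →
            (∀ {y} → y ∈ ys → φ y ∈ xs) →
            (∀ {x} → x ∈ xs → (∃[ y ] (y ∈ ys × x ≡ φ y)) ⊎ f x ≡ 0ℚ) →
            ∑ xs f ≡ ∑ ys (f ∘ φ)
∑-reindex _≟_ {xs} {ys} {f} φ uxs uys inj into onto = begin
  ∑ xs f                                              ≡⟨ ∑-cong-∈ xs perColumn ⟩
  (∑[ x ∈ xs ] ∑[ y ∈ ys ] 𝟙 (x ≟ φ y) ℚ.* f x)      ≡⟨ ∑-swap xs ys _ ⟩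
  (∑[ y ∈ ys ] ∑[ x ∈ xs ] 𝟙 (x ≟ φ y) ℚ.* f x)      ≡⟨ ∑-cong-∈ ys perRow ⟩
  ∑ ys (f ∘ φ)                                        ∎
  where
  open ≡-Reasoning
  hit : ∀ {x y} → x ≡ φ y → 𝟙 (x ≟ φ y) ℚ.* f x ≡ f x
  hit {x} eq = trans (cong (ℚ._* f x) (𝟙-yes (x ≟ _) eq)) (ℚ.*-identityˡ _)
  miss : ∀ {x y} → x ≢ φ y → 𝟙 (x ≟ φ y) ℚ.* f x ≡ 0ℚ
  miss {x} neq = trans (cong (ℚ._* f x) (𝟙-no (x ≟ _) neq)) (ℚ.*-zeroˡ (f x))
  perColumn : ∀ {x} → x ∈ xs → f x ≡ (∑[ y ∈ ys ] 𝟙 (x ≟ φ y) ℚ.* f x)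
  perColumn {x} x∈ with onto x∈
  ... | inj₂ fx≡0 = trans fx≡0 (sym (∑-zero ys λ {y} _ → trans (cong (𝟙 (x ≟ φ y) ℚ.*_) fx≡0) (ℚ.*-zeroʳ (𝟙 (x ≟ φ y)))))
  ... | inj₁ (y , y∈ , refl) = sym (trans
    (∑-single _ uys y∈ λ y′∈ y′≢y → miss (λ eq → y′≢y (sym (inj y∈ y′∈ eq))))
    (hit refl))
  perRow : ∀ {y} → y ∈ ys → (∑[ x ∈ xs ] 𝟙 (x ≟ φ y) ℚ.* f x) ≡ f (φ y)
  perRow y∈ = trans (∑-single _ uxs (into y∈) (λ _ → miss)) (hit refl)

-- Splitting exponents and monomials in two.

module _ {split : A → List (A × A)} {_∙_ : A → A → A} where

  splitVec-∈⁺ : (∀ {x y y′} → y ∙ y′ ≡ x → (y , y′) ∈ split x) →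
                ∀ {k} {x y y′ : Vec A k} → Vec.zipWith _∙_ y y′ ≡ x → (y , y′) ∈ splitVec split x
  splitVec-∈⁺ split⁺ {y = []}    {[]}      refl = here refl
  splitVec-∈⁺ split⁺ {y = _ ∷ _} {_ ∷ _}   refl =
    ∈-cartesianProductWith⁺ _ (split⁺ refl) (splitVec-∈⁺ split⁺ refl)

  splitVec-∈⁻ : (∀ {x y y′} → (y , y′) ∈ split x → y ∙ y′ ≡ x) →
                ∀ {k} {x y y′ : Vec A k} → (y , y′) ∈ splitVec split x → Vec.zipWith _∙_ y y′ ≡ x
  splitVec-∈⁻ split⁻ {x = []}    (here refl) = refl
  splitVec-∈⁻ split⁻ {x = x ∷ xs} p∈ with ∈-cartesianProductWith⁻ _ (split x) (splitVec split xs) p∈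
  ... | _ , _ , q∈ , r∈ , refl = cong₂ _∷_ (split⁻ q∈) (splitVec-∈⁻ split⁻ r∈)

splitVec-unique : ∀ {split : A → List (A × A)} → (∀ x → Unique (split x)) →
                  ∀ {k} (x : Vec A k) → Unique (splitVec split x)
splitVec-unique u []       = [] ∷ []
splitVec-unique u (x ∷ xs) = Unique.cartesianProductWith⁺ _ (λ { refl → refl , refl }) (u x) (splitVec-unique u xs)

-- Splitting into three pieces by cutting the left or the right piece a second time; this becomes
-- associativity of convolution. The test function `f` avoids comparing two differently ordered
-- lists of triples.
Coassociative : (A → List (A × A)) → Set
Coassociative {A} split = ∀ x (f : A → A → A → ℚ) →
  (∑[ p ∈ split x ] ∑[ q ∈ split (proj₁ p) ] f (proj₁ q) (proj₂ q) (proj₂ p)) ≡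
  (∑[ p ∈ split x ] ∑[ q ∈ split (proj₂ p) ] f (proj₁ p) (proj₁ q) (proj₂ q))

-- The head and the tail of a vector are split independently, so their sums can be interchanged
-- until coassociativity applies to the head and, by induction, to the tail.
splitVec-coassoc : ∀ {split : A → List (A × A)} → Coassociative split → ∀ {k} → Coassociative (splitVec split {k})
splitVec-coassoc         coassoc []       f = refl
splitVec-coassoc {split = split} coassoc (x ∷ xs) f = begin
  (∑[ p ∈ splitVec split (x ∷ xs) ] ∑[ q ∈ splitVec split (proj₁ p) ] f (proj₁ q) (proj₂ q) (proj₂ p))
    ≡⟨ ∑-cartesianProductWith _ (split x) _ _ ⟩
  (∑[ p ∈ split x ] ∑[ ps ∈ splitVec split xs ] ∑[ q ∈ splitVec split (proj₁ p ∷ proj₁ ps) ]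
    f (proj₁ q) (proj₂ q) (proj₂ p ∷ proj₂ ps))
    ≡⟨ ∑-cong (split x) (λ p → ∑-cong (splitVec split xs) λ ps → ∑-cartesianProductWith _ (split (proj₁ p)) _ _) ⟩
  (∑[ p ∈ split x ] ∑[ ps ∈ splitVec split xs ] ∑[ q ∈ split (proj₁ p) ] ∑[ qs ∈ splitVec split (proj₁ ps) ]
    f (proj₁ q ∷ proj₁ qs) (proj₂ q ∷ proj₂ qs) (proj₂ p ∷ proj₂ ps))
    ≡⟨ ∑-cong (split x) (λ p → ∑-swap (splitVec split xs) (split (proj₁ p)) _) ⟩
  (∑[ p ∈ split x ] ∑[ q ∈ split (proj₁ p) ] ∑[ ps ∈ splitVec split xs ] ∑[ qs ∈ splitVec split (proj₁ ps) ]
    f (proj₁ q ∷ proj₁ qs) (proj₂ q ∷ proj₂ qs) (proj₂ p ∷ proj₂ ps))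
    ≡⟨ coassoc x (λ u v w → ∑[ ps ∈ splitVec split xs ] ∑[ qs ∈ splitVec split (proj₁ ps) ]
         f (u ∷ proj₁ qs) (v ∷ proj₂ qs) (w ∷ proj₂ ps)) ⟩
  (∑[ p ∈ split x ] ∑[ q ∈ split (proj₂ p) ] ∑[ ps ∈ splitVec split xs ] ∑[ qs ∈ splitVec split (proj₁ ps) ]
    f (proj₁ p ∷ proj₁ qs) (proj₁ q ∷ proj₂ qs) (proj₂ q ∷ proj₂ ps))
    ≡⟨ ∑-cong (split x) (λ p → ∑-cong (split (proj₂ p)) λ q → splitVec-coassoc coassoc xs
         (λ u v w → f (proj₁ p ∷ u) (proj₁ q ∷ v) (proj₂ q ∷ w))) ⟩
  (∑[ p ∈ split x ] ∑[ q ∈ split (proj₂ p) ] ∑[ ps ∈ splitVec split xs ] ∑[ qs ∈ splitVec split (proj₂ ps) ]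
    f (proj₁ p ∷ proj₁ ps) (proj₁ q ∷ proj₁ qs) (proj₂ q ∷ proj₂ qs))
    ≡⟨ ∑-cong (split x) (λ p → ∑-swap (split (proj₂ p)) (splitVec split xs) _) ⟩
  (∑[ p ∈ split x ] ∑[ ps ∈ splitVec split xs ] ∑[ q ∈ split (proj₂ p) ] ∑[ qs ∈ splitVec split (proj₂ ps) ]
    f (proj₁ p ∷ proj₁ ps) (proj₁ q ∷ proj₁ qs) (proj₂ q ∷ proj₂ qs))
    ≡⟨ ∑-cong (split x) (λ p → ∑-cong (splitVec split xs) λ ps → ∑-cartesianProductWith _ (split (proj₂ p)) _ _) ⟨
  (∑[ p ∈ split x ] ∑[ ps ∈ splitVec split xs ] ∑[ q ∈ splitVec split (proj₂ p ∷ proj₂ ps) ]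
    f (proj₁ p ∷ proj₁ ps) (proj₁ q) (proj₂ q))
    ≡⟨ ∑-cartesianProductWith _ (split x) _ _ ⟨
  (∑[ p ∈ splitVec split (x ∷ xs) ] ∑[ q ∈ splitVec split (proj₂ p) ] f (proj₁ p) (proj₁ q) (proj₂ q)) ∎
  where open ≡-Reasoning

∑-upTo-suc : ∀ k (f : ℕ → ℚ) → ∑ (upTo (suc k)) f ≡ f 0 ℚ.+ ∑ (upTo k) (f ∘ suc)
∑-upTo-suc k f = cong (f 0 ℚ.+_) (trans (cong (λ l → ∑ l f) (sym (List.map-upTo suc k))) (∑-map suc (upTo k) f))

-- Unfolds to the splitting of a single exponent that `factorisations` uses anonymously.
splitℕ : ℕ → List (ℕ × ℕ)
splitℕ x = map (λ y → y , x ∸ y) (upTo (suc x))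

∑-splitℕ-suc : ∀ x (f : ℕ × ℕ → ℚ) →
  ∑ (splitℕ (suc x)) f ≡ f (0 , suc x) ℚ.+ (∑[ p ∈ splitℕ x ] f (suc (proj₁ p) , proj₂ p))
∑-splitℕ-suc x f = begin
  ∑ (splitℕ (suc x)) f                                                    ≡⟨ ∑-map _ (upTo (suc (suc x))) f ⟩
  (∑[ y ∈ upTo (suc (suc x)) ] f (y , suc x ∸ y))                         ≡⟨ ∑-upTo-suc (suc x) (λ y → f (y , suc x ∸ y)) ⟩
  f (0 , suc x) ℚ.+ (∑[ y ∈ upTo (suc x) ] f (suc y , x ∸ y))             ≡⟨ cong (f (0 , suc x) ℚ.+_) (∑-map (λ y → y , x ∸ y) (upTo (suc x)) (λ p → f (suc (proj₁ p) , proj₂ p))) ⟨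
  f (0 , suc x) ℚ.+ (∑[ p ∈ splitℕ x ] f (suc (proj₁ p) , proj₂ p))       ∎
  where open ≡-Reasoning

splitℕ-∈⁺ : ∀ {x y y′} → y + y′ ≡ x → (y , y′) ∈ splitℕ x
splitℕ-∈⁺ {y = y} {y′} refl = subst (λ w → (y , w) ∈ splitℕ (y + y′)) (m+n∸m≡n y y′)
  (∈-map⁺ _ (∈-upTo⁺ (s≤s (m≤m+n y y′))))

splitℕ-∈⁻ : ∀ {x y y′} → (y , y′) ∈ splitℕ x → y + y′ ≡ x
splitℕ-∈⁻ {x} p∈ with ∈-map⁻ _ p∈
... | y , y∈ , refl = m+[n∸m]≡n (s≤s⁻¹ (∈-upTo⁻ y∈))

splitℕ-unique : ∀ x → Unique (splitℕ x)
splitℕ-unique x = Unique.map⁺ (λ eq → proj₁ (,-injective eq)) (Unique.upTo⁺ (suc x))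

-- On both sides the triples with first entry 0 are separated from the others; lowering a positive
-- first entry by one leaves the triples that belong to `x`.
splitℕ-coassoc : Coassociative splitℕ
splitℕ-coassoc zero    f = refl
splitℕ-coassoc (suc x) f = begin
  (∑[ p ∈ splitℕ (suc x) ] ∑[ q ∈ splitℕ (proj₁ p) ] f (proj₁ q) (proj₂ q) (proj₂ p))
    ≡⟨ ∑-splitℕ-suc x (λ p → ∑[ q ∈ splitℕ (proj₁ p) ] f (proj₁ q) (proj₂ q) (proj₂ p)) ⟩
  (f 0 0 (suc x) ℚ.+ 0ℚ) ℚ.+ (∑[ p ∈ splitℕ x ] ∑[ q ∈ splitℕ (suc (proj₁ p)) ] f (proj₁ q) (proj₂ q) (proj₂ p))
    ≡⟨ cong₂ ℚ._+_ (ℚ.+-identityʳ (f 0 0 (suc x)))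
         (∑-cong (splitℕ x) λ p → ∑-splitℕ-suc (proj₁ p) (λ q → f (proj₁ q) (proj₂ q) (proj₂ p))) ⟩
  f 0 0 (suc x) ℚ.+ (∑[ p ∈ splitℕ x ] (f 0 (suc (proj₁ p)) (proj₂ p) ℚ.+
    (∑[ q ∈ splitℕ (proj₁ p) ] f (suc (proj₁ q)) (proj₂ q) (proj₂ p))))
    ≡⟨ cong (f 0 0 (suc x) ℚ.+_) (∑-+ (splitℕ x) (λ p → f 0 (suc (proj₁ p)) (proj₂ p))
         (λ p → ∑[ q ∈ splitℕ (proj₁ p) ] f (suc (proj₁ q)) (proj₂ q) (proj₂ p))) ⟩
  f 0 0 (suc x) ℚ.+ ((∑[ p ∈ splitℕ x ] f 0 (suc (proj₁ p)) (proj₂ p)) ℚ.+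
    (∑[ p ∈ splitℕ x ] ∑[ q ∈ splitℕ (proj₁ p) ] f (suc (proj₁ q)) (proj₂ q) (proj₂ p)))
    ≡⟨ ℚ.+-assoc (f 0 0 (suc x)) _ _ ⟨
  (f 0 0 (suc x) ℚ.+ (∑[ p ∈ splitℕ x ] f 0 (suc (proj₁ p)) (proj₂ p))) ℚ.+
    (∑[ p ∈ splitℕ x ] ∑[ q ∈ splitℕ (proj₁ p) ] f (suc (proj₁ q)) (proj₂ q) (proj₂ p))
    ≡⟨ cong₂ ℚ._+_ (sym (∑-splitℕ-suc x (λ q → f 0 (proj₁ q) (proj₂ q)))) (splitℕ-coassoc x (f ∘ suc)) ⟩
  (∑[ q ∈ splitℕ (suc x) ] f 0 (proj₁ q) (proj₂ q)) ℚ.+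
    (∑[ p ∈ splitℕ x ] ∑[ q ∈ splitℕ (proj₂ p) ] f (suc (proj₁ p)) (proj₁ q) (proj₂ q))
    ≡⟨ ∑-splitℕ-suc x (λ p → ∑[ q ∈ splitℕ (proj₂ p) ] f (proj₁ p) (proj₁ q) (proj₂ q)) ⟨
  (∑[ p ∈ splitℕ (suc x) ] ∑[ q ∈ splitℕ (proj₂ p) ] f (proj₁ p) (proj₁ q) (proj₂ q)) ∎
  where open ≡-Reasoning

-- The convolution product of series.

module Convolution {a b : ℕ} where

  infixl 6 _+ᴹ_
  _+ᴹ_ : Monomial a b → Monomial a b → Monomial a b
  _+ᴹ_ = Vec.zipWith (Vec.zipWith _+_)

  0ᴹ : Monomial a b
  0ᴹ = Vec.replicate a (Vec.replicate b 0)

  +ᴹ-comm : ∀ y y′ → y +ᴹ y′ ≡ y′ +ᴹ y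
  +ᴹ-comm = Vec.zipWith-comm (Vec.zipWith-comm +-comm)

  +ᴹ-identityˡ : ∀ y → 0ᴹ +ᴹ y ≡ y
  +ᴹ-identityˡ = Vec.zipWith-identityˡ (Vec.zipWith-identityˡ λ _ → refl)

  ∈-factorisations⁺ : ∀ {e y y′ : Monomial a b} → y +ᴹ y′ ≡ e → (y , y′) ∈ factorisations e
  ∈-factorisations⁺ = splitVec-∈⁺ (splitVec-∈⁺ splitℕ-∈⁺)

  ∈-factorisations⁻ : ∀ {e y y′ : Monomial a b} → (y , y′) ∈ factorisations e → y +ᴹ y′ ≡ e
  ∈-factorisations⁻ = splitVec-∈⁻ (splitVec-∈⁻ splitℕ-∈⁻)

  factorisations-unique : ∀ (e : Monomial a b) → Unique (factorisations e)
  factorisations-unique = splitVec-unique (splitVec-unique splitℕ-unique)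

  _≟ᴾ_ : DecidableEquality (Monomial a b × Monomial a b)
  _≟ᴾ_ = ≡-dec _≟ᴹ_ _≟ᴹ_

  infixl 7 _⊛_
  -- The product `*ˢ` at one fixed size of monomials, so that it also applies to functions that are
  -- only given at this size.
  _⊛_ : (Monomial a b → ℚ) → (Monomial a b → ℚ) → Monomial a b → ℚ
  (F ⊛ G) e = ∑[ p ∈ factorisations e ] F (proj₁ p) ℚ.* G (proj₂ p)

  ⊛-cong : ∀ {F F′ G G′} → F ≗ F′ → G ≗ G′ → F ⊛ G ≗ F′ ⊛ G′
  ⊛-cong F≗ G≗ e = ∑-cong (factorisations e) λ p → cong₂ ℚ._*_ (F≗ (proj₁ p)) (G≗ (proj₂ p))

  ⊛-congˡ : ∀ F {G G′} → G ≗ G′ → F ⊛ G ≗ F ⊛ G′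
  ⊛-congˡ F = ⊛-cong {F} (λ _ → refl)

  ⊛-congʳ : ∀ {F F′} G → F ≗ F′ → F ⊛ G ≗ F′ ⊛ G
  ⊛-congʳ G F≗ = ⊛-cong {G = G} F≗ (λ _ → refl)

  ⊛-comm : ∀ F G → F ⊛ G ≗ G ⊛ F
  ⊛-comm F G e = trans
    (∑-reindex _≟ᴾ_ {xs = factorisations e} {ys = factorisations e} swap
      (factorisations-unique e) (factorisations-unique e)
      (λ _ _ → cong swap)
      (λ {(y , y′)} p∈ → ∈-factorisations⁺ {e} (trans (+ᴹ-comm y′ y) (∈-factorisations⁻ {e} p∈)))
      (λ {(y , y′)} p∈ → inj₁ ((y′ , y) , ∈-factorisations⁺ {e} (trans (+ᴹ-comm y′ y) (∈-factorisations⁻ {e} p∈)) , refl)))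
    (∑-cong (factorisations e) λ p → ℚ.*-comm (F (proj₂ p)) _)

  ⊛-assoc : ∀ F G H → (F ⊛ G) ⊛ H ≗ F ⊛ (G ⊛ H)
  ⊛-assoc F G H e = begin
    (∑[ p ∈ fac e ] (F ⊛ G) (proj₁ p) ℚ.* H (proj₂ p))
      ≡⟨ ∑-cong (fac e) (λ p → ∑-*ʳ (fac (proj₁ p)) (H (proj₂ p)) _) ⟨
    (∑[ p ∈ fac e ] ∑[ q ∈ fac (proj₁ p) ] F (proj₁ q) ℚ.* G (proj₂ q) ℚ.* H (proj₂ p))
      ≡⟨ splitVec-coassoc (splitVec-coassoc splitℕ-coassoc) e (λ u v w → F u ℚ.* G v ℚ.* H w) ⟩
    (∑[ p ∈ fac e ] ∑[ q ∈ fac (proj₂ p) ] F (proj₁ p) ℚ.* G (proj₁ q) ℚ.* H (proj₂ q))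
      ≡⟨ ∑-cong (fac e) (λ p → trans (∑-cong (fac (proj₂ p)) λ q → ℚ.*-assoc (F (proj₁ p)) _ _)
                                      (∑-*ˡ (fac (proj₂ p)) (F (proj₁ p)) _)) ⟩
    (∑[ p ∈ fac e ] F (proj₁ p) ℚ.* (G ⊛ H) (proj₂ p)) ∎
    where
    open ≡-Reasoning
    fac = factorisations

  ⊛-leftComm : ∀ F G H → F ⊛ (G ⊛ H) ≗ G ⊛ (F ⊛ H)
  ⊛-leftComm F G H e = trans (sym (⊛-assoc F G H e))
    (trans (⊛-cong (⊛-comm F G) (λ _ → refl) e) (⊛-assoc G F H e))

  ⊛-zeroˡ : ∀ {F} G → (∀ e → F e ≡ 0ℚ) → ∀ e → (F ⊛ G) e ≡ 0ℚ
  ⊛-zeroˡ G F≡0 e = ∑-zero (factorisations e) λ {p} _ →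
    trans (cong (ℚ._* G (proj₂ p)) (F≡0 (proj₁ p))) (ℚ.*-zeroˡ (G (proj₂ p)))

  ⊛-identityˡ : ∀ F → 1ˢ ⊛ F ≗ F
  ⊛-identityˡ F e = trans
    (∑-single (λ p → 1ˢ (proj₁ p) ℚ.* F (proj₂ p)) (factorisations-unique e) (∈-factorisations⁺ (+ᴹ-identityˡ e)) off)
    (trans (cong (ℚ._* F e) (𝟙-yes (0ᴹ ≟ᴹ 0ᴹ) refl)) (ℚ.*-identityˡ (F e)))
    where
    off : ∀ {p} → p ∈ factorisations e → p ≢ (0ᴹ , e) → 1ˢ (proj₁ p) ℚ.* F (proj₂ p) ≡ 0ℚ
    off {y , y′} p∈ p≢ = trans
      (cong (ℚ._* F y′) (𝟙-no (y ≟ᴹ 0ᴹ) λ { refl → p≢ (cong (0ᴹ ,_) (trans (sym (+ᴹ-identityˡ y′)) (∈-factorisations⁻ {e} p∈))) }))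
      (ℚ.*-zeroˡ (F y′))

  ⊛-∑ˡ : ∀ {I : Set} (is : List I) (F : I → Monomial a b → ℚ) G e →
         ((λ y → ∑[ i ∈ is ] F i y) ⊛ G) e ≡ (∑[ i ∈ is ] (F i ⊛ G) e)
  ⊛-∑ˡ is F G e = trans
    (∑-cong (factorisations e) λ p → sym (∑-*ʳ is (G (proj₂ p)) _))
    (∑-swap (factorisations e) is _)

  ⊛-+ˡ : ∀ F F′ G e → ((λ y → F y ℚ.+ F′ y) ⊛ G) e ≡ (F ⊛ G) e ℚ.+ (F′ ⊛ G) e
  ⊛-+ˡ F F′ G e = trans (∑-cong (factorisations e) λ p → ℚ.*-distribʳ-+ (G (proj₂ p)) (F (proj₁ p)) (F′ (proj₁ p))) (∑-+ (factorisations e) _ _)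

  ⊛-*ˡ : ∀ c F G e → ((λ y → c ℚ.* F y) ⊛ G) e ≡ c ℚ.* (F ⊛ G) e
  ⊛-*ˡ c F G e = trans (∑-cong (factorisations e) λ p → ℚ.*-assoc c _ _) (∑-*ˡ (factorisations e) c _)

-- Substituting powers for the variables.

module _ {_∙_ : A → A → A} {_∘′_ : B → B → B} where

  map-zipWith-distrib : ∀ {h : A → B} → (∀ x y → h (x ∙ y) ≡ h x ∘′ h y) →
    ∀ {k} (xs ys : Vec A k) → Vec.map h (Vec.zipWith _∙_ xs ys) ≡ Vec.zipWith _∘′_ (Vec.map h xs) (Vec.map h ys)
  map-zipWith-distrib hom []       []       = refl
  map-zipWith-distrib hom (x ∷ xs) (y ∷ ys) = cong₂ _∷_ (hom x y) (map-zipWith-distrib hom xs ys)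

map-injective : ∀ {h : A → B} → (∀ {x y} → h x ≡ h y → x ≡ y) →
                ∀ {k} {xs ys : Vec A k} → Vec.map h xs ≡ Vec.map h ys → xs ≡ ys
map-injective inj {xs = []}     {[]}     _  = refl
map-injective inj {xs = x ∷ xs} {y ∷ ys} eq =
  cong₂ _∷_ (inj (Vec.∷-injectiveˡ eq)) (map-injective inj (Vec.∷-injectiveʳ eq))

zipWith-cancelˡ : ∀ {_∙_ : A → B → C} → (∀ x {y z} → x ∙ y ≡ x ∙ z → y ≡ z) →
  ∀ {k} (xs : Vec A k) {ys zs} → Vec.zipWith _∙_ xs ys ≡ Vec.zipWith _∙_ xs zs → ys ≡ zs
zipWith-cancelˡ cancel []       {[]}     {[]}     _  = refl
zipWith-cancelˡ cancel (x ∷ xs) {y ∷ ys} {z ∷ zs} eq =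
  cong₂ _∷_ (cancel x (Vec.∷-injectiveˡ eq)) (zipWith-cancelˡ cancel xs (Vec.∷-injectiveʳ eq))

map-zipWith-const : ∀ {f : A → B → C} {g : C → A} {h : C → B} {h′ : C → C} → (∀ x → f (g x) (h x) ≡ h′ x) →
  ∀ {k} (xs : Vec C k) → Vec.zipWith f (Vec.map g xs) (Vec.map h xs) ≡ Vec.map h′ xs
map-zipWith-const eq []       = refl
map-zipWith-const eq (x ∷ xs) = cong₂ _∷_ (eq x) (map-zipWith-const eq xs)

module Substitution {a b : ℕ} where
  open Convolution {a} {b}

  private
    variable
      F G : Monomial a b → ℚ
      e : Monomial a b

  +ᴹ-cancelˡ : ∀ (y : Monomial a b) {u v} → y +ᴹ u ≡ y +ᴹ v → u ≡ v
  +ᴹ-cancelˡ = zipWith-cancelˡ (zipWith-cancelˡ (λ x → +-cancelˡ-≡ x _ _))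

  +ᴹ-^ᴹ : ∀ r (y u : Monomial a b) → (y +ᴹ u) ^ᴹ r ≡ (y ^ᴹ r) +ᴹ (u ^ᴹ r)
  +ᴹ-^ᴹ r = map-zipWith-distrib (map-zipWith-distrib (*-distribˡ-+ r))

  ^ᴹ-injective : ∀ r {y u : Monomial a b} → y ^ᴹ suc r ≡ u ^ᴹ suc r → y ≡ u
  ^ᴹ-injective r = map-injective (map-injective (λ {x} {y} → *-cancelˡ-≡ x y (suc r)))

  -- A root divides its power, with an explicit cofactor. This matters because `_[x^_]` looks for
  -- roots only among the divisors of the monomial.
  ^ᴹ-suc : ∀ r (y : Monomial a b) → y +ᴹ (y ^ᴹ r) ≡ y ^ᴹ suc r
  ^ᴹ-suc r y = trans (cong (_+ᴹ (y ^ᴹ r)) (sym (trans (Vec.map-cong Vec.map-id y) (Vec.map-id y))))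
    (map-zipWith-const (λ xs → map-zipWith-const (λ _ → refl) xs) y)

  ^ᴹ-^ᴹ : ∀ r s (y : Monomial a b) → (y ^ᴹ s) ^ᴹ r ≡ y ^ᴹ (s * r)
  ^ᴹ-^ᴹ r s y = trans (sym (Vec.map-∘ _ _ y)) (Vec.map-cong (λ xs → trans (sym (Vec.map-∘ _ _ xs))
    (Vec.map-cong (λ x → trans (sym (*-assoc r s x)) (cong (_* x) (*-comm r s))) xs)) y)

  pow : ℕ → (Monomial a b → ℚ) → Monomial a b → ℚ
  pow r F e = ∑[ p ∈ filter (λ p → (proj₁ p ^ᴹ r) ≟ᴹ e) (factorisations e) ] F (proj₁ p)

  IsPower : ℕ → Monomial a b → Set
  IsPower r e = ∃[ y ] y ^ᴹ r ≡ e

  -- Roots are divisors, so a search through the factorisations is exhaustive. Splitting on this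
  -- decision computes `pow` everywhere: `pow-^ᴹ` applies at a power and `pow-nonpower` elsewhere.
  isPower? : ∀ r e → Dec (IsPower (suc r) e)
  isPower? r e = map′ to from (any? (λ p → (proj₁ p ^ᴹ suc r) ≟ᴹ e) (factorisations e))
    where
    to : _ → IsPower (suc r) e
    to any with find any
    ... | p , _ , eq = proj₁ p , eq
    from : IsPower (suc r) e → _
    from (y , refl) = lose (∈-factorisations⁺ {e} (^ᴹ-suc r y)) refl

  pow-^ᴹ : ∀ r F y → pow (suc r) F (y ^ᴹ suc r) ≡ F y
  pow-^ᴹ r F y = begin
    pow (suc r) F (y ^ᴹ suc r)
      ≡⟨ ∑-filter _ (factorisations (y ^ᴹ suc r)) _ ⟩
    (∑[ p ∈ factorisations (y ^ᴹ suc r) ] 𝟙 ((proj₁ p ^ᴹ suc r) ≟ᴹ (y ^ᴹ suc r)) ℚ.* F (proj₁ p))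
      ≡⟨ ∑-single _ (factorisations-unique (y ^ᴹ suc r)) (∈-factorisations⁺ (^ᴹ-suc r y)) off ⟩
    𝟙 ((y ^ᴹ suc r) ≟ᴹ (y ^ᴹ suc r)) ℚ.* F y
      ≡⟨ cong (ℚ._* F y) (𝟙-yes ((y ^ᴹ suc r) ≟ᴹ (y ^ᴹ suc r)) refl) ⟩
    1ℚ ℚ.* F y
      ≡⟨ ℚ.*-identityˡ (F y) ⟩
    F y ∎
    where
    open ≡-Reasoning
    off : ∀ {p} → p ∈ factorisations (y ^ᴹ suc r) → p ≢ (y , y ^ᴹ r) →
          𝟙 ((proj₁ p ^ᴹ suc r) ≟ᴹ (y ^ᴹ suc r)) ℚ.* F (proj₁ p) ≡ 0ℚ
    off {u , v} p∈ p≢ = trans (cong (ℚ._* F u) (𝟙-no ((u ^ᴹ suc r) ≟ᴹ (y ^ᴹ suc r)) λ eq → p≢ (same (^ᴹ-injective r eq))))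
                              (ℚ.*-zeroˡ (F u))
      where
      same : u ≡ y → (u , v) ≡ (y , y ^ᴹ r)
      same refl = cong (u ,_) (+ᴹ-cancelˡ u (trans (∈-factorisations⁻ {y ^ᴹ suc r} p∈) (sym (^ᴹ-suc r u))))

  pow-nonpower : ∀ r F {e} → ¬ IsPower r e → pow r F e ≡ 0ℚ
  pow-nonpower r F {e} ¬pow = trans (∑-filter _ (factorisations e) _) (∑-zero (factorisations e) λ {p} _ →
    trans (cong (ℚ._* F (proj₁ p)) (𝟙-no ((proj₁ p ^ᴹ r) ≟ᴹ e) λ eq → ¬pow (proj₁ p , eq))) (ℚ.*-zeroˡ (F (proj₁ p))))

  pow-cong : ∀ r → F ≗ G → pow r F ≗ pow r G
  pow-cong r F≗G e = ∑-cong (filter (λ p → (proj₁ p ^ᴹ r) ≟ᴹ e) (factorisations e)) (λ p → F≗G (proj₁ p))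

  pow-∑ : ∀ r {I : Set} (is : List I) (F : I → Monomial a b → ℚ) e →
          pow r (λ y → ∑[ i ∈ is ] F i y) e ≡ (∑[ i ∈ is ] pow r (F i) e)
  pow-∑ r is F e = ∑-swap (filter (λ p → (proj₁ p ^ᴹ r) ≟ᴹ e) (factorisations e)) is _

  pow-* : ∀ r c F e → pow r (λ y → c ℚ.* F y) e ≡ c ℚ.* pow r F e
  pow-* r c F e = ∑-*ˡ (filter (λ p → (proj₁ p ^ᴹ r) ≟ᴹ e) (factorisations e)) c _

  pow-+ : ∀ r F G e → pow r (λ y → F y ℚ.+ G y) e ≡ pow r F e ℚ.+ pow r G e
  pow-+ r F G e = ∑-+ (filter (λ p → (proj₁ p ^ᴹ r) ≟ᴹ e) (factorisations e)) _ _

  pow-pow : ∀ r s F → pow (suc r) (pow (suc s) F) ≗ pow (suc s * suc r) F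
  pow-pow r s F e with isPower? r e
  ... | no ¬pow = trans (pow-nonpower (suc r) _ ¬pow) (sym (pow-nonpower (suc s * suc r) F λ (y , eq) →
                    ¬pow (y ^ᴹ suc s , trans (^ᴹ-^ᴹ (suc r) (suc s) y) eq)))
  ... | yes (y , refl) with isPower? s y
  ...   | no ¬pow = trans (pow-^ᴹ r _ y) (trans (pow-nonpower (suc s) F ¬pow) (sym (pow-nonpower (suc s * suc r) F λ (x , eq) →
                      ¬pow (x , ^ᴹ-injective r (trans (^ᴹ-^ᴹ (suc r) (suc s) x) eq)))))
  ...   | yes (x , refl) = trans (pow-^ᴹ r (pow (suc s) F) (x ^ᴹ suc s)) (trans (pow-^ᴹ s F x)
                             (trans (sym (pow-^ᴹ (r + s * suc r) F x)) (cong (pow (suc s * suc r) F) (sym (^ᴹ-^ᴹ (suc r) (suc s) x)))))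

  -- A factorisation contributes on the right only if both of its factors are powers. Their product
  -- is then a power as well, and taking roots matches such factorisations with those of the root.
  pow-⊛ : ∀ r F G → pow (suc r) (F ⊛ G) ≗ pow (suc r) F ⊛ pow (suc r) G
  pow-⊛ r F G e with isPower? r e
  ... | no ¬pow = trans (pow-nonpower (suc r) _ ¬pow) (sym (∑-zero (factorisations e) (λ p∈ → zeroTerm p∈)))
    where
    zeroTerm : ∀ {p} → p ∈ factorisations e → pow (suc r) F (proj₁ p) ℚ.* pow (suc r) G (proj₂ p) ≡ 0ℚ
    zeroTerm {u , v} p∈ with isPower? r u | isPower? r v
    ... | no ¬u | _ = trans (cong (ℚ._* pow (suc r) G v) (pow-nonpower (suc r) F ¬u)) (ℚ.*-zeroˡ (pow (suc r) G v))
    ... | yes _ | no ¬v = trans (cong (pow (suc r) F u ℚ.*_) (pow-nonpower (suc r) G ¬v)) (ℚ.*-zeroʳ (pow (suc r) F u))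
    ... | yes (x , refl) | yes (y , refl) = ⊥-elim (¬pow (x +ᴹ y , trans (+ᴹ-^ᴹ (suc r) x y) (∈-factorisations⁻ {e} p∈)))
  ... | yes (x , refl) = begin
    pow (suc r) (F ⊛ G) (x ^ᴹ suc r)
      ≡⟨ pow-^ᴹ r _ x ⟩
    (∑[ p ∈ factorisations x ] F (proj₁ p) ℚ.* G (proj₂ p))
      ≡⟨ ∑-cong (factorisations x) (λ p → cong₂ ℚ._*_ (pow-^ᴹ r F (proj₁ p)) (pow-^ᴹ r G (proj₂ p))) ⟨
    (∑[ p ∈ factorisations x ] term (φ p))
      ≡⟨ ∑-reindex _≟ᴾ_ φ (factorisations-unique (x ^ᴹ suc r)) (factorisations-unique x) inj into onto ⟨
    (∑[ p ∈ factorisations (x ^ᴹ suc r) ] term p) ∎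
    where
    open ≡-Reasoning
    φ : Monomial a b × Monomial a b → Monomial a b × Monomial a b
    φ (u , v) = u ^ᴹ suc r , v ^ᴹ suc r
    term : Monomial a b × Monomial a b → ℚ
    term p = pow (suc r) F (proj₁ p) ℚ.* pow (suc r) G (proj₂ p)
    inj : ∀ {p q} → p ∈ factorisations x → q ∈ factorisations x → φ p ≡ φ q → p ≡ q
    inj _ _ eq = cong₂ _,_ (^ᴹ-injective r (cong proj₁ eq)) (^ᴹ-injective r (cong proj₂ eq))
    into : ∀ {p} → p ∈ factorisations x → φ p ∈ factorisations (x ^ᴹ suc r)
    into {u , v} p∈ = ∈-factorisations⁺ (trans (sym (+ᴹ-^ᴹ (suc r) u v)) (cong (_^ᴹ suc r) (∈-factorisations⁻ {x} p∈)))
    onto : ∀ {p} → p ∈ factorisations (x ^ᴹ suc r) → (∃[ q ] (q ∈ factorisations x × p ≡ φ q)) ⊎ term p ≡ 0ℚ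
    onto {u , v} p∈ with isPower? r u | isPower? r v
    ... | no ¬u | _ = inj₂ (trans (cong (ℚ._* pow (suc r) G v) (pow-nonpower (suc r) F ¬u)) (ℚ.*-zeroˡ (pow (suc r) G v)))
    ... | yes _ | no ¬v = inj₂ (trans (cong (pow (suc r) F u ℚ.*_) (pow-nonpower (suc r) G ¬v)) (ℚ.*-zeroʳ (pow (suc r) F u)))
    ... | yes (y , refl) | yes (y′ , refl) = inj₁ ((y , y′) , ∈-factorisations⁺
            (^ᴹ-injective r (trans (+ᴹ-^ᴹ (suc r) y y′) (∈-factorisations⁻ {x ^ᴹ suc r} p∈))) , refl)

-- Natural numbers and their reciprocals in ℚ.

toℚᵘ-/ : ∀ p k → ℚ.toℚᵘ (p ℚ./ suc k) ℚᵘ.≃ mkℚᵘ p k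
toℚᵘ-/ p k = ℚ.toℚᵘ-fromℚᵘ (mkℚᵘ p k)

/-split : ∀ p k → p ℚ./ suc k ≡ (p ℚ./ 1) ℚ.* (ℤ.1ℤ ℚ./ suc k)
/-split p k = ℚ.toℚᵘ-injective (begin
  ℚ.toℚᵘ (p ℚ./ suc k)                            ≈⟨ toℚᵘ-/ p k ⟩
  mkℚᵘ p k                                        ≈⟨ *≡* (trans (cong (λ j → p ℤ.* (ℤ.+ suc j)) (+-identityʳ k)) (cong (ℤ._* (ℤ.+ suc k)) (sym (ℤ.*-identityʳ p)))) ⟩
  mkℚᵘ p 0 ℚᵘ.* mkℚᵘ ℤ.1ℤ k                       ≈⟨ ℚᵘ.*-cong (toℚᵘ-/ p 0) (toℚᵘ-/ ℤ.1ℤ k) ⟨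
  ℚ.toℚᵘ (p ℚ./ 1) ℚᵘ.* ℚ.toℚᵘ (ℤ.1ℤ ℚ./ suc k)   ≈⟨ ℚ.toℚᵘ-homo-* (p ℚ./ 1) (ℤ.1ℤ ℚ./ suc k) ⟨
  ℚ.toℚᵘ ((p ℚ./ 1) ℚ.* (ℤ.1ℤ ℚ./ suc k))         ∎)
  where open ℚᵘ.≃-Reasoning

/1-* : ∀ p q → (p ℤ.* q) ℚ./ 1 ≡ (p ℚ./ 1) ℚ.* (q ℚ./ 1)
/1-* p q = ℚ.toℚᵘ-injective (begin
  ℚ.toℚᵘ ((p ℤ.* q) ℚ./ 1)                        ≈⟨ toℚᵘ-/ (p ℤ.* q) 0 ⟩
  mkℚᵘ p 0 ℚᵘ.* mkℚᵘ q 0                          ≈⟨ ℚᵘ.*-cong (toℚᵘ-/ p 0) (toℚᵘ-/ q 0) ⟨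
  ℚ.toℚᵘ (p ℚ./ 1) ℚᵘ.* ℚ.toℚᵘ (q ℚ./ 1)          ≈⟨ ℚ.toℚᵘ-homo-* (p ℚ./ 1) (q ℚ./ 1) ⟨
  ℚ.toℚᵘ ((p ℚ./ 1) ℚ.* (q ℚ./ 1))                ∎)
  where open ℚᵘ.≃-Reasoning

opaque

  -- Opaque, so that `ι k` remains an atom in ring computations instead of unfolding to a normalised
  -- fraction.
  ι : ℕ → ℚ
  ι k = (ℤ.+ k) ℚ./ 1

  ι-def : ∀ k → ι k ≡ (ℤ.+ k) ℚ./ 1
  ι-def k = refl

  ι-0 : ι 0 ≡ 0ℚ
  ι-0 = refl

  ι-1 : ι 1 ≡ 1ℚ
  ι-1 = refl

  ι-+ : ∀ j k → ι (j + k) ≡ ι j ℚ.+ ι k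
  ι-+ j k = ℚ.toℚᵘ-injective (begin
    ℚ.toℚᵘ (ι (j + k))                              ≈⟨ toℚᵘ-/ (ℤ.+ (j + k)) 0 ⟩
    mkℚᵘ (ℤ.+ (j + k)) 0                            ≈⟨ *≡* (cong (ℤ._* ℤ.+ 1) (sym (cong₂ ℤ._+_ (ℤ.*-identityʳ (ℤ.+ j)) (ℤ.*-identityʳ (ℤ.+ k))))) ⟩
    mkℚᵘ (ℤ.+ j) 0 ℚᵘ.+ mkℚᵘ (ℤ.+ k) 0              ≈⟨ ℚᵘ.+-cong (toℚᵘ-/ (ℤ.+ j) 0) (toℚᵘ-/ (ℤ.+ k) 0) ⟨
    ℚ.toℚᵘ (ι j) ℚᵘ.+ ℚ.toℚᵘ (ι k)                  ≈⟨ ℚ.toℚᵘ-homo-+ (ι j) (ι k) ⟨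
    ℚ.toℚᵘ (ι j ℚ.+ ι k)                            ∎)
    where open ℚᵘ.≃-Reasoning

  ι-* : ∀ j k → ι (j * k) ≡ ι j ℚ.* ι k
  ι-* j k = trans (cong (ℚ._/ 1) (ℤ.pos-* j k)) (/1-* (ℤ.+ j) (ℤ.+ k))

  -- The value 0 at 0 makes this a total function that is still multiplicative, so no proofs of
  -- nonzeroness accompany the products below.
  recip : ℕ → ℚ
  recip zero    = 0ℚ
  recip (suc k) = ℤ.1ℤ ℚ./ suc k

  recip-0 : recip 0 ≡ 0ℚ
  recip-0 = refl

  recip-def : ∀ k → recip (suc k) ≡ ℤ.1ℤ ℚ./ suc k
  recip-def k = refl

  ι-recip : ∀ k → ι (suc k) ℚ.* recip (suc k) ≡ 1ℚ
  ι-recip k = trans (sym (/-split (ℤ.+ suc k) k)) (ℚ.toℚᵘ-injective (ℚᵘ.≃-trans (toℚᵘ-/ (ℤ.+ suc k) k) (*≡* (ℤ.*-comm (ℤ.+ suc k) ℤ.1ℤ))))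

ι-cancelˡ : ∀ k {p q} → ι (suc k) ℚ.* p ≡ ι (suc k) ℚ.* q → p ≡ q
ι-cancelˡ k {p} {q} eq = begin
  p                                    ≡⟨ lemma p ⟨
  recip (suc k) ℚ.* (ι (suc k) ℚ.* p)  ≡⟨ cong (recip (suc k) ℚ.*_) eq ⟩
  recip (suc k) ℚ.* (ι (suc k) ℚ.* q)  ≡⟨ lemma q ⟩
  q                                    ∎
  where
  open ≡-Reasoning
  lemma : ∀ x → recip (suc k) ℚ.* (ι (suc k) ℚ.* x) ≡ x
  lemma x = begin
    recip (suc k) ℚ.* (ι (suc k) ℚ.* x)  ≡⟨ ℚ.*-assoc (recip (suc k)) (ι (suc k)) x ⟨
    recip (suc k) ℚ.* ι (suc k) ℚ.* x    ≡⟨ cong (ℚ._* x) (trans (ℚ.*-comm (recip (suc k)) (ι (suc k))) (ι-recip k)) ⟩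
    1ℚ ℚ.* x                             ≡⟨ ℚ.*-identityˡ x ⟩
    x                                    ∎

ι-sum : ∀ (xs : List A) (f : A → ℕ) → ι (sum (map f xs)) ≡ (∑[ x ∈ xs ] ι (f x))
ι-sum []       f = ι-0
ι-sum (x ∷ xs) f = trans (ι-+ (f x) _) (cong (ι (f x) ℚ.+_) (ι-sum xs f))

sum-map-cong : ∀ (xs : List A) {f g : A → ℕ} → (∀ x → f x ≡ g x) → sum (map f xs) ≡ sum (map g xs)
sum-map-cong xs f≡g = cong sum (List.map-cong f≡g xs)

sum-map-+ : ∀ (xs : List A) (f g : A → ℕ) → sum (map (λ x → f x + g x) xs) ≡ sum (map f xs) + sum (map g xs)
sum-map-+ []       f g = refl
sum-map-+ (x ∷ xs) f g = trans (cong (f x + g x +_) (sum-map-+ xs f g)) 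
  (solve 4 (λ a b c d → (a :+ b) :+ (c :+ d) := (a :+ c) :+ (b :+ d)) refl (f x) (g x) (sum (map f xs)) (sum (map g xs)))
  where open ℕSolver

sum-map-zero : ∀ (xs : List A) {f : A → ℕ} → (∀ {x} → x ∈ xs → f x ≡ 0) → sum (map f xs) ≡ 0
sum-map-zero []       f≡0 = refl
sum-map-zero (x ∷ xs) f≡0 = cong₂ _+_ (f≡0 (here refl)) (sum-map-zero xs (f≡0 ∘ there))

∈⇒≤sum : ∀ {x xs} → x ∈ xs → x ≤ sum xs
∈⇒≤sum {xs = x ∷ xs} (here refl) = m≤m+n x (sum xs)
∈⇒≤sum {xs = y ∷ xs} (there x∈)  = m≤n⇒m≤o+n y (∈⇒≤sum x∈)

sum-map-single : ∀ {xs : List A} {x} (f : A → ℕ) → Unique xs → x ∈ xs → (∀ {y} → y ≢ x → f y ≡ 0) → sum (map f xs) ≡ f x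
sum-map-single {xs = x ∷ xs} f (x∉ ∷ u) (here refl) f≡0 =
  trans (cong (f x +_) (sum-map-zero xs λ y∈ → f≡0 (λ y≡x → All.lookup x∉ y∈ (sym y≡x)))) (+-identityʳ (f x))
sum-map-single {xs = y ∷ xs} f (y∉ ∷ u) (there x∈) f≡0 =
  cong₂ _+_ (f≡0 (All.lookup y∉ x∈)) (sum-map-single f u x∈ f≡0)

sum-Vec : ∀ {k} (xs : Vec ℕ k) → Vec.sum xs ≡ sum (map (Vec.lookup xs) (allFin k))
sum-Vec []       = refl
sum-Vec (x ∷ xs) = cong (x +_) (trans (sum-Vec xs)
  (cong sum (trans (List.map-tabulate (λ i → i) (Vec.lookup xs)) (sym (List.map-tabulate suc (Vec.lookup (x ∷ xs)))))))

-- Exponents and degrees of monomials.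

module Exponents {a b : ℕ} where
  open Convolution {a} {b}
  open Substitution {a} {b}

  exponent : Monomial a b → Fin a → Fin b → ℕ
  exponent e k l = Vec.lookup (Vec.lookup e k) l

  exponent-ext : ∀ {e e′} → (∀ k l → exponent e k l ≡ exponent e′ k l) → e ≡ e′
  exponent-ext {e} {e′} eq = begin
    e                            ≡⟨ Vec.tabulate∘lookup e ⟨
    Vec.tabulate (Vec.lookup e)  ≡⟨ Vec.tabulate-cong (λ k → trans (sym (Vec.tabulate∘lookup (Vec.lookup e k)))
                                      (trans (Vec.tabulate-cong (eq k)) (Vec.tabulate∘lookup (Vec.lookup e′ k)))) ⟩
    Vec.tabulate (Vec.lookup e′) ≡⟨ Vec.tabulate∘lookup e′ ⟩
    e′                           ∎
    where open ≡-Reasoning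

  exponent-+ : ∀ y y′ k l → exponent (y +ᴹ y′) k l ≡ exponent y k l + exponent y′ k l
  exponent-+ y y′ k l = trans (cong (λ v → Vec.lookup v l) (Vec.lookup-zipWith _ k y y′))
                              (Vec.lookup-zipWith _+_ l (Vec.lookup y k) (Vec.lookup y′ k))

  exponent-^ : ∀ y r k l → exponent (y ^ᴹ r) k l ≡ r * exponent y k l
  exponent-^ y r k l = trans (cong (λ v → Vec.lookup v l) (Vec.lookup-map k _ y)) (Vec.lookup-map l (r *_) (Vec.lookup y k))

  exponent-tabulate : ∀ (f : Fin a → Fin b → ℕ) k l → exponent (Vec.tabulate λ k → Vec.tabulate (f k)) k l ≡ f k l
  exponent-tabulate f k l = trans (cong (λ v → Vec.lookup v l) (Vec.lookup∘tabulate _ k)) (Vec.lookup∘tabulate (f k) l)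

  exponent-var : ∀ k l q → exponent (var^ k l q) k l ≡ q
  exponent-var k l q = trans (exponent-tabulate _ k l) eq
    where
    eq : (if does (k Fin.≟ k) then (if does (l Fin.≟ l) then q else 0) else 0) ≡ q
    eq with k Fin.≟ k | l Fin.≟ l
    ... | yes _ | yes _ = refl
    ... | no ¬p | _     = ⊥-elim (¬p refl)
    ... | yes _ | no ¬p = ⊥-elim (¬p refl)

  exponent-var-other : ∀ k l q {k′ l′} → ¬ (k ≡ k′ × l ≡ l′) → exponent (var^ k l q) k′ l′ ≡ 0
  exponent-var-other k l q {k′} {l′} ne = trans (exponent-tabulate _ k′ l′) eq
    where
    eq : (if does (k Fin.≟ k′) then (if does (l Fin.≟ l′) then q else 0) else 0) ≡ 0
    eq with k Fin.≟ k′ | l Fin.≟ l′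
    ... | yes p | yes p′ = ⊥-elim (ne (p , p′))
    ... | no _  | _      = refl
    ... | yes _ | no _   = refl

  same? : ∀ (k k′ : Fin a) (l l′ : Fin b) → Dec (k ≡ k′ × l ≡ l′)
  same? k k′ l l′ = (k Fin.≟ k′) ×-dec (l Fin.≟ l′)

  var-^ : ∀ k l q r → var^ k l q ^ᴹ r ≡ var^ k l (r * q)
  var-^ k l q r = exponent-ext λ k′ l′ → trans (exponent-^ (var^ k l q) r k′ l′) (eq k′ l′)
    where
    eq : ∀ k′ l′ → r * exponent (var^ k l q) k′ l′ ≡ exponent (var^ k l (r * q)) k′ l′
    eq k′ l′ with same? k k′ l l′
    ... | yes (refl , refl) = trans (cong (r *_) (exponent-var k l q)) (sym (exponent-var k l (r * q)))
    ... | no ne = trans (cong (r *_) (exponent-var-other k l q ne)) (trans (*-zeroʳ r) (sym (exponent-var-other k l (r * q) ne)))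

  deg-exponent : ∀ e → deg e ≡ sum (map (λ k → suc (toℕ k) * sum (map (exponent e k) (allFin b))) (allFin a))
  deg-exponent e = sum-map-cong (allFin a) (λ k → cong (suc (toℕ k) *_) (sum-Vec (Vec.lookup e k)))

  deg-+ : ∀ y y′ → deg (y +ᴹ y′) ≡ deg y + deg y′
  deg-+ y y′ = begin
    deg (y +ᴹ y′)
      ≡⟨ deg-exponent (y +ᴹ y′) ⟩
    sum (map (λ k → suc (toℕ k) * sum (map (exponent (y +ᴹ y′) k) (allFin b))) (allFin a))
      ≡⟨ sum-map-cong (allFin a) (λ k → trans (cong (suc (toℕ k) *_) (trans (sum-map-cong (allFin b) (exponent-+ y y′ k))
           (sum-map-+ (allFin b) (exponent y k) (exponent y′ k)))) (*-distribˡ-+ (suc (toℕ k)) (sum (map (exponent y k) (allFin b))) (sum (map (exponent y′ k) (allFin b))))) ⟩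
    sum (map (λ k → suc (toℕ k) * sum (map (exponent y k) (allFin b)) + suc (toℕ k) * sum (map (exponent y′ k) (allFin b))) (allFin a))
      ≡⟨ sum-map-+ (allFin a) _ _ ⟩
    sum (map (λ k → suc (toℕ k) * sum (map (exponent y k) (allFin b))) (allFin a)) + sum (map (λ k → suc (toℕ k) * sum (map (exponent y′ k) (allFin b))) (allFin a))
      ≡⟨ cong₂ _+_ (deg-exponent y) (deg-exponent y′) ⟨
    deg y + deg y′ ∎
    where open ≡-Reasoning

  deg-var : ∀ k l q → deg (var^ k l q) ≡ suc (toℕ k) * q
  deg-var k l q = begin
    deg (var^ k l q)
      ≡⟨ deg-exponent (var^ k l q) ⟩
    sum (map (λ k′ → suc (toℕ k′) * sum (map (exponent (var^ k l q) k′) (allFin b))) (allFin a))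
      ≡⟨ sum-map-single _ (Unique.allFin⁺ a) (∈-allFin k) (λ {k′} k′≢k → trans (cong (suc (toℕ k′) *_)
           (sum-map-zero (allFin b) λ _ → exponent-var-other k l q (λ (k≡k′ , _) → k′≢k (sym k≡k′)))) (*-zeroʳ (suc (toℕ k′)))) ⟩
    suc (toℕ k) * sum (map (exponent (var^ k l q) k) (allFin b))
      ≡⟨ cong (suc (toℕ k) *_) (trans (sum-map-single _ (Unique.allFin⁺ b) (∈-allFin l)
           (λ l′≢l → exponent-var-other k l q (λ (_ , l≡l′) → l′≢l (sym l≡l′)))) (exponent-var k l q)) ⟩
    suc (toℕ k) * q ∎
    where open ≡-Reasoning

  ι-deg : ∀ e → ι (deg e) ≡ (∑[ k ∈ allFin a ] ∑[ l ∈ allFin b ] ι (suc (toℕ k)) ℚ.* ι (exponent e k l))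
  ι-deg e = trans (cong ι (deg-exponent e)) (trans (ι-sum (allFin a) _) (∑-cong (allFin a) λ k →
    trans (ι-* (suc (toℕ k)) _) (trans (cong (ι (suc (toℕ k)) ℚ.*_) (ι-sum (allFin b) _)) (sym (∑-*ˡ (allFin b) (ι (suc (toℕ k))) _)))))

  squareFree⇒ : ∀ {e : Monomial a b} → SquareFree e → ∀ k l → exponent e k l ≤ 1
  squareFree⇒ sf k l = VecAll.lookup⁺ (VecAll.lookup⁺ sf k) l

  squareFree⇐ : ∀ {e : Monomial a b} → (∀ k l → exponent e k l ≤ 1) → SquareFree e
  squareFree⇐ h = VecAll.lookup⁻ λ k → VecAll.lookup⁻ (h k)

-- Newton's identity for E⁺, coefficient by coefficient.

-2ℚ : ℚ
-2ℚ = ℚ.- (1ℚ ℚ.+ 1ℚ)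

-- Passing from a multiple of `suc k` to its quotient turns the divisor sum in `P` into a sum over
-- the powers of one variable. The range on the right is too long; the hypothesis on `g` kills the
-- excess.
∑-quotients : ∀ n k (g : ℕ → ℚ) → (∀ p → n < suc k * suc p → g (suc p) ≡ 0ℚ) →
  (∑[ d ∈ upTo n ] 𝟙 (suc k ∣? suc d) ℚ.* g (suc d / suc k)) ≡ (∑[ p ∈ upTo n ] g (suc p))
∑-quotients n k g g≡0 = begin
  (∑[ d ∈ upTo n ] 𝟙 (suc k ∣? suc d) ℚ.* g (suc d / suc k))
    ≡⟨ ∑-filter (λ d → suc k ∣? suc d) (upTo n) (λ d → g (suc d / suc k)) ⟨
  (∑[ d ∈ multiples ] g (suc d / suc k))
    ≡⟨ ∑-cong-∈ multiples (λ d∈ → cong g (sym (suc-φ (isMultiple d∈)))) ⟩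
  (∑[ d ∈ multiples ] g (suc (φ d)))
    ≡⟨ ∑-reindex _≟_ {f = g ∘ suc} φ (Unique.upTo⁺ n) (Unique.filter⁺ _ (Unique.upTo⁺ n)) inj into onto ⟨
  (∑[ p ∈ upTo n ] g (suc p)) ∎
  where
  open ≡-Reasoning
  multiples = filter (λ d → suc k ∣? suc d) (upTo n)
  isMultiple : ∀ {d} → d ∈ multiples → suc k ∣ suc d
  isMultiple d∈ = proj₂ (∈-filter⁻ (λ d → suc k ∣? suc d) {xs = upTo n} d∈)
  φ : ℕ → ℕ
  φ d = pred (suc d / suc k)
  suc-φ : ∀ {d} → suc k ∣ suc d → suc (φ d) ≡ suc d / suc k
  suc-φ {d} k∣d with suc d / suc k | m*[n/m]≡n k∣d
  ... | zero  | eq = ⊥-elim (0≢1+n (trans (sym (*-zeroʳ (suc k))) eq))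
  ... | suc _ | _  = refl
  recover : ∀ {d} → suc k ∣ suc d → suc k * suc (φ d) ≡ suc d
  recover k∣d = trans (cong (suc k *_) (suc-φ k∣d)) (m*[n/m]≡n k∣d)
  inj : ∀ {d d′} → d ∈ multiples → d′ ∈ multiples → φ d ≡ φ d′ → d ≡ d′
  inj d∈ d′∈ eq = suc-injective (trans (sym (recover (isMultiple d∈)))
    (trans (cong (λ p → suc k * suc p) eq) (recover (isMultiple d′∈))))
  into : ∀ {d} → d ∈ multiples → φ d ∈ upTo n
  into {d} d∈ with ∈-filter⁻ (λ d → suc k ∣? suc d) {xs = upTo n} d∈
  ... | d∈′ , k∣d = ∈-upTo⁺ (≤-trans (≤-reflexive (suc-φ k∣d)) (≤-trans (m/n≤m (suc d) (suc k)) (∈-upTo⁻ d∈′)))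
  onto : ∀ {p} → p ∈ upTo n → (∃[ d ] (d ∈ multiples × p ≡ φ d)) ⊎ g (suc p) ≡ 0ℚ
  onto {p} p∈ with suc k * suc p ≤? n
  ... | no ≰n = inj₂ (g≡0 p (≰⇒> ≰n))
  -- The index is the predecessor of `suc k * suc p`, since `d` in `upTo n` stands for the degree
  -- `suc d`.
  ... | yes ≤n = inj₁ (p + k * suc p , ∈-filter⁺ _ (∈-upTo⁺ ≤n) k∣ ,
          suc-injective (trans (sym (m*n/n≡m (suc p) (suc k))) (trans (cong (_/ suc k) (*-comm (suc p) (suc k))) (sym (suc-φ k∣)))))
    where
    k∣ : suc k ∣ suc k * suc p
    k∣ = divides (suc p) (*-comm (suc k) (suc p))

∑-hit : ∀ n {y} → 1 ≤ y → y ≤ n → (∑[ p ∈ upTo n ] 𝟙 (y ≟ suc p)) ≡ 1ℚ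
∑-hit n {suc y} _ y≤n = trans
  (∑-single (λ p → 𝟙 (suc y ≟ suc p)) (Unique.upTo⁺ n) (∈-upTo⁺ y≤n)
    (λ {p} _ p≢y → 𝟙-no (suc y ≟ suc p) (λ eq → p≢y (sym (suc-injective eq)))))
  (𝟙-yes (suc y ≟ suc y) refl)

half : ∀ x → (x ≡ 2 * ⌊ x /2⌋) ⊎ (x ≡ suc (2 * ⌊ x /2⌋))
half zero = inj₁ refl
half (suc zero) = inj₂ refl
half (suc (suc x)) with half x
... | inj₁ eq = inj₁ (trans (cong 2+ eq) (sym (*-suc 2 ⌊ x /2⌋)))
... | inj₂ eq = inj₂ (trans (cong 2+ eq) (cong suc (sym (*-suc 2 ⌊ x /2⌋))))

⌊2q/2⌋ : ∀ q → ⌊ 2 * q /2⌋ ≡ q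
⌊2q/2⌋ zero    = refl
⌊2q/2⌋ (suc q) = trans (cong ⌊_/2⌋ (*-suc 2 q)) (cong suc (⌊2q/2⌋ q))

⌊1+2q/2⌋ : ∀ q → ⌊ suc (2 * q) /2⌋ ≡ q
⌊1+2q/2⌋ zero    = refl
⌊1+2q/2⌋ (suc q) = trans (cong (λ x → ⌊ suc x /2⌋) (*-suc 2 q)) (cong suc (⌊1+2q/2⌋ q))

-- The two cases exclude each other. Together they say that an exponent `x` can lose exactly `q` and
-- be left with 0 or 1.
near : ℕ → ℕ → ℚ
near x q = 𝟙 (x ≟ q) ℚ.+ 𝟙 (x ≟ suc q)

-- The numbers 2q and 2q + 1 form the fibre of halving over `q`, so a sum over all `q` has a single
-- hit.
near-2* : ∀ x q → near x (2 * q) ≡ 𝟙 (⌊ x /2⌋ ≟ q)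
near-2* x q with ⌊ x /2⌋ ≟ q | half x
... | yes refl | inj₁ eq = trans (cong₂ ℚ._+_ (𝟙-yes (x ≟ 2 * q) eq) (𝟙-no (x ≟ suc (2 * q)) (λ eq′ → 1+n≢n (trans (sym eq′) eq))))
                                 (sym (𝟙-yes (⌊ x /2⌋ ≟ q) refl))
... | yes refl | inj₂ eq = trans (cong₂ ℚ._+_ (𝟙-no (x ≟ 2 * q) (λ eq′ → 1+n≢n (trans (sym eq) eq′))) (𝟙-yes (x ≟ suc (2 * q)) eq))
                                 (sym (𝟙-yes (⌊ x /2⌋ ≟ q) refl))
... | no ne    | _       = trans (cong₂ ℚ._+_ (𝟙-no (x ≟ 2 * q) (λ { refl → ne (⌊2q/2⌋ q) })) (𝟙-no (x ≟ suc (2 * q)) (λ { refl → ne (⌊1+2q/2⌋ q) })))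
                                 (sym (𝟙-no (⌊ x /2⌋ ≟ q) ne))

-- For x ≥ 2 the first sum is hit twice, by the exponents x and x - 1, and the second once, by half
-- of x rounded down; the coefficient -2 makes them cancel. For x = 1 only the first sum is hit,
-- once, and for x = 0 neither is. The bound on `x` keeps all hits within the range.
∑-near : ∀ n x → x ≤ n →
  (∑[ p ∈ upTo n ] near x (1 * suc p)) ℚ.+ -2ℚ ℚ.* (∑[ p ∈ upTo n ] near x (2 * suc p)) ≡ 𝟙 (x ≤? 1) ℚ.* ι x
∑-near n x x≤n = trans (cong₂ (λ u v → u ℚ.+ -2ℚ ℚ.* v) split1 split2) (counts x x≤n)
  where
  split1 : (∑[ p ∈ upTo n ] near x (1 * suc p)) ≡ (∑[ p ∈ upTo n ] 𝟙 (x ≟ suc p)) ℚ.+ (∑[ p ∈ upTo n ] 𝟙 (x ≟ suc (suc p)))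
  split1 = trans (∑-cong (upTo n) λ p → cong (near x) (*-identityˡ (suc p))) (∑-+ (upTo n) (λ p → 𝟙 (x ≟ suc p)) (λ p → 𝟙 (x ≟ suc (suc p))))
  split2 : (∑[ p ∈ upTo n ] near x (2 * suc p)) ≡ (∑[ p ∈ upTo n ] 𝟙 (⌊ x /2⌋ ≟ suc p))
  split2 = ∑-cong (upTo n) λ p → near-2* x (suc p)
  counts : ∀ x → x ≤ n → ((∑[ p ∈ upTo n ] 𝟙 (x ≟ suc p)) ℚ.+ (∑[ p ∈ upTo n ] 𝟙 (x ≟ suc (suc p)))) ℚ.+ -2ℚ ℚ.* (∑[ p ∈ upTo n ] 𝟙 (⌊ x /2⌋ ≟ suc p))
           ≡ 𝟙 (x ≤? 1) ℚ.* ι x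
  counts zero x≤n = begin
    _ ≡⟨ cong₂ (λ u v → u ℚ.+ -2ℚ ℚ.* v)
           (cong₂ ℚ._+_ (∑-zero (upTo n) λ {p} _ → 𝟙-no (0 ≟ suc p) (λ ())) (∑-zero (upTo n) λ {p} _ → 𝟙-no (0 ≟ suc (suc p)) (λ ())))
           (∑-zero (upTo n) λ {p} _ → 𝟙-no (0 ≟ suc p) (λ ())) ⟩
    0ℚ              ≡⟨ ι-0 ⟨
    ι 0             ≡⟨ ℚ.*-identityˡ (ι 0) ⟨
    1ℚ ℚ.* ι 0      ∎
    where open ≡-Reasoning
  counts (suc zero) x≤n = begin
    _ ≡⟨ cong₂ (λ u v → u ℚ.+ -2ℚ ℚ.* v)
           (cong₂ ℚ._+_ (∑-hit n (s≤s z≤n) x≤n) (∑-zero (upTo n) λ {p} _ → 𝟙-no (1 ≟ suc (suc p)) (λ ())))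
           (∑-zero (upTo n) λ {p} _ → 𝟙-no (0 ≟ suc p) (λ ())) ⟩
    1ℚ              ≡⟨ ι-1 ⟨
    ι 1             ≡⟨ ℚ.*-identityˡ (ι 1) ⟨
    1ℚ ℚ.* ι 1      ∎
    where open ≡-Reasoning
  counts (suc (suc x)) x≤n = begin
    _ ≡⟨ cong₂ (λ u v → u ℚ.+ -2ℚ ℚ.* v)
           (cong₂ ℚ._+_ (∑-hit n (s≤s z≤n) x≤n)
             (trans (∑-cong (upTo n) λ p → 𝟙-⇔ (suc (suc x) ≟ suc (suc p)) (suc x ≟ suc p) suc-injective (cong suc))
                    (∑-hit n (s≤s z≤n) (<⇒≤ x≤n))))
           (∑-hit n {suc ⌊ x /2⌋} (s≤s z≤n) (≤-trans (⌊n/2⌋≤n (suc (suc x))) x≤n)) ⟩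
    0ℚ                     ≡⟨ ℚ.*-zeroˡ (ι (suc (suc x))) ⟨
    0ℚ ℚ.* ι (suc (suc x)) ∎
    where open ≡-Reasoning

module Newton {a b : ℕ} where
  open Convolution {a} {b}
  open Substitution {a} {b}
  open Exponents {a} {b}

  -- The series E⁺_{R-O}, which is zero for O > R; the offset form avoids
  -- truncated subtraction.

  E∸ : ℕ → ℕ → Monomial a b → ℚ
  E∸ R O e = 𝟙 (squareFree? e ×-dec (deg e + O ≟ R))

  E∸-0 : ∀ R e → E∸ R 0 e ≡ E⁺ R e
  E∸-0 R e = 𝟙-⇔ (squareFree? e ×-dec (deg e + 0 ≟ R)) (squareFree? e ×-dec (deg e ≟ R))
    (λ (sf , eq) → sf , trans (sym (+-identityʳ (deg e))) eq) (λ (sf , eq) → sf , trans (+-identityʳ (deg e)) eq)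

  -- `P d` after the substitution of s-th powers, with the substitution carried out in each variable
  -- power.
  scaledP : ℕ → ℕ → Monomial a b → ℚ
  scaledP s d y = ∑[ k ∈ filter (λ k → suc (toℕ k) ∣? d) (allFin a) ] ∑[ l ∈ allFin b ]
    ι (suc (toℕ k)) ℚ.* 𝟙 (y ≟ᴹ var^ k l (s * (d / suc (toℕ k))))

  pow-var : ∀ r k l q → pow (suc r) (λ y → 𝟙 (y ≟ᴹ var^ k l q)) ≗ λ y → 𝟙 (y ≟ᴹ var^ k l (suc r * q))
  pow-var r k l q e with isPower? r e
  ... | no ¬pow = trans (pow-nonpower (suc r) _ ¬pow) (sym (𝟙-no (e ≟ᴹ var^ k l (suc r * q)) λ { refl → ¬pow (var^ k l q , var-^ k l q (suc r)) }))
  ... | yes (y , refl) = trans (pow-^ᴹ r (λ y → 𝟙 (y ≟ᴹ var^ k l q)) y) (𝟙-⇔ (y ≟ᴹ var^ k l q) ((y ^ᴹ suc r) ≟ᴹ var^ k l (suc r * q))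
          (λ { refl → var-^ k l q (suc r) }) (λ eq → ^ᴹ-injective r (trans eq (sym (var-^ k l q (suc r))))))

  pow-P : ∀ r d → pow (suc r) (P d) ≗ scaledP (suc r) d
  pow-P r d e = begin
    pow (suc r) (P d) e
      ≡⟨ pow-cong (suc r) (λ y → ∑-cong ks λ k → ∑-cong (allFin b) λ l →
           trans (if-𝟙 (y ≟ᴹ var^ k l (d / suc (toℕ k))) _) (trans (ℚ.*-comm (𝟙 (y ≟ᴹ var^ k l (d / suc (toℕ k)))) _)
             (cong (ℚ._* 𝟙 (y ≟ᴹ var^ k l (d / suc (toℕ k)))) (sym (ι-def (suc (toℕ k))))))) e ⟩
    pow (suc r) (λ y → ∑[ k ∈ ks ] ∑[ l ∈ allFin b ] ι (suc (toℕ k)) ℚ.* V k l y) e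
      ≡⟨ pow-∑ (suc r) ks (λ k y → ∑[ l ∈ allFin b ] ι (suc (toℕ k)) ℚ.* V k l y) e ⟩
    (∑[ k ∈ ks ] pow (suc r) (λ y → ∑[ l ∈ allFin b ] ι (suc (toℕ k)) ℚ.* V k l y) e)
      ≡⟨ ∑-cong ks (λ k → trans (pow-∑ (suc r) (allFin b) (λ l y → ι (suc (toℕ k)) ℚ.* V k l y) e)
           (∑-cong (allFin b) λ l → trans (pow-* (suc r) (ι (suc (toℕ k))) (V k l) e)
             (cong (ι (suc (toℕ k)) ℚ.*_) (pow-var r k l (d / suc (toℕ k)) e)))) ⟩
    scaledP (suc r) d e ∎
    where
    open ≡-Reasoning
    ks = filter (λ k → suc (toℕ k) ∣? d) (allFin a)
    V : Fin a → Fin b → Monomial a b → ℚ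
    V k l y = 𝟙 (y ≟ᴹ var^ k l (d / suc (toℕ k)))

  -- 1 if e is x_{k+1,l+1}^q times a square-free monomial, and 0 otherwise.

  cofactor : Monomial a b → Fin a → Fin b → ℕ → ℚ
  cofactor e k l q = ((λ y → 𝟙 (y ≟ᴹ var^ k l q)) ⊛ (λ y → 𝟙 (squareFree? y))) e

  cofactor-large : ∀ e k l q → deg e < suc (toℕ k) * q → cofactor e k l q ≡ 0ℚ
  cofactor-large e k l q lt = ∑-zero (factorisations e) λ {(y , y′)} p∈ →
    trans (cong (ℚ._* 𝟙 (squareFree? y′)) (𝟙-no (y ≟ᴹ var^ k l q) λ { refl → <⇒≱ lt (begin
      suc (toℕ k) * q          ≡⟨ deg-var k l q ⟨
      deg (var^ k l q)         ≤⟨ m≤m+n _ (deg y′) ⟩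
      deg (var^ k l q) + deg y′ ≡⟨ deg-+ (var^ k l q) y′ ⟨
      deg (var^ k l q +ᴹ y′)   ≡⟨ cong deg (∈-factorisations⁻ {e} p∈) ⟩
      deg e                    ∎) }))
      (ℚ.*-zeroˡ (𝟙 (squareFree? y′)))
    where open ≤-Reasoning

  -- The extra offset is the degree of the variable power. It turns the degree condition on the
  -- cofactor into a condition on `e` alone, which can be pulled out of the convolution.
  var-⊛-E∸ : ∀ e k l q R O → ((λ y → 𝟙 (y ≟ᴹ var^ k l q)) ⊛ E∸ R (O + suc (toℕ k) * q)) e ≡ 𝟙 (deg e + O ≟ R) ℚ.* cofactor e k l q
  var-⊛-E∸ e k l q R O = trans (∑-cong-∈ (factorisations e) λ {(y , y′)} p∈ → begin
      𝟙 (y ≟ᴹ v) ℚ.* E∸ R (O + suc (toℕ k) * q) y′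
        ≡⟨ 𝟙-*-cong (y ≟ᴹ v) (λ { refl → trans (𝟙-× (squareFree? y′) (deg y′ + (O + suc (toℕ k) * q) ≟ R))
             (trans (ℚ.*-comm (𝟙 (squareFree? y′)) _) (cong (λ j → 𝟙 (j ≟ R) ℚ.* 𝟙 (squareFree? y′)) (shift p∈))) }) ⟩
      𝟙 (y ≟ᴹ v) ℚ.* (𝟙 (deg e + O ≟ R) ℚ.* 𝟙 (squareFree? y′))
        ≡⟨ solve 3 (λ u v w → u :* (v :* w) := v :* (u :* w)) refl (𝟙 (y ≟ᴹ v)) (𝟙 (deg e + O ≟ R)) (𝟙 (squareFree? y′)) ⟩
      𝟙 (deg e + O ≟ R) ℚ.* (𝟙 (y ≟ᴹ v) ℚ.* 𝟙 (squareFree? y′)) ∎)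
    (∑-*ˡ (factorisations e) (𝟙 (deg e + O ≟ R)) _)
    where
    open ≡-Reasoning
    open +-*-Solver
    v = var^ k l q
    shift : ∀ {y′} → (v , y′) ∈ factorisations e → deg y′ + (O + suc (toℕ k) * q) ≡ deg e + O
    shift {y′} p∈ = begin
      deg y′ + (O + suc (toℕ k) * q)  ≡⟨ cong (λ j → deg y′ + (O + j)) (deg-var k l q) ⟨
      deg y′ + (O + deg v)            ≡⟨ S.solve 3 (λ x y z → x S.:+ (y S.:+ z) S.:= (z S.:+ x) S.:+ y) refl (deg y′) O (deg v) ⟩
      (deg v + deg y′) + O            ≡⟨ cong (_+ O) (trans (sym (deg-+ v y′)) (cong deg (∈-factorisations⁻ {e} p∈))) ⟩
      deg e + O                       ∎
      where module S = ℕSolver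

  -- All variable powers in `scaledP s d` have degree `s * d`, because k times d / k is d. So
  -- `var-⊛-E∸` applies to every term with the same degree indicator.
  scaledP-⊛-E∸ : ∀ s d R O e → (scaledP s d ⊛ E∸ R (O + s * d)) e ≡
    (∑[ k ∈ allFin a ] ∑[ l ∈ allFin b ] (𝟙 (deg e + O ≟ R) ℚ.* ι (suc (toℕ k))) ℚ.*
      (𝟙 (suc (toℕ k) ∣? d) ℚ.* cofactor e k l (s * (d / suc (toℕ k)))))
  scaledP-⊛-E∸ s d R O e = begin
    (scaledP s d ⊛ G) e
      ≡⟨ ⊛-∑ˡ ks (λ k y → ∑[ l ∈ allFin b ] ι (suc (toℕ k)) ℚ.* V k l y) G e ⟩
    (∑[ k ∈ ks ] ((λ y → ∑[ l ∈ allFin b ] ι (suc (toℕ k)) ℚ.* V k l y) ⊛ G) e)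
      ≡⟨ ∑-cong ks (λ k → trans (⊛-∑ˡ (allFin b) (λ l y → ι (suc (toℕ k)) ℚ.* V k l y) G e)
           (∑-cong (allFin b) λ l → ⊛-*ˡ (ι (suc (toℕ k))) (V k l) G e)) ⟩
    (∑[ k ∈ ks ] ∑[ l ∈ allFin b ] ι (suc (toℕ k)) ℚ.* (V k l ⊛ G) e)
      ≡⟨ ∑-filter (λ k → suc (toℕ k) ∣? d) (allFin a) (λ k → ∑[ l ∈ allFin b ] ι (suc (toℕ k)) ℚ.* (V k l ⊛ G) e) ⟩
    (∑[ k ∈ allFin a ] 𝟙 (suc (toℕ k) ∣? d) ℚ.* (∑[ l ∈ allFin b ] ι (suc (toℕ k)) ℚ.* (V k l ⊛ G) e))
      ≡⟨ ∑-cong (allFin a) (λ k → trans (sym (∑-*ˡ (allFin b) (𝟙 (suc (toℕ k) ∣? d)) _)) (∑-cong (allFin b) λ l → perVariable k l)) ⟩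
    _ ∎
    where
    open ≡-Reasoning
    ks = filter (λ k → suc (toℕ k) ∣? d) (allFin a)
    G = E∸ R (O + s * d)
    V : Fin a → Fin b → Monomial a b → ℚ
    V k l y = 𝟙 (y ≟ᴹ var^ k l (s * (d / suc (toℕ k))))
    perVariable : ∀ k l → 𝟙 (suc (toℕ k) ∣? d) ℚ.* (ι (suc (toℕ k)) ℚ.* (V k l ⊛ G) e) ≡
      (𝟙 (deg e + O ≟ R) ℚ.* ι (suc (toℕ k))) ℚ.* (𝟙 (suc (toℕ k) ∣? d) ℚ.* cofactor e k l (s * (d / suc (toℕ k))))
    perVariable k l = begin
      𝟙 (suc (toℕ k) ∣? d) ℚ.* (ι (suc (toℕ k)) ℚ.* (V k l ⊛ G) e)
        ≡⟨ 𝟙-*-cong (suc (toℕ k) ∣? d) (λ k∣d → cong (ι (suc (toℕ k)) ℚ.*_)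
             (trans (cong (λ j → (V k l ⊛ E∸ R (O + j)) e) (sym (reassoc k∣d))) (var-⊛-E∸ e k l (s * (d / suc (toℕ k))) R O))) ⟩
      𝟙 (suc (toℕ k) ∣? d) ℚ.* (ι (suc (toℕ k)) ℚ.* (𝟙 (deg e + O ≟ R) ℚ.* cofactor e k l (s * (d / suc (toℕ k)))))
        ≡⟨ solve 4 (λ x y z w → x :* (y :* (z :* w)) := (z :* y) :* (x :* w)) refl
             (𝟙 (suc (toℕ k) ∣? d)) (ι (suc (toℕ k))) (𝟙 (deg e + O ≟ R)) (cofactor e k l (s * (d / suc (toℕ k)))) ⟩
      _ ∎
      where
      open +-*-Solver
      reassoc : suc (toℕ k) ∣ d → suc (toℕ k) * (s * (d / suc (toℕ k))) ≡ s * d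
      reassoc k∣d = begin
        suc (toℕ k) * (s * (d / suc (toℕ k)))  ≡⟨ *-assoc (suc (toℕ k)) s _ ⟨
        suc (toℕ k) * s * (d / suc (toℕ k))    ≡⟨ cong (_* (d / suc (toℕ k))) (*-comm (suc (toℕ k)) s) ⟩
        s * suc (toℕ k) * (d / suc (toℕ k))    ≡⟨ *-assoc s (suc (toℕ k)) _ ⟩
        s * (suc (toℕ k) * (d / suc (toℕ k)))  ≡⟨ cong (s *_) (m*[n/m]≡n k∣d) ⟩
        s * d                                  ∎

  -- Summing over a degree and its divisors amounts to summing over the variables and their powers.
  -- Where the degree indicator is nonzero, deg e ≤ R ≤ n, so a variable power of degree above `n`
  -- has no cofactor and the truncated range suffices.
  ∑-pow-P-⊛-E∸ : ∀ r n R O e → R ≤ n → (∑[ d ∈ upTo n ] (pow (suc r) (P (suc d)) ⊛ E∸ R (O + suc r * suc d)) e) ≡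
    (∑[ k ∈ allFin a ] ∑[ l ∈ allFin b ] (𝟙 (deg e + O ≟ R) ℚ.* ι (suc (toℕ k))) ℚ.* (∑[ p ∈ upTo n ] cofactor e k l (suc r * suc p)))
  ∑-pow-P-⊛-E∸ r n R O e R≤n = begin
    (∑[ d ∈ upTo n ] (pow (suc r) (P (suc d)) ⊛ E∸ R (O + suc r * suc d)) e)
      ≡⟨ ∑-cong (upTo n) (λ d → trans (⊛-cong (pow-P r (suc d)) (λ _ → refl) e) (scaledP-⊛-E∸ (suc r) (suc d) R O e)) ⟩
    (∑[ d ∈ upTo n ] ∑[ k ∈ allFin a ] ∑[ l ∈ allFin b ] c k ℚ.* D d k l)
      ≡⟨ ∑-swap (upTo n) (allFin a) _ ⟩
    (∑[ k ∈ allFin a ] ∑[ d ∈ upTo n ] ∑[ l ∈ allFin b ] c k ℚ.* D d k l)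
      ≡⟨ ∑-cong (allFin a) (λ k → trans (∑-swap (upTo n) (allFin b) _) (∑-cong (allFin b) λ l →
           trans (∑-*ˡ (upTo n) (c k) (λ d → D d k l)) (perVariable k l))) ⟩
    _ ∎
    where
    open ≡-Reasoning
    c : Fin a → ℚ
    c k = 𝟙 (deg e + O ≟ R) ℚ.* ι (suc (toℕ k))
    D : ℕ → Fin a → Fin b → ℚ
    D d k l = 𝟙 (suc (toℕ k) ∣? suc d) ℚ.* cofactor e k l (suc r * (suc d / suc (toℕ k)))
    perVariable : ∀ k l → c k ℚ.* (∑[ d ∈ upTo n ] D d k l) ≡ c k ℚ.* (∑[ p ∈ upTo n ] cofactor e k l (suc r * suc p))
    perVariable k l = trans (ℚ.*-assoc (𝟙 (deg e + O ≟ R)) _ _) (trans (𝟙-*-cong (deg e + O ≟ R) (λ { refl → cong (ι (suc (toℕ k)) ℚ.*_)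
      (∑-quotients n (toℕ k) (λ p → cofactor e k l (suc r * p)) λ p n< → cofactor-large e k l (suc r * suc p)
        (≤-<-trans (m≤m+n (deg e) O) (≤-<-trans R≤n (≤-trans n< (*-monoʳ-≤ (suc (toℕ k)) (m≤m+n (suc p) _)))))) }))
      (sym (ℚ.*-assoc (𝟙 (deg e + O ≟ R)) (ι (suc (toℕ k))) _)))

  SquareFreeElsewhere : Monomial a b → Fin a → Fin b → Set
  SquareFreeElsewhere e k l = ∀ k′ l′ → ¬ (k ≡ k′ × l ≡ l′) → exponent e k′ l′ ≤ 1

  squareFreeElsewhere? : ∀ e k l → Dec (SquareFreeElsewhere e k l)
  squareFreeElsewhere? e k l = Fin.all? λ k′ → Fin.all? λ l′ → ¬? (same? k k′ l l′) →-dec (exponent e k′ l′ ≤? 1)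

  cofactor-zero : ∀ e k l q → (∀ {y} → var^ k l q +ᴹ y ≡ e → ¬ SquareFree y) → cofactor e k l q ≡ 0ℚ
  cofactor-zero e k l q none = ∑-zero (factorisations e) λ {(y , y′)} p∈ →
    trans (𝟙-*-cong (y ≟ᴹ var^ k l q) (λ { refl → 𝟙-no (squareFree? y′) (none (∈-factorisations⁻ {e} p∈)) }))
          (ℚ.*-zeroʳ (𝟙 (y ≟ᴹ var^ k l q)))

  cofactor-one : ∀ k l q y → SquareFree y → cofactor (var^ k l q +ᴹ y) k l q ≡ 1ℚ
  cofactor-one k l q y sf = trans
    (∑-single _ (factorisations-unique (v +ᴹ y)) (∈-factorisations⁺ {v +ᴹ y} refl) off)
    (cong₂ ℚ._*_ (𝟙-yes (v ≟ᴹ v) refl) (𝟙-yes (squareFree? y) sf))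
    where
    v = var^ k l q
    off : ∀ {p} → p ∈ factorisations (v +ᴹ y) → p ≢ (v , y) → 𝟙 (proj₁ p ≟ᴹ v) ℚ.* 𝟙 (squareFree? (proj₂ p)) ≡ 0ℚ
    off {u , u′} p∈ p≢ = trans (cong (ℚ._* 𝟙 (squareFree? u′)) (𝟙-no (u ≟ᴹ v) λ { refl →
      p≢ (cong (v ,_) (+ᴹ-cancelˡ v (∈-factorisations⁻ {v +ᴹ y} p∈))) })) (ℚ.*-zeroˡ (𝟙 (squareFree? u′)))

  -- There is at most one cofactor, the quotient of `e` by the variable power. It keeps all other
  -- exponents of `e` and lowers the chosen one by `q`, so square-freeness can be tested separately
  -- at the chosen variable and elsewhere.
  cofactor-near : ∀ e k l q (d : Dec (SquareFreeElsewhere e k l)) → cofactor e k l q ≡ 𝟙 d ℚ.* near (exponent e k l) q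
  cofactor-near e k l q (no ¬sf) = trans
    (cofactor-zero e k l q λ { {y} refl sf → ¬sf λ k′ l′ ne → subst (_≤ 1)
      (sym (trans (exponent-+ (var^ k l q) y k′ l′) (cong (_+ exponent y k′ l′) (exponent-var-other k l q ne)))) (squareFree⇒ sf k′ l′) })
    (sym (ℚ.*-zeroˡ (near (exponent e k l) q)))
  cofactor-near e k l q (yes sf) = trans main (sym (ℚ.*-identityˡ (near x q)))
    where
    x = exponent e k l
    v = var^ k l q
    -- The only candidate for the quotient; the truncated subtraction is exact once q ≤ x.
    rest : Monomial a b
    rest = Vec.tabulate λ k′ → Vec.tabulate λ l′ → exponent e k′ l′ ∸ exponent v k′ l′
    exponent-rest : ∀ k′ l′ → exponent rest k′ l′ ≡ exponent e k′ l′ ∸ exponent v k′ l′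
    exponent-rest = exponent-tabulate _
    v≤e : q ≤ x → ∀ k′ l′ → exponent v k′ l′ ≤ exponent e k′ l′
    v≤e q≤x k′ l′ with same? k k′ l l′
    ... | yes (refl , refl) = ≤-trans (≤-reflexive (exponent-var k l q)) q≤x
    ... | no ne = ≤-trans (≤-reflexive (exponent-var-other k l q ne)) z≤n
    v+rest : q ≤ x → v +ᴹ rest ≡ e
    v+rest q≤x = exponent-ext λ k′ l′ → trans (exponent-+ v rest k′ l′)
      (trans (cong (exponent v k′ l′ +_) (exponent-rest k′ l′)) (m+[n∸m]≡n (v≤e q≤x k′ l′)))
    rest-squareFree : x ≤ suc q → SquareFree rest
    rest-squareFree x≤1+q = squareFree⇐ λ k′ l′ → ≤-trans (≤-reflexive (exponent-rest k′ l′)) (bound k′ l′)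
      where
      bound : ∀ k′ l′ → exponent e k′ l′ ∸ exponent v k′ l′ ≤ 1
      bound k′ l′ with same? k k′ l l′
      ... | yes (refl , refl) = ≤-trans (≤-reflexive (cong (x ∸_) (exponent-var k l q))) (m≤n+o⇒m∸n≤o x q (≤-trans x≤1+q (≤-reflexive (+-comm 1 q))))
      ... | no ne = ≤-trans (m∸n≤m (exponent e k′ l′) (exponent v k′ l′)) (sf k′ l′ ne)
    one : q ≤ x → x ≤ suc q → cofactor e k l q ≡ 1ℚ
    one q≤x x≤1+q = trans (cong (λ e → cofactor e k l q) (sym (v+rest q≤x))) (cofactor-one k l q rest (rest-squareFree x≤1+q))
    main : cofactor e k l q ≡ near x q
    main with x ≟ q | x ≟ suc q
    ... | yes x≡q | _ = trans (one (≤-reflexive (sym x≡q)) (m≤n⇒m≤1+n (≤-reflexive x≡q)))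
                          (sym (cong₂ ℚ._+_ (𝟙-yes (x ≟ q) x≡q) (𝟙-no (x ≟ suc q) λ x≡1+q → 1+n≢n (trans (sym x≡1+q) x≡q))))
    ... | no x≢q | yes x≡1+q = trans (one (≤-trans (n≤1+n q) (≤-reflexive (sym x≡1+q))) (≤-reflexive x≡1+q))
                          (sym (cong₂ ℚ._+_ (𝟙-no (x ≟ q) x≢q) (𝟙-yes (x ≟ suc q) x≡1+q)))
    ... | no x≢q | no x≢1+q = trans (cofactor-zero e k l q (λ {y} eq sf′ → absurd eq (squareFree⇒ sf′ k l)))
                          (sym (cong₂ ℚ._+_ (𝟙-no (x ≟ q) x≢q) (𝟙-no (x ≟ suc q) x≢1+q)))
      where
      absurd : ∀ {y} → v +ᴹ y ≡ e → ¬ (exponent y k l ≤ 1)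
      absurd {y} refl y≤1 with exponent y k l in eq
      ... | 0 = x≢q (trans (exponent-+ v y k l) (trans (cong₂ _+_ (exponent-var k l q) eq) (+-identityʳ q)))
      ... | 1 = x≢1+q (trans (exponent-+ v y k l) (trans (cong₂ _+_ (exponent-var k l q) eq) (+-comm q 1)))
      absurd refl (s≤s ()) | 2+ _

  squareFree-split : ∀ e k l → 𝟙 (squareFreeElsewhere? e k l) ℚ.* 𝟙 (exponent e k l ≤? 1) ≡ 𝟙 (squareFree? e)
  squareFree-split e k l = trans (sym (𝟙-× (squareFreeElsewhere? e k l) (exponent e k l ≤? 1)))
    (𝟙-⇔ (squareFreeElsewhere? e k l ×-dec (exponent e k l ≤? 1)) (squareFree? e)
      (λ (sf , ≤1) → squareFree⇐ (λ k′ l′ → everywhere sf ≤1 k′ l′)) (λ sf → (λ k′ l′ _ → squareFree⇒ sf k′ l′) , squareFree⇒ sf k l))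
    where
    everywhere : SquareFreeElsewhere e k l → exponent e k l ≤ 1 → ∀ k′ l′ → exponent e k′ l′ ≤ 1
    everywhere sf ≤1 k′ l′ with same? k k′ l l′
    ... | yes (refl , refl) = ≤1
    ... | no ne = sf k′ l′ ne

  exponent≤deg : ∀ e k l → exponent e k l ≤ deg e
  exponent≤deg e k l = ≤-trans (∈⇒≤sum (∈-map⁺ (exponent e k) (∈-allFin l)))
    (≤-trans (m≤m+n _ _) (≤-trans (∈⇒≤sum (∈-map⁺ (λ k → suc (toℕ k) * sum (map (exponent e k) (allFin b))) (∈-allFin k)))
      (≤-reflexive (sym (deg-exponent e)))))

  -- Coefficientwise this says that the exponent x of each variable satisfies
  -- #{p ≥ 1 : x - p ∈ {0,1}} - 2 #{p ≥ 1 : x - 2p ∈ {0,1}} = x if x ≤ 1, and 0 otherwise.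

  newton : ∀ n R O e → R ≤ n →
    (∑[ d ∈ upTo n ] (pow 1 (P (suc d)) ⊛ E∸ R (O + 1 * suc d)) e) ℚ.+
    -2ℚ ℚ.* (∑[ d ∈ upTo n ] (pow 2 (P (suc d)) ⊛ E∸ R (O + 2 * suc d)) e)
    ≡ (ι R ℚ.- ι O) ℚ.* E∸ R O e
  newton n R O e R≤n = begin
    _ ≡⟨ cong₂ (λ u v → u ℚ.+ -2ℚ ℚ.* v) (∑-pow-P-⊛-E∸ 0 n R O e R≤n) (∑-pow-P-⊛-E∸ 1 n R O e R≤n) ⟩
    (∑[ k ∈ allFin a ] ∑[ l ∈ allFin b ] c k ℚ.* S 1 k l) ℚ.+ -2ℚ ℚ.* (∑[ k ∈ allFin a ] ∑[ l ∈ allFin b ] c k ℚ.* S 2 k l)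
      ≡⟨ merge ⟩
    (∑[ k ∈ allFin a ] ∑[ l ∈ allFin b ] c k ℚ.* (S 1 k l ℚ.+ -2ℚ ℚ.* S 2 k l))
      ≡⟨ ∑-cong (allFin a) (λ k → ∑-cong (allFin b) (perVariable k)) ⟩
    (∑[ k ∈ allFin a ] ∑[ l ∈ allFin b ] 𝟙D ℚ.* 𝟙 (squareFree? e) ℚ.* (ι (suc (toℕ k)) ℚ.* ι (exponent e k l)))
      ≡⟨ trans (∑-cong (allFin a) λ k → ∑-*ˡ (allFin b) (𝟙D ℚ.* 𝟙 (squareFree? e)) _) (∑-*ˡ (allFin a) (𝟙D ℚ.* 𝟙 (squareFree? e)) _) ⟩
    𝟙D ℚ.* 𝟙 (squareFree? e) ℚ.* (∑[ k ∈ allFin a ] ∑[ l ∈ allFin b ] ι (suc (toℕ k)) ℚ.* ι (exponent e k l))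
      ≡⟨ cong (𝟙D ℚ.* 𝟙 (squareFree? e) ℚ.*_) (ι-deg e) ⟨
    𝟙D ℚ.* 𝟙 (squareFree? e) ℚ.* ι (deg e)
      ≡⟨ trans (ℚ.*-assoc 𝟙D _ _) (𝟙-*-cong (deg e + O ≟ R) λ { refl → trans (ℚ.*-comm (𝟙 (squareFree? e)) _)
           (cong (ℚ._* 𝟙 (squareFree? e)) (trans (solve 2 (λ x y → x := (x :+ y) :- y) refl (ι (deg e)) (ι O)) (cong (ℚ._- ι O) (sym (ι-+ (deg e) O))))) }) ⟩
    𝟙D ℚ.* ((ι R ℚ.- ι O) ℚ.* 𝟙 (squareFree? e))
      ≡⟨ solve 3 (λ x y z → x :* (y :* z) := y :* (z :* x)) refl 𝟙D (ι R ℚ.- ι O) (𝟙 (squareFree? e)) ⟩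
    (ι R ℚ.- ι O) ℚ.* (𝟙 (squareFree? e) ℚ.* 𝟙D)
      ≡⟨ cong ((ι R ℚ.- ι O) ℚ.*_) (𝟙-× (squareFree? e) (deg e + O ≟ R)) ⟨
    (ι R ℚ.- ι O) ℚ.* E∸ R O e ∎
    where
    open ≡-Reasoning
    open +-*-Solver
    𝟙D = 𝟙 (deg e + O ≟ R)
    c : Fin a → ℚ
    c k = 𝟙D ℚ.* ι (suc (toℕ k))
    S : ℕ → Fin a → Fin b → ℚ
    S s k l = ∑[ p ∈ upTo n ] cofactor e k l (s * suc p)
    merge : (∑[ k ∈ allFin a ] ∑[ l ∈ allFin b ] c k ℚ.* S 1 k l) ℚ.+ -2ℚ ℚ.* (∑[ k ∈ allFin a ] ∑[ l ∈ allFin b ] c k ℚ.* S 2 k l) ≡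
            (∑[ k ∈ allFin a ] ∑[ l ∈ allFin b ] c k ℚ.* (S 1 k l ℚ.+ -2ℚ ℚ.* S 2 k l))
    merge = sym (trans (∑-cong (allFin a) λ k → trans (∑-cong (allFin b) λ l →
        solve 4 (λ x y z w → x :* (y :+ z :* w) := x :* y :+ z :* (x :* w)) refl (c k) (S 1 k l) -2ℚ (S 2 k l))
        (trans (∑-+ (allFin b) _ _) (cong ((∑[ l ∈ allFin b ] c k ℚ.* S 1 k l) ℚ.+_) (∑-*ˡ (allFin b) -2ℚ (λ l → c k ℚ.* S 2 k l)))))
      (trans (∑-+ (allFin a) _ _) (cong ((∑[ k ∈ allFin a ] ∑[ l ∈ allFin b ] c k ℚ.* S 1 k l) ℚ.+_) (∑-*ˡ (allFin a) -2ℚ (λ k → ∑[ l ∈ allFin b ] c k ℚ.* S 2 k l)))))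
    perVariable : ∀ k l → c k ℚ.* (S 1 k l ℚ.+ -2ℚ ℚ.* S 2 k l) ≡ 𝟙D ℚ.* 𝟙 (squareFree? e) ℚ.* (ι (suc (toℕ k)) ℚ.* ι (exponent e k l))
    perVariable k l = begin
      c k ℚ.* (S 1 k l ℚ.+ -2ℚ ℚ.* S 2 k l)
        ≡⟨ cong (c k ℚ.*_) (cong₂ (λ u v → u ℚ.+ -2ℚ ℚ.* v) (asNear 1) (asNear 2)) ⟩
      c k ℚ.* (o ℚ.* N 1 ℚ.+ -2ℚ ℚ.* (o ℚ.* N 2))
        ≡⟨ solve 6 (λ d i o x t y → (d :* i) :* (o :* x :+ t :* (o :* y)) := (i :* o) :* (d :* (x :+ t :* y))) refl 𝟙D (ι (suc (toℕ k))) o (N 1) -2ℚ (N 2) ⟩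
      (ι (suc (toℕ k)) ℚ.* o) ℚ.* (𝟙D ℚ.* (N 1 ℚ.+ -2ℚ ℚ.* N 2))
        ≡⟨ cong ((ι (suc (toℕ k)) ℚ.* o) ℚ.*_) (𝟙-*-cong (deg e + O ≟ R) λ D → ∑-near n x
             (≤-trans (exponent≤deg e k l) (≤-trans (m≤m+n (deg e) O) (≤-trans (≤-reflexive D) R≤n)))) ⟩
      (ι (suc (toℕ k)) ℚ.* o) ℚ.* (𝟙D ℚ.* (𝟙 (x ≤? 1) ℚ.* ι x))
        ≡⟨ solve 5 (λ i o d q x → (i :* o) :* (d :* (q :* x)) := (d :* (o :* q)) :* (i :* x)) refl (ι (suc (toℕ k))) o 𝟙D (𝟙 (x ≤? 1)) (ι x) ⟩
      (𝟙D ℚ.* (o ℚ.* 𝟙 (x ≤? 1))) ℚ.* (ι (suc (toℕ k)) ℚ.* ι x)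
        ≡⟨ cong (λ q → 𝟙D ℚ.* q ℚ.* (ι (suc (toℕ k)) ℚ.* ι x)) (squareFree-split e k l) ⟩
      _ ∎
      where
      x = exponent e k l
      o = 𝟙 (squareFreeElsewhere? e k l)
      N : ℕ → ℚ
      N s = ∑[ p ∈ upTo n ] near x (s * suc p)
      asNear : ∀ s → S s k l ≡ o ℚ.* N s
      asNear s = trans (∑-cong (upTo n) λ p → cofactor-near e k l (s * suc p) (squareFreeElsewhere? e k l)) (∑-*ˡ (upTo n) o _)

-- Signed fillings of rows, and the removal of a block.

-- An entry that occurs k times is picked k times, once per position. This repetition supplies the
-- multiplicity factor in the recursion.
picks : List A → List (A × List A)
picks []       = []
picks (x ∷ xs) = (x , xs) ∷ map (λ (y , ys) → y , x ∷ ys) (picks xs)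

-- Plays two parts: the length of a tile relative to the degree of its block, and the multiplicity
-- of the block relative to the index of the tensor factor.
scale : Bool → ℕ
scale b = if b then 2 else 1

scale≥1 : ∀ b → 1 ≤ scale b
scale≥1 false = s≤s z≤n
scale≥1 true  = s≤s z≤n

sign : Bool → ℚ
sign b = if b then ℚ.- 1ℚ else 1ℚ

bools : List Bool
bools = false ∷ true ∷ []

blockWeight : Block → ℕ
blockWeight β = multiplicity β * degree β

totalWeight : List Block → ℕ
totalWeight bs = sum (map blockWeight bs)

module Placements {I : Set} (_≟ᴵ_ : DecidableEquality I) (rows : List I) (rows-unique : Unique rows)
                  (tensorFactor : I → ℕ) (R : I → ℕ) where

  raise : (I → ℕ) → I → ℕ → I → ℕ
  raise O ρ k ρ′ = O ρ′ + (if does (ρ ≟ᴵ ρ′) then k else 0)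

  private
    δ : I → I → ℕ → ℕ
    δ ρ ρ′ k = if does (ρ ≟ᴵ ρ′) then k else 0

    δ-same : ∀ {ρ} k → δ ρ ρ k ≡ k
    δ-same {ρ} k with ρ ≟ᴵ ρ
    ... | yes _ = refl
    ... | no ¬p = ⊥-elim (¬p refl)

    δ-other : ∀ {ρ ρ′} k → ρ ≢ ρ′ → δ ρ ρ′ k ≡ 0
    δ-other {ρ} {ρ′} k ne with ρ ≟ᴵ ρ′
    ... | yes p = ⊥-elim (ne p)
    ... | no _ = refl

  raise-same : ∀ O ρ k → raise O ρ k ρ ≡ O ρ + k
  raise-same O ρ k = cong (O ρ +_) (δ-same k)

  raise-other : ∀ O {ρ ρ′} k → ρ ≢ ρ′ → raise O ρ k ρ′ ≡ O ρ′
  raise-other O {ρ′ = ρ′} k ne = trans (cong (O ρ′ +_) (δ-other k ne)) (+-identityʳ (O ρ′))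

  positions : List (I × Bool)
  positions = cartesianProduct rows bools

  fits? : ∀ (q : I × Bool) β → Dec (multiplicity β ≡ scale (proj₂ q) * tensorFactor (proj₁ q))
  fits? q β = multiplicity β ≟ scale (proj₂ q) * tensorFactor (proj₁ q)

  tileWeight : I × Bool → Block → ℚ
  tileWeight q β = 𝟙 (fits? q β) ℚ.* sign (proj₂ q)

  lengthIn : I × Bool → Block → ℕ
  lengthIn q β = scale (proj₂ q) * degree β

  place : (I → ℕ) → I × Bool → Block → I → ℕ
  place O q β = raise O (proj₁ q) (lengthIn q β)

  -- The signed number of ways to put the blocks bs, one after the other, as
  -- bricks or doublebricks at the ends of rows of lengths O so that the rows
  -- reach the lengths R.

  fillings : (I → ℕ) → List Block → ℚ
  fillings O []       = 𝟙 (All.all? (λ ρ → O ρ ≟ R ρ) rows)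
  fillings O (β ∷ bs) = ∑[ q ∈ positions ] tileWeight q β ℚ.* fillings (place O q β) bs

  fillings-cong : ∀ bs {O O′} → O ≗ O′ → fillings O bs ≡ fillings O′ bs
  fillings-cong [] {O} {O′} O≗O′ = 𝟙-⇔ (All.all? (λ ρ → O ρ ≟ R ρ) rows) (All.all? (λ ρ → O′ ρ ≟ R ρ) rows)
    (All.map (λ {ρ} eq → trans (sym (O≗O′ ρ)) eq)) (All.map (λ {ρ} eq → trans (O≗O′ ρ) eq))
  fillings-cong (β ∷ bs) O≗O′ = ∑-cong positions λ q → cong (tileWeight q β ℚ.*_)
    (fillings-cong bs λ ρ → cong (_+ δ (proj₁ q) ρ (lengthIn q β)) (O≗O′ ρ))

  fillings-over : ∀ bs {O ρ} → ρ ∈ rows → R ρ < O ρ → fillings O bs ≡ 0ℚ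
  fillings-over [] {O} {ρ} ρ∈ R<O = 𝟙-no (All.all? (λ ρ → O ρ ≟ R ρ) rows) λ all → <⇒≢ R<O (sym (All.lookup all ρ∈))
  fillings-over (β ∷ bs) {O} ρ∈ R<O = ∑-zero positions λ {q} _ →
    trans (cong (tileWeight q β ℚ.*_) (fillings-over bs ρ∈ (≤-trans R<O (m≤m+n (O _) _)))) (ℚ.*-zeroʳ (tileWeight q β))

  weightOf : (I → ℕ) → ℕ
  weightOf O = sum (map (λ ρ → tensorFactor ρ * O ρ) rows)

  weightOf-raise : ∀ O {ρ} k → ρ ∈ rows → weightOf (raise O ρ k) ≡ weightOf O + tensorFactor ρ * k
  weightOf-raise O {ρ} k ρ∈ = begin
    weightOf (raise O ρ k)
      ≡⟨ sum-map-cong rows (λ ρ′ → *-distribˡ-+ (tensorFactor ρ′) (O ρ′) (δ ρ ρ′ k)) ⟩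
    sum (map (λ ρ′ → tensorFactor ρ′ * O ρ′ + tensorFactor ρ′ * δ ρ ρ′ k) rows)
      ≡⟨ sum-map-+ rows (λ ρ′ → tensorFactor ρ′ * O ρ′) (λ ρ′ → tensorFactor ρ′ * δ ρ ρ′ k) ⟩
    weightOf O + sum (map (λ ρ′ → tensorFactor ρ′ * δ ρ ρ′ k) rows)
      ≡⟨ cong (weightOf O +_) (trans (sum-map-single (λ ρ′ → tensorFactor ρ′ * δ ρ ρ′ k) rows-unique ρ∈
           (λ {ρ′} ne → trans (cong (tensorFactor ρ′ *_) (δ-other k (≢-sym ne))) (*-zeroʳ (tensorFactor ρ′))))
           (cong (tensorFactor ρ *_) (δ-same k))) ⟩
    weightOf O + tensorFactor ρ * k ∎
    where open ≡-Reasoning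

  ∈positions⇒∈rows : ∀ {q} → q ∈ positions → proj₁ q ∈ rows
  ∈positions⇒∈rows q∈ = proj₁ (∈-cartesianProduct⁻ rows bools q∈)

  -- Conservation of weight: a tile in factor f adds scale times degree cells, each of weight f, and
  -- by the fitting condition this is the multiplicity times the degree of its block. This is what
  -- justifies every truncation below.
  fillings-weight : ∀ bs {O} → weightOf R ≢ weightOf O + totalWeight bs → fillings O bs ≡ 0ℚ
  fillings-weight [] {O} ne = 𝟙-no (All.all? (λ ρ → O ρ ≟ R ρ) rows) λ all → ne
    (trans (cong sum (List.map-cong-local (All.map (λ {ρ} eq → cong (tensorFactor ρ *_) (sym eq)) all))) (sym (+-identityʳ (weightOf O))))
  fillings-weight (β ∷ bs) {O} ne = ∑-zero positions λ {q} q∈ →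
    trans (ℚ.*-assoc (𝟙 (fits? q β)) (sign (proj₂ q)) _) (trans (𝟙-*-cong (fits? q β) λ fits →
      trans (cong (sign (proj₂ q) ℚ.*_) (fillings-weight bs λ eq → ne (trans eq (trans
        (cong (_+ totalWeight bs) (weightOf-raise O (lengthIn q β) (∈positions⇒∈rows q∈)))
        (trans (+-assoc (weightOf O) _ _) (cong (λ j → weightOf O + (j + totalWeight bs))
          (trans (swapScale (tensorFactor (proj₁ q)) (scale (proj₂ q)) (degree β)) (cong (_* degree β) (sym fits))))))))) (ℚ.*-zeroʳ (sign (proj₂ q))))
      (ℚ.*-zeroʳ (𝟙 (fits? q β))))
    where
    swapScale : ∀ f s d → f * (s * d) ≡ (s * f) * d
    swapScale f s d = trans (sym (*-assoc f s d)) (cong (_* d) (*-comm f s))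

  -- The identity counts a filling once for every cell that it adds to row ρ,
  -- according to the block containing the cell.

  fillings-picks : ∀ bs O {ρ} → ρ ∈ rows → (ι (R ρ) ℚ.- ι (O ρ)) ℚ.* fillings O bs ≡
    (∑[ p ∈ picks bs ] ∑[ b ∈ bools ] tileWeight (ρ , b) (proj₁ p) ℚ.* (ι (lengthIn (ρ , b) (proj₁ p)) ℚ.*
      fillings (place O (ρ , b) (proj₁ p)) (proj₂ p)))
  fillings-picks [] O {ρ} ρ∈ with All.all? (λ ρ → O ρ ≟ R ρ) rows
  ... | yes all = trans (cong (λ j → (ι (R ρ) ℚ.- ι j) ℚ.* 1ℚ) (All.lookup all ρ∈)) (trans (ℚ.*-identityʳ (ι (R ρ) ℚ.- ι (R ρ))) (ℚ.+-inverseʳ (ι (R ρ))))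
  ... | no _    = ℚ.*-zeroʳ (ι (R ρ) ℚ.- ι (O ρ))
  fillings-picks (β ∷ bs) O {ρ} ρ∈ = begin
    (ι (R ρ) ℚ.- ι (O ρ)) ℚ.* fillings O (β ∷ bs)
      ≡⟨ ∑-*ˡ positions (ι (R ρ) ℚ.- ι (O ρ)) _ ⟨
    (∑[ q ∈ positions ] (ι (R ρ) ℚ.- ι (O ρ)) ℚ.* (tileWeight q β ℚ.* fillings (place O q β) bs))
      ≡⟨ ∑-cong positions distribute ⟩
    (∑[ q ∈ positions ] (ownCells q ℚ.+ otherCells q))
      ≡⟨ ∑-+ positions ownCells otherCells ⟩
    ∑ positions ownCells ℚ.+ ∑ positions otherCells
      ≡⟨ cong₂ ℚ._+_ own other ⟩
    _ ∎
    where
    open ≡-Reasoning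
    open +-*-Solver
    term : (I → ℕ) → Block × List Block → Bool → ℚ
    term O p b = tileWeight (ρ , b) (proj₁ p) ℚ.* (ι (lengthIn (ρ , b) (proj₁ p)) ℚ.* fillings (place O (ρ , b) (proj₁ p)) (proj₂ p))
    ownCells otherCells : I × Bool → ℚ
    ownCells q = ι (δ (proj₁ q) ρ (lengthIn q β)) ℚ.* (tileWeight q β ℚ.* fillings (place O q β) bs)
    otherCells q = tileWeight q β ℚ.* ((ι (R ρ) ℚ.- ι (place O q β ρ)) ℚ.* fillings (place O q β) bs)
    -- What row ρ lacks is what the first tile contributes to it, zero if that tile lies in another
    -- row, plus what is still lacking afterwards.
    distribute : ∀ q → (ι (R ρ) ℚ.- ι (O ρ)) ℚ.* (tileWeight q β ℚ.* fillings (place O q β) bs) ≡ ownCells q ℚ.+ otherCells q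
    distribute q = trans
      (solve 5 (λ r o d t w → (r :- o) :* (t :* w) := d :* (t :* w) :+ t :* ((r :- (o :+ d)) :* w)) refl
        (ι (R ρ)) (ι (O ρ)) (ι (δ (proj₁ q) ρ (lengthIn q β))) (tileWeight q β) (fillings (place O q β) bs))
      (cong (λ j → ownCells q ℚ.+ tileWeight q β ℚ.* ((ι (R ρ) ℚ.- j) ℚ.* fillings (place O q β) bs)) (sym (ι-+ (O ρ) _)))
    own : ∑ positions ownCells ≡ (∑[ b ∈ bools ] term O (β , bs) b)
    own = trans (∑-cartesianProductWith _,_ rows bools ownCells) (trans
      (∑-single (λ ρ′ → ∑[ b ∈ bools ] ownCells (ρ′ , b)) rows-unique ρ∈ λ {ρ′} _ ne → ∑-zero bools λ {b} _ →
        trans (cong (ℚ._* (tileWeight (ρ′ , b) β ℚ.* fillings (place O (ρ′ , b) β) bs)) (trans (cong ι (δ-other (lengthIn (ρ′ , b) β) ne)) ι-0)) (ℚ.*-zeroˡ (tileWeight (ρ′ , b) β ℚ.* fillings (place O (ρ′ , b) β) bs)))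
      (∑-cong bools λ b → trans (cong (λ j → ι j ℚ.* (tileWeight (ρ , b) β ℚ.* fillings (place O (ρ , b) β) bs)) (δ-same {ρ} (lengthIn (ρ , b) β)))
        (solve 3 (λ x y z → x :* (y :* z) := y :* (x :* z)) refl (ι (lengthIn (ρ , b) β)) (tileWeight (ρ , b) β) (fillings (place O (ρ , b) β) bs))))
    -- Only lengths are recorded, so two placements commute and a block from the middle of the list
    -- may be placed before `β`.
    commute : ∀ q b γ → place (place O q β) (ρ , b) γ ≗ place (place O (ρ , b) γ) q β
    commute q b γ ρ′ = trans (+-assoc (O ρ′) _ _) (trans (cong (O ρ′ +_) (+-comm (δ (proj₁ q) ρ′ (lengthIn q β)) _)) (sym (+-assoc (O ρ′) _ _)))
    perPick : ∀ (p : Block × List Block) → (∑[ q ∈ positions ] tileWeight q β ℚ.* (∑[ b ∈ bools ] term (place O q β) p b)) ≡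
              (∑[ b ∈ bools ] term O (proj₁ p , β ∷ proj₂ p) b)
    perPick (γ , cs) = begin
      (∑[ q ∈ positions ] tileWeight q β ℚ.* (∑[ b ∈ bools ] term (place O q β) (γ , cs) b))
        ≡⟨ ∑-cong positions (λ q → ∑-*ˡ bools (tileWeight q β) (term (place O q β) (γ , cs))) ⟨
      (∑[ q ∈ positions ] ∑[ b ∈ bools ] tileWeight q β ℚ.* term (place O q β) (γ , cs) b)
        ≡⟨ ∑-swap positions bools (λ q b → tileWeight q β ℚ.* term (place O q β) (γ , cs) b) ⟩
      (∑[ b ∈ bools ] ∑[ q ∈ positions ] tileWeight q β ℚ.* term (place O q β) (γ , cs) b)
        ≡⟨ ∑-cong bools (λ b → trans (∑-cong positions λ q → trans
             (cong (λ w → tileWeight q β ℚ.* (tileWeight (ρ , b) γ ℚ.* (ι (lengthIn (ρ , b) γ) ℚ.* w))) (fillings-cong cs (commute q b γ)))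
             (solve 4 (λ x y z w → x :* (y :* (z :* w)) := (y :* z) :* (x :* w)) refl (tileWeight q β) (tileWeight (ρ , b) γ) (ι (lengthIn (ρ , b) γ))
               (fillings (place (place O (ρ , b) γ) q β) cs)))
           (trans (∑-*ˡ positions (tileWeight (ρ , b) γ ℚ.* ι (lengthIn (ρ , b) γ)) _) (ℚ.*-assoc (tileWeight (ρ , b) γ) (ι (lengthIn (ρ , b) γ)) _))) ⟩
      (∑[ b ∈ bools ] term O (γ , β ∷ cs) b) ∎
    other : ∑ positions otherCells ≡ (∑[ p ∈ map (λ (γ , cs) → γ , β ∷ cs) (picks bs) ] ∑[ b ∈ bools ] term O p b)
    other = begin
      ∑ positions otherCells
        ≡⟨ ∑-cong positions (λ q → trans (cong (tileWeight q β ℚ.*_) (fillings-picks bs (place O q β) ρ∈))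
             (sym (∑-*ˡ (picks bs) (tileWeight q β) _))) ⟩
      (∑[ q ∈ positions ] ∑[ p ∈ picks bs ] tileWeight q β ℚ.* (∑[ b ∈ bools ] term (place O q β) p b))
        ≡⟨ ∑-swap positions (picks bs) _ ⟩
      (∑[ p ∈ picks bs ] ∑[ q ∈ positions ] tileWeight q β ℚ.* (∑[ b ∈ bools ] term (place O q β) p b))
        ≡⟨ ∑-cong (picks bs) perPick ⟩
      (∑[ p ∈ picks bs ] ∑[ b ∈ bools ] term O (proj₁ p , β ∷ proj₂ p) b)
        ≡⟨ ∑-map (λ (γ , cs) → γ , β ∷ cs) (picks bs) _ ⟨
      _ ∎

-- Sums over multisets of blocks, weighted by 1/z.

∑-upTo-∷ʳ : ∀ k (f : ℕ → ℚ) → ∑ (upTo (suc k)) f ≡ ∑ (upTo k) f ℚ.+ f k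
∑-upTo-∷ʳ k f = trans (cong (λ l → ∑ l f) (sym (List.upTo-∷ʳ k)))
  (trans (∑-++ (upTo k) (k ∷ []) f) (cong (∑ (upTo k) f ℚ.+_) (ℚ.+-identityʳ (f k))))

-- Each of the `m` leading copies leaves the same remainder. The value `pred 0 = 0` does no harm,
-- since its coefficient is `ι 0`.
∑-picks-replicate : ∀ m (x : A) xs (f : A × List A → ℚ) → ∑ (picks (replicate m x ++ xs)) f ≡
  ι m ℚ.* f (x , replicate (pred m) x ++ xs) ℚ.+ (∑[ p ∈ picks xs ] f (proj₁ p , replicate m x ++ proj₂ p))
∑-picks-replicate zero x xs f = begin
  ∑ (picks xs) f                                      ≡⟨ ℚ.+-identityˡ _ ⟨
  0ℚ ℚ.+ ∑ (picks xs) f                               ≡⟨ cong (ℚ._+ ∑ (picks xs) f) (trans (cong (ℚ._* f (x , xs)) ι-0) (ℚ.*-zeroˡ (f (x , xs)))) ⟨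
  ι 0 ℚ.* f (x , xs) ℚ.+ ∑ (picks xs) f               ∎
  where open ≡-Reasoning
∑-picks-replicate (suc m) x xs f = begin
  f (x , rep m xs) ℚ.+ ∑ (map (λ (y , ys) → y , x ∷ ys) (picks (rep m xs))) f
    ≡⟨ cong (f (x , rep m xs) ℚ.+_) (trans (∑-map (λ (y , ys) → y , x ∷ ys) (picks (rep m xs)) f)
         (∑-picks-replicate m x xs (λ (y , ys) → f (y , x ∷ ys)))) ⟩
  f (x , rep m xs) ℚ.+ (ι m ℚ.* f (x , x ∷ rep (pred m) xs) ℚ.+ rest)
    ≡⟨ cong (λ t → f (x , rep m xs) ℚ.+ (t ℚ.+ rest)) (shift m) ⟩
  f (x , rep m xs) ℚ.+ (ι m ℚ.* f (x , rep m xs) ℚ.+ rest)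
    ≡⟨ solve 3 (λ t i r → t :+ (i :* t :+ r) := (con 1ℚ :+ i) :* t :+ r) refl (f (x , rep m xs)) (ι m) rest ⟩
  (1ℚ ℚ.+ ι m) ℚ.* f (x , rep m xs) ℚ.+ rest
    ≡⟨ cong (λ i → i ℚ.* f (x , rep m xs) ℚ.+ rest) (trans (cong (ℚ._+ ι m) (sym ι-1)) (sym (ι-+ 1 m))) ⟩
  ι (suc m) ℚ.* f (x , rep m xs) ℚ.+ rest ∎
  where
  open ≡-Reasoning
  open +-*-Solver
  rep : ℕ → List _ → List _
  rep k ys = replicate k x ++ ys
  rest = ∑[ p ∈ picks xs ] f (proj₁ p , x ∷ rep m (proj₂ p))
  shift : ∀ m → ι m ℚ.* f (x , x ∷ rep (pred m) xs) ≡ ι m ℚ.* f (x , rep m xs)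
  shift zero    = trans (cong (ℚ._* f (x , x ∷ xs)) ι-0) (trans (ℚ.*-zeroˡ (f (x , x ∷ xs)))
                    (sym (trans (cong (ℚ._* f (x , xs)) ι-0) (ℚ.*-zeroˡ (f (x , xs))))))
  shift (suc m) = refl

-- The contribution of k parts equal to d to 1 / z.

recipFactor : ℕ → ℕ → ℚ
recipFactor d zero    = 1ℚ
recipFactor d (suc k) = recipFactor d k ℚ.* (recip d ℚ.* recip (suc k))

-- The choice among `suc k` equal parts and the `d` cells of the chosen part cancel exactly the
-- factor by which z shrinks when that part is removed.
recipFactor-suc : ∀ d k → 1 ≤ d → recipFactor d (suc k) ℚ.* (ι (suc k) ℚ.* ι d) ≡ recipFactor d k
recipFactor-suc (suc d) k _ = begin
  recipFactor (suc d) k ℚ.* (recip (suc d) ℚ.* recip (suc k)) ℚ.* (ι (suc k) ℚ.* ι (suc d))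
    ≡⟨ solve 5 (λ w x y z t → (w :* (x :* y)) :* (z :* t) := w :* ((t :* x) :* (z :* y))) refl
         (recipFactor (suc d) k) (recip (suc d)) (recip (suc k)) (ι (suc k)) (ι (suc d)) ⟩
  recipFactor (suc d) k ℚ.* ((ι (suc d) ℚ.* recip (suc d)) ℚ.* (ι (suc k) ℚ.* recip (suc k)))
    ≡⟨ cong (recipFactor (suc d) k ℚ.*_) (cong₂ ℚ._*_ (ι-recip d) (ι-recip k)) ⟩
  recipFactor (suc d) k ℚ.* 1ℚ
    ≡⟨ ℚ.*-identityʳ (recipFactor (suc d) k) ⟩
  recipFactor (suc d) k ∎
  where
  open ≡-Reasoning
  open +-*-Solver

module MultisetSums (N : ℕ) where

  -- The sum of F bs / z over the multisets bs of blocks with support in ks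
  -- and all multiplicities at most N.

  multisetSum : List Block → (List Block → ℚ) → ℚ
  multisetSum []       F = F []
  multisetSum (β ∷ ks) F =
    ∑[ k ∈ upTo (suc N) ] recipFactor (degree β) k ℚ.* multisetSum ks (λ bs → F (replicate k β ++ bs))

  module _ {Q : Block → Set} where

    multisetSum-cong-All : ∀ {ks F G} → All Q ks → (∀ bs → All Q bs → F bs ≡ G bs) → multisetSum ks F ≡ multisetSum ks G
    multisetSum-cong-All []         F≡G = F≡G [] []
    multisetSum-cong-All {β ∷ ks} (q ∷ qs) F≡G = ∑-cong (upTo (suc N)) λ k → cong (recipFactor (degree β) k ℚ.*_)
      (multisetSum-cong-All qs λ bs qs′ → F≡G (replicate k β ++ bs) (AllP.++⁺ (AllP.replicate⁺ k q) qs′))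

    multisetSum-zero : ∀ {ks F} → All Q ks → (∀ bs → All Q bs → F bs ≡ 0ℚ) → multisetSum ks F ≡ 0ℚ
    multisetSum-zero []         F≡0 = F≡0 [] []
    multisetSum-zero {β ∷ ks} (q ∷ qs) F≡0 = ∑-zero (upTo (suc N)) λ {k} _ → trans (cong (recipFactor (degree β) k ℚ.*_)
      (multisetSum-zero qs λ bs qs′ → F≡0 (replicate k β ++ bs) (AllP.++⁺ (AllP.replicate⁺ k q) qs′))) (ℚ.*-zeroʳ (recipFactor (degree β) k))

    multisetSum-[] : ∀ {ks F} → All Q ks → (∀ β bs → All Q (β ∷ bs) → F (β ∷ bs) ≡ 0ℚ) → multisetSum ks F ≡ F []
    multisetSum-[] []         F≡0 = refl
    multisetSum-[] {β ∷ ks} {F} (q ∷ qs) F≡0 = begin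
      multisetSum (β ∷ ks) F
        ≡⟨ ∑-upTo-suc N (λ k → recipFactor (degree β) k ℚ.* multisetSum ks (λ bs → F (replicate k β ++ bs))) ⟩
      1ℚ ℚ.* multisetSum ks F ℚ.+ (∑[ k ∈ upTo N ] recipFactor (degree β) (suc k) ℚ.* multisetSum ks (λ bs → F (β ∷ replicate k β ++ bs)))
        ≡⟨ cong₂ ℚ._+_ (trans (ℚ.*-identityˡ (multisetSum ks F)) (multisetSum-[] qs F≡0)) (∑-zero (upTo N) λ {k} _ →
             trans (cong (recipFactor (degree β) (suc k) ℚ.*_) (multisetSum-zero qs λ bs qs′ →
               F≡0 β (replicate k β ++ bs) (q ∷ AllP.++⁺ (AllP.replicate⁺ k q) qs′))) (ℚ.*-zeroʳ (recipFactor (degree β) (suc k)))) ⟩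
      F [] ℚ.+ 0ℚ
        ≡⟨ ℚ.+-identityʳ (F []) ⟩
      F [] ∎
      where open ≡-Reasoning

  multisetSum-cong : ∀ ks {F G} → (∀ bs → F bs ≡ G bs) → multisetSum ks F ≡ multisetSum ks G
  multisetSum-cong []       F≡G = F≡G []
  multisetSum-cong (β ∷ ks) F≡G = ∑-cong (upTo (suc N)) λ k → cong (recipFactor (degree β) k ℚ.*_)
    (multisetSum-cong ks λ bs → F≡G (replicate k β ++ bs))

  multisetSum-∑ : ∀ ks (xs : List A) (F : A → List Block → ℚ) →
    multisetSum ks (λ bs → ∑[ x ∈ xs ] F x bs) ≡ (∑[ x ∈ xs ] multisetSum ks (F x))
  multisetSum-∑ []       xs F = refl
  multisetSum-∑ (β ∷ ks) xs F = trans
    (∑-cong (upTo (suc N)) λ k → trans (cong (recipFactor (degree β) k ℚ.*_) (multisetSum-∑ ks xs _)) (sym (∑-*ˡ xs (recipFactor (degree β) k) _)))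
    (∑-swap (upTo (suc N)) xs _)

  multisetSum-+ : ∀ ks (F G : List Block → ℚ) → multisetSum ks (λ bs → F bs ℚ.+ G bs) ≡ multisetSum ks F ℚ.+ multisetSum ks G
  multisetSum-+ []       F G = refl
  multisetSum-+ (β ∷ ks) F G = trans
    (∑-cong (upTo (suc N)) λ k → trans
      (cong (recipFactor (degree β) k ℚ.*_) (multisetSum-+ ks (λ bs → F (replicate k β ++ bs)) (λ bs → G (replicate k β ++ bs))))
      (ℚ.*-distribˡ-+ (recipFactor (degree β) k) (multisetSum ks (λ bs → F (replicate k β ++ bs))) (multisetSum ks (λ bs → G (replicate k β ++ bs)))))
    (∑-+ (upTo (suc N)) (λ k → recipFactor (degree β) k ℚ.* multisetSum ks (λ bs → F (replicate k β ++ bs)))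
      (λ k → recipFactor (degree β) k ℚ.* multisetSum ks (λ bs → G (replicate k β ++ bs))))

  multisetSum-* : ∀ ks c (F : List Block → ℚ) → multisetSum ks (λ bs → c ℚ.* F bs) ≡ c ℚ.* multisetSum ks F
  multisetSum-* []       c F = refl
  multisetSum-* (β ∷ ks) c F = trans
    (∑-cong (upTo (suc N)) λ k → trans (cong (recipFactor (degree β) k ℚ.*_) (multisetSum-* ks c _))
      (solve 3 (λ x y z → x :* (y :* z) := y :* (x :* z)) refl (recipFactor (degree β) k) c (multisetSum ks (λ bs → F (replicate k β ++ bs)))))
    (∑-*ˡ (upTo (suc N)) c _)
    where open +-*-Solver

  multisetSum-++ : ∀ ks ls (F : List Block → ℚ) → multisetSum (ks ++ ls) F ≡ multisetSum ks (λ bs → multisetSum ls (λ cs → F (bs ++ cs)))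
  multisetSum-++ []       ls F = refl
  multisetSum-++ (β ∷ ks) ls F = ∑-cong (upTo (suc N)) λ k → cong (recipFactor (degree β) k ℚ.*_)
    (trans (multisetSum-++ ks ls _) (multisetSum-cong ks λ bs → multisetSum-cong ls λ cs → cong F (sym (List.++-assoc (replicate k β) bs cs))))

  -- If β occurs k times in bs, then removing one of these occurrences
  -- multiplies 1 / z by k times the degree of β.

  multisetSum-picks : ∀ {Q : Block → Set} {ks} (h : Block → List Block → ℚ) → All Q ks → All (λ β → 1 ≤ degree β) ks →
    (∀ {β bs} → Q β → All Q bs → N ≤ length bs → h β bs ≡ 0ℚ) →
    multisetSum ks (λ bs → ∑[ p ∈ picks bs ] ι (degree (proj₁ p)) ℚ.* h (proj₁ p) (proj₂ p)) ≡ (∑[ β ∈ ks ] multisetSum ks (h β))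
  multisetSum-picks                h []       []       h≡0 = refl
  multisetSum-picks {Q} {β ∷ ks} h (q ∷ qs) (d ∷ ds) h≡0 = begin
    (∑[ k ∈ upTo (suc N) ] w k ℚ.* multisetSum ks (λ bs → ∑ (picks (replicate k β ++ bs)) term))
      ≡⟨ ∑-cong (upTo (suc N)) (λ k → cong (w k ℚ.*_) (trans
           (multisetSum-cong ks λ bs → ∑-picks-replicate k β bs term)
           (trans (multisetSum-+ ks _ _) (cong₂ ℚ._+_ (trans (multisetSum-* ks (ι k) _) (cong (ι k ℚ.*_) (multisetSum-* ks (ι (degree β)) _)))
             (multisetSum-picks (λ γ bs → h γ (replicate k β ++ bs)) qs ds
               λ {γ} {bs} q′ qs′ N≤ → h≡0 q′ (AllP.++⁺ (AllP.replicate⁺ k q) qs′)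
                 (≤-trans N≤ (≤-trans (m≤n+m (length bs) _) (≤-reflexive (sym (List.length-++ (replicate k β)))))) ))))) ⟩
    (∑[ k ∈ upTo (suc N) ] w k ℚ.* (ι k ℚ.* (ι (degree β) ℚ.* H (pred k)) ℚ.+ others k))
      ≡⟨ trans (∑-cong (upTo (suc N)) λ k → solve 5 (λ w i d t o → w :* (i :* (d :* t) :+ o) := (w :* (i :* d)) :* t :+ w :* o) refl
           (w k) (ι k) (ι (degree β)) (H (pred k)) (others k)) (∑-+ (upTo (suc N)) (λ k → w k ℚ.* (ι k ℚ.* ι (degree β)) ℚ.* H (pred k)) (λ k → w k ℚ.* others k)) ⟩
    (∑[ k ∈ upTo (suc N) ] w k ℚ.* (ι k ℚ.* ι (degree β)) ℚ.* H (pred k)) ℚ.+ (∑[ k ∈ upTo (suc N) ] w k ℚ.* others k)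
      ≡⟨ cong₂ ℚ._+_ own (trans (∑-cong (upTo (suc N)) λ k → sym (∑-*ˡ ks (w k) _)) (∑-swap (upTo (suc N)) ks _)) ⟩
    multisetSum (β ∷ ks) (h β) ℚ.+ (∑[ γ ∈ ks ] multisetSum (β ∷ ks) (h γ)) ∎
    where
    open ≡-Reasoning
    open +-*-Solver
    term : Block × List Block → ℚ
    term p = ι (degree (proj₁ p)) ℚ.* h (proj₁ p) (proj₂ p)
    w : ℕ → ℚ
    w = recipFactor (degree β)
    H : ℕ → ℚ
    H k = multisetSum ks (λ bs → h β (replicate k β ++ bs))
    others : ℕ → ℚ
    others k = ∑[ γ ∈ ks ] multisetSum ks (λ bs → h γ (replicate k β ++ bs))
    -- Removing a copy shifts the range 1, ..., N to 0, ..., N - 1, but a multiset sum also has an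
    -- N-th term. That term belongs to lists of at least N blocks, where `h` vanishes.
    HN≡0 : H N ≡ 0ℚ
    HN≡0 = multisetSum-zero qs λ bs qs′ → h≡0 q (AllP.++⁺ (AllP.replicate⁺ N q) qs′)
      (≤-trans (≤-reflexive (sym (List.length-replicate N))) (≤-trans (m≤m+n _ (length bs)) (≤-reflexive (sym (List.length-++ (replicate N β))))))
    own : (∑[ k ∈ upTo (suc N) ] w k ℚ.* (ι k ℚ.* ι (degree β)) ℚ.* H (pred k)) ≡ multisetSum (β ∷ ks) (h β)
    own = begin
      (∑[ k ∈ upTo (suc N) ] w k ℚ.* (ι k ℚ.* ι (degree β)) ℚ.* H (pred k))
        ≡⟨ ∑-upTo-suc N (λ k → w k ℚ.* (ι k ℚ.* ι (degree β)) ℚ.* H (pred k)) ⟩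
      w 0 ℚ.* (ι 0 ℚ.* ι (degree β)) ℚ.* H 0 ℚ.+ (∑[ k ∈ upTo N ] w (suc k) ℚ.* (ι (suc k) ℚ.* ι (degree β)) ℚ.* H k)
        ≡⟨ cong₂ ℚ._+_ (trans (cong (λ i → w 0 ℚ.* (i ℚ.* ι (degree β)) ℚ.* H 0) ι-0)
             (solve 2 (λ x y → (con 1ℚ :* (con 0ℚ :* x)) :* y := con 0ℚ) refl (ι (degree β)) (H 0)))
             (∑-cong (upTo N) λ k → cong (ℚ._* H k) (recipFactor-suc (degree β) k d)) ⟩
      0ℚ ℚ.+ (∑[ k ∈ upTo N ] w k ℚ.* H k)
        ≡⟨ ℚ.+-comm 0ℚ (∑[ k ∈ upTo N ] w k ℚ.* H k) ⟩
      (∑[ k ∈ upTo N ] w k ℚ.* H k) ℚ.+ 0ℚ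
        ≡⟨ cong ((∑[ k ∈ upTo N ] w k ℚ.* H k) ℚ.+_) (trans (cong (w N ℚ.*_) HN≡0) (ℚ.*-zeroʳ (w N))) ⟨
      (∑[ k ∈ upTo N ] w k ℚ.* H k) ℚ.+ w N ℚ.* H N
        ≡⟨ ∑-upTo-∷ʳ N (λ k → w k ℚ.* H k) ⟨
      (∑[ k ∈ upTo (suc N) ] w k ℚ.* H k) ∎

-- Auxiliary bounds and finite products of series.

sum-map-≤ : ∀ (xs : List A) {f g : A → ℕ} → (∀ x → f x ≤ g x) → sum (map f xs) ≤ sum (map g xs)
sum-map-≤ []       f≤g = z≤n
sum-map-≤ (x ∷ xs) f≤g = +-mono-≤ (f≤g x) (sum-map-≤ xs f≤g)

sum-map-< : ∀ {xs : List A} {f g : A → ℕ} {x} → (∀ x → f x ≤ g x) → x ∈ xs → f x < g x → sum (map f xs) < sum (map g xs)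
sum-map-< {xs = x ∷ xs} f≤g (here refl) f<g = +-mono-≤ f<g (sum-map-≤ xs f≤g)
sum-map-< {xs = y ∷ xs} {f} {g} f≤g (there x∈) f<g =
  ≤-trans (≤-reflexive (sym (+-suc (f y) _))) (+-mono-≤ (f≤g y) (sum-map-< f≤g x∈ f<g))

Positive : Block → Set
Positive β = 1 ≤ degree β × 1 ≤ multiplicity β

length≤totalWeight : ∀ {bs} → All Positive bs → length bs ≤ totalWeight bs
length≤totalWeight []              = z≤n
length≤totalWeight ((d , r) ∷ ps) = +-mono-≤ (*-mono-≤ r d) (length≤totalWeight ps)

picks-All : ∀ {Q : A → Set} {xs} → All Q xs → ∀ {p} → p ∈ picks xs → Q (proj₁ p) × All Q (proj₂ p)
picks-All (q ∷ qs) (here refl) = q , qs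
picks-All (q ∷ qs) (there p∈) with ∈-map⁻ _ p∈
... | p′ , p′∈ , refl with picks-All qs p′∈
...   | q′ , qs′ = q′ , q ∷ qs′

module Products {a b : ℕ} where
  open Convolution {a} {b}
  open Substitution {a} {b}
  open Newton {a} {b}
  open Exponents {a} {b}

  blockSeries : (ℕ → Series) → Block → Monomial a b → ℚ
  blockSeries F β = pow (multiplicity β) (F (degree β))

  blockProduct-picks : ∀ F bs {p} → p ∈ picks bs → ∀ (e : Monomial a b) →
    blockProduct F bs e ≡ (blockSeries F (proj₁ p) ⊛ blockProduct F (proj₂ p)) e
  blockProduct-picks F (β ∷ bs) (here refl) e = refl
  blockProduct-picks F (β ∷ bs) (there p∈) e with ∈-map⁻ _ p∈
  ... | (γ , cs) , p′∈ , refl = trans (⊛-congˡ (blockSeries F β) (blockProduct-picks F bs p′∈) e)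
    (⊛-leftComm (blockSeries F β) (blockSeries F γ) (blockProduct F cs) e)

  ∏ : {I : Set} → List I → (I → Monomial a b → ℚ) → Monomial a b → ℚ
  ∏ []       X = 1ˢ
  ∏ (i ∷ is) X = X i ⊛ ∏ is X

  ∏-cong : ∀ {I : Set} (is : List I) {X Y : I → Monomial a b → ℚ} → (∀ {i} → i ∈ is → X i ≗ Y i) → ∏ is X ≗ ∏ is Y
  ∏-cong []       X≗Y e = refl
  ∏-cong (i ∷ is) X≗Y e = ⊛-cong (X≗Y (here refl)) (∏-cong is (X≗Y ∘ there)) e

  ∏-1 : ∀ {I : Set} (is : List I) {X : I → Monomial a b → ℚ} → (∀ {i} → i ∈ is → X i ≗ 1ˢ) → ∏ is X ≗ 1ˢ
  ∏-1 []       X≗1 e = refl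
  ∏-1 (i ∷ is) X≗1 e = trans (⊛-cong (X≗1 (here refl)) (∏-1 is (X≗1 ∘ there)) e) (⊛-identityˡ 1ˢ e)

  ∏-zero : ∀ {I : Set} {is : List I} {i} {X : I → Monomial a b → ℚ} → i ∈ is → (∀ e → X i e ≡ 0ℚ) → ∀ e → ∏ is X e ≡ 0ℚ
  ∏-zero {is = i ∷ is} {X = X} (here refl) X≡0 e = ⊛-zeroˡ (∏ is X) X≡0 e
  ∏-zero {is = i ∷ is} {X = X} (there i∈)  X≡0 e = trans (⊛-comm (X i) (∏ is X) e) (⊛-zeroˡ (X i) (∏-zero i∈ X≡0) e)

  -- One `rest` serves all families that differ from `X` only at `i`. In the recursion for a row,
  -- all offsets that arise by raising this row therefore share the same remaining product.
  ∏-extract : ∀ {I : Set} {is : List I} {i} (X : I → Monomial a b → ℚ) → Unique is → i ∈ is →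
    ∃[ rest ] (∀ Y → (∀ {j} → i ≢ j → Y j ≗ X j) → ∏ is Y ≗ Y i ⊛ rest)
  ∏-extract {is = i ∷ is} X (i∉ ∷ u) (here refl) = ∏ is X , λ Y Y≗X →
    ⊛-congˡ (Y i) (∏-cong is λ j∈ → Y≗X (All.lookup i∉ j∈))
  ∏-extract {is = j ∷ is} {i} X (j∉ ∷ u) (there i∈) with ∏-extract X u i∈
  ... | rest , extract = X j ⊛ rest , λ Y Y≗X e → trans (⊛-cong (Y≗X (λ i≡j → All.lookup j∉ i∈ (sym i≡j))) (extract Y Y≗X) e)
    (⊛-leftComm (X j) (Y i) rest e)

  deg-0ᴹ : deg 0ᴹ ≡ 0
  deg-0ᴹ = trans (deg-exponent 0ᴹ) (sum-map-zero (allFin a) λ {k} _ → trans (cong (suc (toℕ k) *_)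
    (sum-map-zero (allFin b) λ {l} _ → exponent-0 k l)) (*-zeroʳ (suc (toℕ k))))
    where
    exponent-0 : ∀ k l → exponent 0ᴹ k l ≡ 0
    exponent-0 k l = trans (cong (λ v → Vec.lookup v l) (Vec.lookup-replicate k (Vec.replicate b 0))) (Vec.lookup-replicate l 0)

  deg≡0⇒0ᴹ : ∀ {e} → deg e ≡ 0 → e ≡ 0ᴹ
  deg≡0⇒0ᴹ {e} eq = exponent-ext λ k l → trans (zero! {e} eq k l) (sym (zero! {0ᴹ} deg-0ᴹ k l))
    where
    zero! : ∀ {e} → deg e ≡ 0 → ∀ k l → exponent e k l ≡ 0
    zero! {e} eq k l = n≤0⇒n≡0 (≤-trans (exponent≤deg e k l) (≤-reflexive eq))

  E∸-diagonal : ∀ R → E∸ R R ≗ 1ˢ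
  E∸-diagonal R e = 𝟙-⇔ (squareFree? e ×-dec (deg e + R ≟ R)) (e ≟ᴹ 0ᴹ)
    (λ (_ , eq) → deg≡0⇒0ᴹ (+-cancelʳ-≡ R (deg e) 0 eq))
    (λ { refl → squareFree⇐ (λ k l → ≤-trans (exponent≤deg 0ᴹ k l) (≤-trans (≤-reflexive deg-0ᴹ) z≤n)) , cong (_+ R) deg-0ᴹ })

  E∸-over : ∀ {R O} → R < O → ∀ e → E∸ R O e ≡ 0ℚ
  E∸-over {R} {O} R<O e = 𝟙-no (squareFree? e ×-dec (deg e + O ≟ R)) λ (_ , eq) →
    <⇒≱ R<O (≤-trans (m≤n+m O (deg e)) (≤-reflexive eq))

  0ᴹ-^ : ∀ r → 0ᴹ ^ᴹ r ≡ 0ᴹ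
  0ᴹ-^ r = trans (Vec.map-replicate _ _ a) (cong (Vec.replicate a) (trans (Vec.map-replicate _ 0 b) (cong (Vec.replicate b) (*-zeroʳ r))))

  pow-1ˢ : ∀ r → pow (suc r) 1ˢ ≗ 1ˢ
  pow-1ˢ r e with isPower? r e
  ... | no ¬pow = trans (pow-nonpower (suc r) 1ˢ ¬pow) (sym (𝟙-no (e ≟ᴹ 0ᴹ) λ { refl → ¬pow (0ᴹ , 0ᴹ-^ (suc r)) }))
  ... | yes (y , refl) = trans (pow-^ᴹ r 1ˢ y) (𝟙-⇔ (y ≟ᴹ 0ᴹ) ((y ^ᴹ suc r) ≟ᴹ 0ᴹ)
          (λ { refl → 0ᴹ-^ (suc r) }) (λ eq → ^ᴹ-injective r (trans eq (sym (0ᴹ-^ (suc r))))))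

-- The common recursion and the induction on missing cells.

module FillingExpansion {I : Set} (_≟ᴵ_ : DecidableEquality I) (rows : List I) (rows-unique : Unique rows)
  (tf : I → ℕ) (R : I → ℕ) (n : ℕ) (weight≡n : sum (map (λ ρ → suc (tf ρ) * R ρ) rows) ≡ n)
  (ks : List Block) (ks-positive : All Positive ks)
  (∑-ks : ∀ g → ∑ ks g ≡ (∑[ r ∈ upTo n ] ∑[ d ∈ upTo n ] g (block (suc d) (suc r))))
  {a b : ℕ} where

  open Placements _≟ᴵ_ rows rows-unique (suc ∘ tf) R
  open MultisetSums n
  open Convolution {a} {b}
  open Substitution {a} {b}
  open Newton {a} {b}
  open Products {a} {b}

  -- The claimed expansion of `eProduct O`. With empty rows the pair becomes the claimed sum and
  -- E⁺_σ; with `O` equal to `R` on all rows both are 1.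
  pExpansion : (I → ℕ) → Monomial a b → ℚ
  pExpansion O e = multisetSum ks (λ bs → fillings O bs ℚ.* blockProduct P bs e)

  rowSeries : (I → ℕ) → I → Monomial a b → ℚ
  rowSeries O ρ = pow (suc (tf ρ)) (E∸ (R ρ) (O ρ))

  eProduct : (I → ℕ) → Monomial a b → ℚ
  eProduct O = ∏ rows (rowSeries O)

  row-weight≤n : ∀ {ρ} → ρ ∈ rows → suc (tf ρ) * R ρ ≤ n
  row-weight≤n ρ∈ = ≤-trans (∈⇒≤sum (∈-map⁺ _ ρ∈)) (≤-reflexive weight≡n)

  R≤n : ∀ {ρ} → ρ ∈ rows → R ρ ≤ n
  R≤n {ρ} ρ∈ = ≤-trans (m≤m+n (R ρ) (tf ρ * R ρ)) (row-weight≤n ρ∈)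

  ⊛-pExpansion : ∀ F O e → multisetSum ks (λ bs → fillings O bs ℚ.* (F ⊛ blockProduct P bs) e) ≡ (F ⊛ pExpansion O) e
  ⊛-pExpansion F O e = begin
    multisetSum ks (λ bs → fillings O bs ℚ.* (F ⊛ blockProduct P bs) e)
      ≡⟨ multisetSum-cong ks (λ bs → trans (sym (∑-*ˡ (factorisations e) (fillings O bs) _)) (∑-cong (factorisations e) λ p →
           solve 3 (λ x y z → x :* (y :* z) := y :* (x :* z)) refl (fillings O bs) (F (proj₁ p)) (blockProduct P bs (proj₂ p)))) ⟩
    multisetSum ks (λ bs → ∑[ p ∈ factorisations e ] F (proj₁ p) ℚ.* (fillings O bs ℚ.* blockProduct P bs (proj₂ p)))
      ≡⟨ multisetSum-∑ ks (factorisations e) (λ p bs → F (proj₁ p) ℚ.* (fillings O bs ℚ.* blockProduct P bs (proj₂ p))) ⟩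
    (∑[ p ∈ factorisations e ] multisetSum ks (λ bs → F (proj₁ p) ℚ.* (fillings O bs ℚ.* blockProduct P bs (proj₂ p))))
      ≡⟨ ∑-cong (factorisations e) (λ p → multisetSum-* ks (F (proj₁ p)) _) ⟩
    (F ⊛ pExpansion O) e ∎
    where
    open ≡-Reasoning
    open +-*-Solver

  -- The summand after the tile on `γ` has been placed and `γ` removed from the content. The factor
  -- `degree γ` stays outside, where `multisetSum-picks` absorbs it into 1/z; of the number of cells
  -- only `scale c` is kept.
  removeBlock : (I → ℕ) → I → Monomial a b → Block → List Block → ℚ
  removeBlock O ρ e γ bs = ∑[ c ∈ bools ] (tileWeight (ρ , c) γ ℚ.* ι (scale c)) ℚ.*
    (fillings (place O (ρ , c) γ) bs ℚ.* (blockSeries P γ ⊛ blockProduct P bs) e)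

  -- Every positive block weighs at least 1, so the placed tile and `n` further blocks together
  -- exceed the weight `n` of the full shape, and no filling exists. This is the vanishing required
  -- by `multisetSum-picks`.
  removeBlock-long : ∀ O {ρ} → ρ ∈ rows → ∀ e {γ bs} → Positive γ → All Positive bs → n ≤ length bs → removeBlock O ρ e γ bs ≡ 0ℚ
  removeBlock-long O {ρ} ρ∈ e {γ} {bs} (d , _) pos n≤ = ∑-zero bools λ {c} _ → trans
    (cong (λ w → (tileWeight (ρ , c) γ ℚ.* ι (scale c)) ℚ.* (w ℚ.* (blockSeries P γ ⊛ blockProduct P bs) e)) (fillings-weight bs λ eq →
      <⇒≱ (≤-trans (s≤s n≤) (≤-trans (s≤s (length≤totalWeight pos)) (+-monoˡ-≤ (totalWeight bs) (long c))))
        (≤-reflexive (trans (sym eq) weight≡n))))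
    (solve 2 (λ x y → x :* (con 0ℚ :* y) := con 0ℚ) refl (tileWeight (ρ , c) γ ℚ.* ι (scale c)) ((blockSeries P γ ⊛ blockProduct P bs) e))
    where
    open +-*-Solver
    long : ∀ c → 1 ≤ weightOf (place O (ρ , c) γ)
    long c = ≤-trans (≤-trans (*-mono-≤ (s≤s (z≤n {tf ρ})) (*-mono-≤ (scale≥1 c) d)) (m≤n+m _ (weightOf O)))
      (≤-reflexive (sym (weightOf-raise O (lengthIn (ρ , c) γ) ρ∈)))

  -- The cells missing in row ρ are counted by the tiles that will contain them. Of the
  -- `scale c * degree γ` cells of such a tile, the degree goes into 1/z along with the number of
  -- copies of `γ`.
  pExpansion-row : ∀ O {ρ} → ρ ∈ rows → ∀ e →
    (ι (R ρ) ℚ.- ι (O ρ)) ℚ.* pExpansion O e ≡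
    (∑[ γ ∈ ks ] ∑[ c ∈ bools ] (tileWeight (ρ , c) γ ℚ.* ι (scale c)) ℚ.* (blockSeries P γ ⊛ pExpansion (place O (ρ , c) γ)) e)
  pExpansion-row O {ρ} ρ∈ e = begin
    (ι (R ρ) ℚ.- ι (O ρ)) ℚ.* pExpansion O e
      ≡⟨ multisetSum-* ks (ι (R ρ) ℚ.- ι (O ρ)) _ ⟨
    multisetSum ks (λ bs → (ι (R ρ) ℚ.- ι (O ρ)) ℚ.* (fillings O bs ℚ.* blockProduct P bs e))
      ≡⟨ multisetSum-cong ks (λ bs → trans (sym (ℚ.*-assoc (ι (R ρ) ℚ.- ι (O ρ)) (fillings O bs) _))
           (trans (cong (ℚ._* blockProduct P bs e) (fillings-picks bs O ρ∈)) (trans (sym (∑-*ʳ (picks bs) (blockProduct P bs e) _))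
             (∑-cong-∈ (picks bs) (λ {p} p∈ → perPick bs p p∈))))) ⟩
    multisetSum ks (λ bs → ∑[ p ∈ picks bs ] ι (degree (proj₁ p)) ℚ.* removeBlock O ρ e (proj₁ p) (proj₂ p))
      ≡⟨ multisetSum-picks (removeBlock O ρ e) ks-positive (All.map proj₁ ks-positive) (removeBlock-long O ρ∈ e) ⟩
    (∑[ γ ∈ ks ] multisetSum ks (removeBlock O ρ e γ))
      ≡⟨ ∑-cong ks (λ γ → trans (multisetSum-∑ ks bools (λ c bs → (tileWeight (ρ , c) γ ℚ.* ι (scale c)) ℚ.* (fillings (place O (ρ , c) γ) bs ℚ.* (blockSeries P γ ⊛ blockProduct P bs) e))) (∑-cong bools λ c →
           trans (multisetSum-* ks (tileWeight (ρ , c) γ ℚ.* ι (scale c)) _) (cong ((tileWeight (ρ , c) γ ℚ.* ι (scale c)) ℚ.*_) (⊛-pExpansion (blockSeries P γ) (place O (ρ , c) γ) e)))) ⟩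
    _ ∎
    where
    open ≡-Reasoning
    open +-*-Solver
    perPick : ∀ bs p → p ∈ picks bs →
      (∑[ c ∈ bools ] tileWeight (ρ , c) (proj₁ p) ℚ.* (ι (lengthIn (ρ , c) (proj₁ p)) ℚ.* fillings (place O (ρ , c) (proj₁ p)) (proj₂ p))) ℚ.* blockProduct P bs e
      ≡ ι (degree (proj₁ p)) ℚ.* removeBlock O ρ e (proj₁ p) (proj₂ p)
    perPick bs (γ , cs) p∈ = begin
      (∑[ c ∈ bools ] tileWeight (ρ , c) γ ℚ.* (ι (lengthIn (ρ , c) γ) ℚ.* fillings (place O (ρ , c) γ) cs)) ℚ.* blockProduct P bs e
        ≡⟨ cong ((∑[ c ∈ bools ] tileWeight (ρ , c) γ ℚ.* (ι (lengthIn (ρ , c) γ) ℚ.* fillings (place O (ρ , c) γ) cs)) ℚ.*_) (blockProduct-picks P bs p∈ e) ⟩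
      (∑[ c ∈ bools ] tileWeight (ρ , c) γ ℚ.* (ι (lengthIn (ρ , c) γ) ℚ.* fillings (place O (ρ , c) γ) cs)) ℚ.* picked
        ≡⟨ ∑-*ʳ bools picked (λ c → tileWeight (ρ , c) γ ℚ.* (ι (lengthIn (ρ , c) γ) ℚ.* fillings (place O (ρ , c) γ) cs)) ⟨
      (∑[ c ∈ bools ] tileWeight (ρ , c) γ ℚ.* (ι (lengthIn (ρ , c) γ) ℚ.* fillings (place O (ρ , c) γ) cs) ℚ.* picked)
        ≡⟨ ∑-cong bools (λ c → trans (cong (λ j → tileWeight (ρ , c) γ ℚ.* (j ℚ.* fillings (place O (ρ , c) γ) cs) ℚ.* picked) (ι-* (scale c) (degree γ)))
             (solve 5 (λ t s d w x → (t :* ((s :* d) :* w)) :* x := d :* ((t :* s) :* (w :* x))) refl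
               (tileWeight (ρ , c) γ) (ι (scale c)) (ι (degree γ)) (fillings (place O (ρ , c) γ) cs) picked)) ⟩
      (∑[ c ∈ bools ] ι (degree γ) ℚ.* ((tileWeight (ρ , c) γ ℚ.* ι (scale c)) ℚ.* (fillings (place O (ρ , c) γ) cs ℚ.* picked)))
        ≡⟨ ∑-*ˡ bools (ι (degree γ)) (λ c → (tileWeight (ρ , c) γ ℚ.* ι (scale c)) ℚ.* (fillings (place O (ρ , c) γ) cs ℚ.* picked)) ⟩
      ι (degree γ) ℚ.* removeBlock O ρ e γ cs ∎
      where
      picked = (blockSeries P γ ⊛ blockProduct P cs) e

  eProduct-over : ∀ O {ρ} → ρ ∈ rows → R ρ < O ρ → ∀ e → eProduct O e ≡ 0ℚ
  eProduct-over O {ρ} ρ∈ R<O = ∏-zero ρ∈ λ e → trans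
    (pow-cong {F = E∸ (R ρ) (O ρ)} {G = λ _ → 0ℚ} (suc (tf ρ)) (E∸-over R<O) e) (∑-zero (filter (λ p → (proj₁ p ^ᴹ suc (tf ρ)) ≟ᴹ e) (factorisations e)) (λ _ → refl))

  -- Only the factor of row ρ depends on the tile. A fitting block has multiplicity `scale c * f`,
  -- and substituting these powers into P_d means substituting first `scale c`-th and then `f`-th
  -- powers; so the sum is Newton's identity with `f`-th powers substituted, times the other rows.
  eProduct-row : ∀ O {ρ} → ρ ∈ rows → ∀ e →
    (∑[ γ ∈ ks ] ∑[ c ∈ bools ] (tileWeight (ρ , c) γ ℚ.* ι (scale c)) ℚ.* (blockSeries P γ ⊛ eProduct (place O (ρ , c) γ)) e) ≡
    (ι (R ρ) ℚ.- ι (O ρ)) ℚ.* eProduct O e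
  eProduct-row O {ρ} ρ∈ e with ∏-extract (rowSeries O) rows-unique ρ∈
  ... | rest , extract = begin
    (∑[ γ ∈ ks ] ∑[ c ∈ bools ] X c γ)
      ≡⟨ trans (∑-swap ks bools (λ γ c → X c γ)) (∑-cong bools λ c → trans (∑-ks (X c)) (perScale c)) ⟩
    (∑[ c ∈ bools ] sign c ℚ.* ι (scale c) ℚ.* (pow f (T c) ⊛ rest) e)
      ≡⟨ combine ⟩
    (pow f (λ y → T false y ℚ.+ -2ℚ ℚ.* T true y) ⊛ rest) e
      ≡⟨ ⊛-congʳ rest (λ y → trans (pow-cong f (λ y → newton n (R ρ) (O ρ) y (R≤n ρ∈)) y) (pow-* f (ι (R ρ) ℚ.- ι (O ρ)) (E∸ (R ρ) (O ρ)) y)) e ⟩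
    ((λ y → (ι (R ρ) ℚ.- ι (O ρ)) ℚ.* rowSeries O ρ y) ⊛ rest) e
      ≡⟨ ⊛-*ˡ (ι (R ρ) ℚ.- ι (O ρ)) (rowSeries O ρ) rest e ⟩
    (ι (R ρ) ℚ.- ι (O ρ)) ℚ.* (rowSeries O ρ ⊛ rest) e
      ≡⟨ cong ((ι (R ρ) ℚ.- ι (O ρ)) ℚ.*_) (extract (rowSeries O) (λ _ _ → refl) e) ⟨
    (ι (R ρ) ℚ.- ι (O ρ)) ℚ.* eProduct O e ∎
    where
    open ≡-Reasoning
    open +-*-Solver
    f = suc (tf ρ)
    X : Bool → Block → ℚ
    X c γ = (tileWeight (ρ , c) γ ℚ.* ι (scale c)) ℚ.* (blockSeries P γ ⊛ eProduct (place O (ρ , c) γ)) e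
    T : Bool → Monomial a b → ℚ
    T c y = ∑[ d ∈ upTo n ] (pow (scale c) (P (suc d)) ⊛ E∸ (R ρ) (O ρ + scale c * suc d)) y
    combine : (∑[ c ∈ bools ] sign c ℚ.* ι (scale c) ℚ.* (pow f (T c) ⊛ rest) e) ≡ (pow f (λ y → T false y ℚ.+ -2ℚ ℚ.* T true y) ⊛ rest) e
    combine = begin
      (1ℚ ℚ.* ι 1 ℚ.* (pow f (T false) ⊛ rest) e) ℚ.+ ((ℚ.- 1ℚ ℚ.* ι 2 ℚ.* (pow f (T true) ⊛ rest) e) ℚ.+ 0ℚ)
        ≡⟨ cong₂ (λ i j → (1ℚ ℚ.* i ℚ.* (pow f (T false) ⊛ rest) e) ℚ.+ ((ℚ.- 1ℚ ℚ.* j ℚ.* (pow f (T true) ⊛ rest) e) ℚ.+ 0ℚ)) ι-1 (trans (ι-+ 1 1) (cong₂ ℚ._+_ ι-1 ι-1)) ⟩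
      (1ℚ ℚ.* 1ℚ ℚ.* (pow f (T false) ⊛ rest) e) ℚ.+ ((ℚ.- 1ℚ ℚ.* (1ℚ ℚ.+ 1ℚ) ℚ.* (pow f (T true) ⊛ rest) e) ℚ.+ 0ℚ)
        ≡⟨ solve 2 (λ x y → con 1ℚ :* con 1ℚ :* x :+ ((:- con 1ℚ) :* (con 1ℚ :+ con 1ℚ) :* y :+ con 0ℚ) := x :+ con -2ℚ :* y) refl
             ((pow f (T false) ⊛ rest) e) ((pow f (T true) ⊛ rest) e) ⟩
      (pow f (T false) ⊛ rest) e ℚ.+ -2ℚ ℚ.* (pow f (T true) ⊛ rest) e
        ≡⟨ cong ((pow f (T false) ⊛ rest) e ℚ.+_) (⊛-*ˡ -2ℚ (pow f (T true)) rest e) ⟨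
      (pow f (T false) ⊛ rest) e ℚ.+ ((λ y → -2ℚ ℚ.* pow f (T true) y) ⊛ rest) e
        ≡⟨ ⊛-+ˡ (pow f (T false)) (λ y → -2ℚ ℚ.* pow f (T true) y) rest e ⟨
      ((λ y → pow f (T false) y ℚ.+ -2ℚ ℚ.* pow f (T true) y) ⊛ rest) e
        ≡⟨ ⊛-congʳ rest (λ y → trans (pow-+ f (T false) (λ y → -2ℚ ℚ.* T true y) y) (cong (pow f (T false) y ℚ.+_) (pow-* f -2ℚ (T true) y))) e ⟨
      (pow f (λ y → T false y ℚ.+ -2ℚ ℚ.* T true y) ⊛ rest) e ∎
    pow-scale : ∀ c F → pow (scale c * f) F ≗ pow f (pow (scale c) F)
    pow-scale false F y = sym (pow-pow (tf ρ) 0 F y)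
    pow-scale true  F y = sym (pow-pow (tf ρ) 1 F y)
    eProduct-place : ∀ k → eProduct (raise O ρ k) ≗ pow f (E∸ (R ρ) (O ρ + k)) ⊛ rest
    eProduct-place k y = trans (extract (rowSeries (raise O ρ k)) (λ {j} ρ≢j y → cong (λ i → pow (suc (tf j)) (E∸ (R j) i) y) (raise-other O k ρ≢j)) y)
      (cong (λ i → (pow f (E∸ (R ρ) i) ⊛ rest) y) (raise-same O ρ k))
    perScale : ∀ c → (∑[ r ∈ upTo n ] ∑[ d ∈ upTo n ] X c (block (suc d) (suc r))) ≡ sign c ℚ.* ι (scale c) ℚ.* (pow f (T c) ⊛ rest) e
    perScale c = begin
      (∑[ r ∈ upTo n ] ∑[ d ∈ upTo n ] X c (block (suc d) (suc r)))
        ≡⟨ ∑-cong (upTo n) (λ r → trans (∑-cong (upTo n) λ d → solve 4 (λ t s i x → ((t :* s) :* i) :* x := (t :* (s :* i)) :* x) refl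
             (𝟙 (suc r ≟ scale c * f)) (sign c) (ι (scale c)) (Z (suc r) d)) (trans (∑-*ˡ (upTo n) (𝟙 (suc r ≟ scale c * f) ℚ.* (sign c ℚ.* ι (scale c))) (Z (suc r)))
               (solve 3 (λ t s x → (t :* s) :* x := s :* (t :* x)) refl (𝟙 (suc r ≟ scale c * f)) (sign c ℚ.* ι (scale c)) (∑ (upTo n) (Z (suc r)))))) ⟩
      (∑[ r ∈ upTo n ] (sign c ℚ.* ι (scale c)) ℚ.* (𝟙 (suc r ≟ scale c * f) ℚ.* ∑ (upTo n) (Z (suc r))))
        ≡⟨ trans (∑-*ˡ (upTo n) (sign c ℚ.* ι (scale c)) _) (cong ((sign c ℚ.* ι (scale c)) ℚ.*_) (∑-at (λ r → ∑ (upTo n) (Z r)) (*-mono-≤ (scale≥1 c) (s≤s z≤n)) outside)) ⟩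
      (sign c ℚ.* ι (scale c)) ℚ.* ∑ (upTo n) (Z (scale c * f))
        ≡⟨ cong ((sign c ℚ.* ι (scale c)) ℚ.*_) sumZ ⟩
      sign c ℚ.* ι (scale c) ℚ.* (pow f (T c) ⊛ rest) e ∎
      where
      Z : ℕ → ℕ → ℚ
      Z r d = (pow r (P (suc d)) ⊛ eProduct (raise O ρ (scale c * suc d))) e
      ∑-at : ∀ (Y : ℕ → ℚ) {q} → 1 ≤ q → (n < q → Y q ≡ 0ℚ) → (∑[ r ∈ upTo n ] 𝟙 (suc r ≟ q) ℚ.* Y (suc r)) ≡ Y q
      ∑-at Y {suc q} _ Y≡0 with q <? n
      ... | yes q<n = trans
        (∑-single (λ r → 𝟙 (suc r ≟ suc q) ℚ.* Y (suc r)) (Unique.upTo⁺ n) (∈-upTo⁺ q<n)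
          (λ {r} _ r≢q → trans (cong (ℚ._* Y (suc r)) (𝟙-no (suc r ≟ suc q) (r≢q ∘ suc-injective))) (ℚ.*-zeroˡ (Y (suc r)))))
        (trans (cong (ℚ._* Y (suc q)) (𝟙-yes (suc q ≟ suc q) refl)) (ℚ.*-identityˡ (Y (suc q))))
      ... | no q≮n = trans (∑-zero (upTo n) λ {r} r∈ → trans (cong (ℚ._* Y (suc r)) (𝟙-no (suc r ≟ suc q) λ eq →
        q≮n (subst (_< n) (suc-injective eq) (∈-upTo⁻ r∈)))) (ℚ.*-zeroˡ (Y (suc r)))) (sym (Y≡0 (s≤s (≮⇒≥ q≮n))))
      -- The required multiplicity may lie outside the range. Then f times R ρ is at most n, hence
      -- below `scale c * f`, so R ρ is smaller than `scale c` and even the shortest such tile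
      -- overfills the row.
      outside : n < scale c * f → ∑ (upTo n) (Z (scale c * f)) ≡ 0ℚ
      outside n<sf = ∑-zero (upTo n) λ {d} _ → trans (⊛-comm (pow (scale c * f) (P (suc d))) (eProduct (raise O ρ (scale c * suc d))) e)
        (⊛-zeroˡ (pow (scale c * f) (P (suc d))) (eProduct-over (raise O ρ (scale c * suc d)) ρ∈ (R<raise d)) e)
        where
        R<scale : R ρ < scale c
        R<scale = *-cancelˡ-< f (R ρ) (scale c) (≤-<-trans (row-weight≤n ρ∈) (≤-trans n<sf (≤-reflexive (*-comm (scale c) f))))
        R<raise : ∀ d → R ρ < raise O ρ (scale c * suc d) ρ
        R<raise d = ≤-trans R<scale (≤-trans (m≤m*n (scale c) (suc d)) (≤-trans (m≤n+m _ (O ρ)) (≤-reflexive (sym (raise-same O ρ _)))))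
      sumZ : ∑ (upTo n) (Z (scale c * f)) ≡ (pow f (T c) ⊛ rest) e
      sumZ = begin
        ∑ (upTo n) (Z (scale c * f))
          ≡⟨ ∑-cong (upTo n) (λ d → begin
               Z (scale c * f) d
                 ≡⟨ ⊛-cong (pow-scale c (P (suc d))) (eProduct-place (scale c * suc d)) e ⟩
               (pow f (pow (scale c) (P (suc d))) ⊛ (pow f (E∸ (R ρ) (O ρ + scale c * suc d)) ⊛ rest)) e
                 ≡⟨ ⊛-assoc (pow f (pow (scale c) (P (suc d)))) (pow f (E∸ (R ρ) (O ρ + scale c * suc d))) rest e ⟨
               ((pow f (pow (scale c) (P (suc d))) ⊛ pow f (E∸ (R ρ) (O ρ + scale c * suc d))) ⊛ rest) e
                 ≡⟨ ⊛-congʳ rest (pow-⊛ (tf ρ) (pow (scale c) (P (suc d))) (E∸ (R ρ) (O ρ + scale c * suc d))) e ⟨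
               (pow f (pow (scale c) (P (suc d)) ⊛ E∸ (R ρ) (O ρ + scale c * suc d)) ⊛ rest) e ∎) ⟩
        (∑[ d ∈ upTo n ] (pow f (pow (scale c) (P (suc d)) ⊛ E∸ (R ρ) (O ρ + scale c * suc d)) ⊛ rest) e)
          ≡⟨ ⊛-∑ˡ (upTo n) (λ d → pow f (pow (scale c) (P (suc d)) ⊛ E∸ (R ρ) (O ρ + scale c * suc d))) rest e ⟨
        ((λ y → ∑[ d ∈ upTo n ] pow f (pow (scale c) (P (suc d)) ⊛ E∸ (R ρ) (O ρ + scale c * suc d)) y) ⊛ rest) e
          ≡⟨ ⊛-congʳ rest (pow-∑ f (upTo n) (λ d → pow (scale c) (P (suc d)) ⊛ E∸ (R ρ) (O ρ + scale c * suc d))) e ⟨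
        (pow f (T c) ⊛ rest) e ∎

  -- When all rows are full, a further positive block would exceed the weight of `R`, so only the
  -- empty content survives. On the other side every row contributes a power substitution into 1.
  pExpansion-full : ∀ O → (∀ {ρ} → ρ ∈ rows → O ρ ≡ R ρ) → ∀ e → pExpansion O e ≡ eProduct O e
  pExpansion-full O O≡R e = begin
    pExpansion O e
      ≡⟨ multisetSum-[] {Q = Positive} ks-positive (λ β bs pos → trans (cong (ℚ._* blockProduct P (β ∷ bs) e) (fillings-weight (β ∷ bs) λ eq →
           <⇒≢ (≤-trans (s≤s z≤n) (length≤totalWeight pos))
             (+-cancelˡ-≡ (weightOf O) 0 (totalWeight (β ∷ bs)) (trans (+-identityʳ (weightOf O)) (trans weightO eq)))))
           (ℚ.*-zeroˡ (blockProduct P (β ∷ bs) e))) ⟩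
    fillings O [] ℚ.* 1ˢ e
      ≡⟨ cong (ℚ._* 1ˢ e) (𝟙-yes (All.all? (λ ρ → O ρ ≟ R ρ) rows) (All.tabulate O≡R)) ⟩
    1ℚ ℚ.* 1ˢ e
      ≡⟨ ℚ.*-identityˡ (1ˢ e) ⟩
    1ˢ e
      ≡⟨ ∏-1 rows (λ {ρ} ρ∈ y → trans (cong (λ o → pow (suc (tf ρ)) (E∸ (R ρ) o) y) (O≡R ρ∈))
           (trans (pow-cong (suc (tf ρ)) (E∸-diagonal (R ρ)) y) (pow-1ˢ (tf ρ) y))) e ⟨
    eProduct O e ∎
    where
    open ≡-Reasoning
    weightO : weightOf O ≡ weightOf R
    weightO = cong sum (List.map-cong-local (All.tabulate λ {ρ} ρ∈ → cong (suc (tf ρ) *_) (O≡R ρ∈)))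

  -- Subtraction is truncated on purpose: a tile that overshoots its row still lowers this measure,
  -- so overfull states need no separate induction.
  missing : (I → ℕ) → ℕ
  missing O = sum (map (λ ρ → R ρ ∸ O ρ) rows)

  missing-raise : ∀ O {ρ} k → ρ ∈ rows → O ρ < R ρ → 1 ≤ k → missing (raise O ρ k) < missing O
  missing-raise O {ρ} k ρ∈ O<R 1≤k = sum-map-< (λ ρ′ → ∸-monoʳ-≤ (R ρ′) (m≤m+n (O ρ′) _)) ρ∈
    (≤-trans (s≤s (∸-monoʳ-≤ (R ρ) O<raise)) (≤-reflexive (sym (+-∸-assoc 1 O<R))))
    where
    O<raise : O ρ < raise O ρ k ρ
    O<raise = ≤-trans (≤-trans (≤-reflexive (+-comm 1 (O ρ))) (+-monoʳ-≤ (O ρ) 1≤k)) (≤-reflexive (sym (raise-same O ρ k)))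

  -- If some row is overfull, both sides vanish; if all rows are full, both are 1. Otherwise some
  -- row lacks cells, and both sides obey the same recursion, whose factor R ρ - O ρ is positive and
  -- can be cancelled.
  pExpansion≡eProduct : ∀ k O → missing O ≤ k → ∀ e → pExpansion O e ≡ eProduct O e
  pExpansion≡eProduct k O missing≤k e with any? (λ ρ → R ρ <? O ρ) rows
  ... | yes over with find over
  ...   | ρ , ρ∈ , R<O = trans (multisetSum-zero {Q = Positive} ks-positive λ bs _ →
            trans (cong (ℚ._* blockProduct P bs e) (fillings-over bs ρ∈ R<O)) (ℚ.*-zeroˡ (blockProduct P bs e)))
          (sym (eProduct-over O ρ∈ R<O e))
  pExpansion≡eProduct k O missing≤k e | no ¬over with any? (λ ρ → O ρ <? R ρ) rows
  ... | no ¬under = pExpansion-full O (λ {ρ} ρ∈ → ≤-antisym (≮⇒≥ λ R<O → ¬over (lose ρ∈ R<O)) (≮⇒≥ λ O<R → ¬under (lose ρ∈ O<R))) e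
  ... | yes under with find under
  pExpansion≡eProduct zero O missing≤k e | no ¬over | yes under | ρ , ρ∈ , O<R =
    ⊥-elim (<⇒≱ (m<n⇒0<n∸m O<R) (≤-trans (∈⇒≤sum (∈-map⁺ (λ ρ → R ρ ∸ O ρ) ρ∈)) missing≤k))
  pExpansion≡eProduct (suc k) O missing≤k e | no ¬over | yes under | ρ , ρ∈ , O<R =
    -- The number of cells lacking in this row, presented as a successor so that it can be
    -- cancelled.
    ι-cancelˡ (pred (R ρ ∸ O ρ)) (subst (λ c → c ℚ.* pExpansion O e ≡ c ℚ.* eProduct O e) difference (begin
      (ι (R ρ) ℚ.- ι (O ρ)) ℚ.* pExpansion O e
        ≡⟨ pExpansion-row O ρ∈ e ⟩
      (∑[ γ ∈ ks ] ∑[ c ∈ bools ] (tileWeight (ρ , c) γ ℚ.* ι (scale c)) ℚ.* (blockSeries P γ ⊛ pExpansion (place O (ρ , c) γ)) e)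
        ≡⟨ ∑-cong-∈ ks (λ {γ} γ∈ → ∑-cong bools λ c → cong ((tileWeight (ρ , c) γ ℚ.* ι (scale c)) ℚ.*_)
             (⊛-congˡ (blockSeries P γ) (pExpansion≡eProduct k (place O (ρ , c) γ)
               (s≤s⁻¹ (≤-trans (missing-raise O (lengthIn (ρ , c) γ) ρ∈ O<R (*-mono-≤ (scale≥1 c) (proj₁ (All.lookup ks-positive γ∈)))) missing≤k))) e)) ⟩
      (∑[ γ ∈ ks ] ∑[ c ∈ bools ] (tileWeight (ρ , c) γ ℚ.* ι (scale c)) ℚ.* (blockSeries P γ ⊛ eProduct (place O (ρ , c) γ)) e)
        ≡⟨ eProduct-row O ρ∈ e ⟩
      (ι (R ρ) ℚ.- ι (O ρ)) ℚ.* eProduct O e ∎))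
    where
    open ≡-Reasoning
    open +-*-Solver
    difference : ι (R ρ) ℚ.- ι (O ρ) ≡ ι (suc (pred (R ρ ∸ O ρ)))
    difference = begin
      ι (R ρ) ℚ.- ι (O ρ)                  ≡⟨ cong (λ j → ι j ℚ.- ι (O ρ)) (m∸n+n≡m (<⇒≤ O<R)) ⟨
      ι (R ρ ∸ O ρ + O ρ) ℚ.- ι (O ρ)      ≡⟨ cong (ℚ._- ι (O ρ)) (ι-+ (R ρ ∸ O ρ) (O ρ)) ⟩
      ι (R ρ ∸ O ρ) ℚ.+ ι (O ρ) ℚ.- ι (O ρ) ≡⟨ solve 2 (λ x y → x :+ y :- y := x) refl (ι (R ρ ∸ O ρ)) (ι (O ρ)) ⟩
      ι (R ρ ∸ O ρ)                        ≡⟨ cong ι (suc-pred (R ρ ∸ O ρ) {{>-nonZero (m<n⇒0<n∸m O<R)}}) ⟨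
      ι (suc (pred (R ρ ∸ O ρ)))           ∎

-- Tabloids as sequences of placements.

-- An index for a row of the tensor diagram: the tensor factor and the row within it. The column is
-- represented by the offsets.
Cell : ℕ → Set
Cell n = Fin n × Fin n

_≟ᶜ_ : ∀ {n} → DecidableEquality (Cell n)
_≟ᶜ_ = ≡-dec Fin._≟_ Fin._≟_

cells : ∀ n → List (Cell n)
cells n = cartesianProduct (allFin n) (allFin n)

cells-unique : ∀ n → Unique (cells n)
cells-unique n = Unique.cartesianProduct⁺ (Unique.allFin⁺ n) (Unique.allFin⁺ n)

∈-cells : ∀ {n} (ρ : Cell n) → ρ ∈ cells n
∈-cells (f , r) = ∈-cartesianProduct⁺ (∈-allFin f) (∈-allFin r)

∑-tiles : ∀ n (G : Tile n → ℚ) → ∑ (tiles n) G ≡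
  (∑[ b ∈ bools ] ∑[ f ∈ allFin n ] ∑[ r ∈ allFin n ] ∑[ c ∈ allFin n ] G (tile b f r c))
∑-tiles n G = trans
  (∑-cartesianProductWith (λ (b , f) (r , c) → tile b f r c) (cartesianProduct bools (allFin n)) (cartesianProduct (allFin n) (allFin n)) G)
  (trans (∑-cartesianProductWith _,_ bools (allFin n) (λ (b , f) → ∑ (cartesianProduct (allFin n) (allFin n)) λ (r , c) → G (tile b f r c)))
    (∑-cong bools λ b → ∑-cong (allFin n) λ f → ∑-cartesianProductWith _,_ (allFin n) (allFin n) (λ (r , c) → G (tile b f r c))))

module SkewTabloids {n : ℕ} (R : Cell n → ℕ) (R≤n : ∀ ρ → R ρ ≤ n) where

  open Placements _≟ᶜ_ (cells n) (cells-unique n) (λ ρ → suc (toℕ (proj₁ ρ))) R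

  rowOf : Tile n → Cell n
  rowOf t = factor t , row t

  -- Follows the conditional form of `tileLength`, so that at zero offsets the conditions on skew
  -- tabloids agree with those of `IsTabloid` by unfolding.
  length′ : Tile n → Block → ℕ
  length′ t β = if doubled t then 2 * degree β else degree β

  length′-scale : ∀ t β → length′ t β ≡ scale (doubled t) * degree β
  length′-scale (tile true  _ _ _) β = refl
  length′-scale (tile false _ _ _) β = sym (+-identityʳ (degree β))

  module _ (bs : List Block) (T : Vec (Tile n) (length bs)) where

    Covered : Fin (length bs) → Fin n → Fin n → Fin n → Set
    Covered i f r c = factor (Vec.lookup T i) ≡ f × row (Vec.lookup T i) ≡ r × toℕ (column (Vec.lookup T i)) ≤ toℕ c
                    × toℕ c < toℕ (column (Vec.lookup T i)) + length′ (Vec.lookup T i) (List.lookup bs i)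

    -- Tabloids on the cells between the offsets `O` and the row ends `R`, which is the shape left
    -- over once the tiles with the smallest labels have been taken away.
    record IsSkewTabloid (O : Cell n → ℕ) : Set where
      field
        rightFactor : ∀ i → multiplicity (List.lookup bs i) ≡ scale (doubled (Vec.lookup T i)) * suc (toℕ (factor (Vec.lookup T i)))
        below       : ∀ ρ → O ρ ≤ R ρ
        starts      : ∀ i → O (rowOf (Vec.lookup T i)) ≤ toℕ (column (Vec.lookup T i))
        ends        : ∀ i → toℕ (column (Vec.lookup T i)) + length′ (Vec.lookup T i) (List.lookup bs i) ≤ R (rowOf (Vec.lookup T i))
        disjoint    : ∀ i j f r c → Covered i f r c → Covered j f r c → i ≡ j
        covers      : ∀ f r c → O (f , r) ≤ toℕ c → toℕ c < R (f , r) → ∃[ i ] Covered i f r c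
        increase    : ∀ i j → factor (Vec.lookup T i) ≡ factor (Vec.lookup T j) → row (Vec.lookup T i) ≡ row (Vec.lookup T j) →
                      column (Vec.lookup T i) Fin.< column (Vec.lookup T j) → i Fin.< j

  open IsSkewTabloid

  place′ : (Cell n → ℕ) → Tile n → Block → Cell n → ℕ
  place′ O t β = place O (rowOf t , doubled t) β

  Fits : (Cell n → ℕ) → Tile n → Block → Set
  Fits O t β = multiplicity β ≡ scale (doubled t) * suc (toℕ (factor t)) × toℕ (column t) ≡ O (rowOf t)

  fitsAt? : ∀ (O : Cell n → ℕ) t β → Dec (Fits O t β)
  fitsAt? O t β = fits? (rowOf t , doubled t) β ×-dec (toℕ (column t) ≟ O (rowOf t))

  -- The tile with the smallest label is the leftmost one of its row, so a
  -- tabloid is built by appending the tiles to the rows in label order.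

  IsChain : (Cell n → ℕ) → ∀ (bs : List Block) → Vec (Tile n) (length bs) → Set
  IsChain O []       []      = All (λ ρ → O ρ ≡ R ρ) (cells n)
  IsChain O (β ∷ bs) (t ∷ T) = Fits O t β × IsChain (place′ O t β) bs T

  isChain? : ∀ O (bs : List Block) T → Dec (IsChain O bs T)
  isChain? O []       []      = All.all? (λ ρ → O ρ ≟ R ρ) (cells n)
  isChain? O (β ∷ bs) (t ∷ T) = fitsAt? O t β ×-dec isChain? (place′ O t β) bs T

  length′≥1 : ∀ t {β} → 1 ≤ degree β → 1 ≤ length′ t β
  length′≥1 (tile true  _ _ _) 1≤d = ≤-trans 1≤d (m≤m+n _ _)
  length′≥1 (tile false _ _ _) 1≤d = 1≤d

  place′-same : ∀ O t β → place′ O t β (rowOf t) ≡ O (rowOf t) + length′ t β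
  place′-same O t β = trans (raise-same O (rowOf t) _) (cong (O (rowOf t) +_) (sym (length′-scale t β)))

  ≤place′ : ∀ O t β ρ → O ρ ≤ place′ O t β ρ
  ≤place′ O t β ρ = m≤m+n (O ρ) _

  private
    cong-row : ∀ (X : Cell n → ℕ) {t f r} → factor t ≡ f → row t ≡ r → X (rowOf t) ≡ X (f , r)
    cong-row X refl refl = refl

  skew⇒chain : ∀ bs → All (λ β → 1 ≤ degree β) bs → ∀ T O → IsSkewTabloid bs T O → IsChain O bs T
  skew⇒chain [] [] [] O S = All.tabulate λ {ρ} _ → ≤-antisym (below S ρ) (≮⇒≥ λ O<R → noLabel O<R)
    where
    noLabel : ∀ {ρ} → ¬ (O ρ < R ρ)
    noLabel {f , r} O<R with covers S f r (Fin.fromℕ< (≤-trans O<R (R≤n (f , r))))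
      (≤-reflexive (sym (Fin.toℕ-fromℕ< _))) (≤-trans (≤-reflexive (cong suc (Fin.toℕ-fromℕ< _))) O<R)
    ... | () , _
  skew⇒chain (β ∷ bs) (d ∷ ds) (t ∷ T) O S = (rightFactor S zero , column≡) , skew⇒chain bs ds T (place′ O t β) tail
    where
    ρ = rowOf t
    len = length′ t β
    len≥1 : 1 ≤ len
    len≥1 = length′≥1 t {β} d
    O<n : O ρ < n
    O<n = ≤-<-trans (starts S zero) (Fin.toℕ<n (column t))
    O<R : O ρ < R ρ
    O<R = ≤-trans (≤-trans (≤-reflexive (+-comm 1 (O ρ))) (+-mono-≤ (starts S zero) len≥1)) (ends S zero)
    -- Some tile covers the cell in column `O ρ` of this row. If it has a later label, it cannot
    -- start to the left of `t`, because labels increase; so `t` starts at this column at the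
    -- latest.
    column≤ : toℕ (column t) ≤ O ρ
    column≤ with covers S (factor t) (row t) (Fin.fromℕ< O<n) (≤-reflexive (sym (Fin.toℕ-fromℕ< O<n)))
                   (≤-trans (≤-reflexive (cong suc (Fin.toℕ-fromℕ< O<n))) O<R)
    ... | zero  , _ , _ , c≤ , _ = ≤-trans c≤ (≤-reflexive (Fin.toℕ-fromℕ< O<n))
    ... | suc i , f≡ , r≡ , c≤ , _ = ≤-trans (≮⇒≥ λ lt → n≮0 {suc (toℕ i)} (increase S (suc i) zero f≡ r≡ lt)) (≤-trans c≤ (≤-reflexive (Fin.toℕ-fromℕ< O<n)))
    column≡ : toℕ (column t) ≡ O ρ
    column≡ = ≤-antisym column≤ (starts S zero)
    end≡ : toℕ (column t) + len ≡ place′ O t β ρ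
    end≡ = trans (cong (_+ len) column≡) (sym (place′-same O t β))
    -- A later tile of this row that started before the end of `t` would have its first cell in
    -- common with `t`. That first cell exists because all lengths are positive.
    after : ∀ i → place′ O t β (rowOf (Vec.lookup T i)) ≤ toℕ (column (Vec.lookup T i))
    after i with toSum (rowOf t ≟ᶜ rowOf (Vec.lookup T i))
    ... | inj₂ ≢ρ = ≤-trans (≤-reflexive (raise-other O _ ≢ρ)) (starts S (suc i))
    ... | inj₁ ρ≡ = ≤-trans (≤-reflexive (trans (cong (place′ O t β) (sym ρ≡)) (sym end≡))) (≮⇒≥ λ lt → Fin.0≢1+n
            (disjoint S zero (suc i) (factor (Vec.lookup T i)) (row (Vec.lookup T i)) (column (Vec.lookup T i))
              (cong proj₁ ρ≡ , cong proj₂ ρ≡ , ≤-trans (≤-reflexive (trans column≡ (cong O ρ≡))) (starts S (suc i)) , lt)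
              (refl , refl , ≤-refl , ≤-trans (≤-reflexive (+-comm 1 _)) (+-monoʳ-≤ (toℕ (column (Vec.lookup T i))) (length′≥1 (Vec.lookup T i) {List.lookup bs i} (All.lookup ds (∈-lookup {xs = bs} i)))))))
    tail : IsSkewTabloid bs T (place′ O t β)
    tail .rightFactor i = rightFactor S (suc i)
    tail .below ρ′ with toSum (ρ ≟ᶜ ρ′)
    ... | inj₁ refl = ≤-trans (≤-reflexive (sym end≡)) (ends S zero)
    ... | inj₂ ≢ρ = ≤-trans (≤-reflexive (raise-other O _ ≢ρ)) (below S ρ′)
    tail .starts = after
    tail .ends i = ends S (suc i)
    tail .disjoint i j f r c x y = Fin.suc-injective (disjoint S (suc i) (suc j) f r c x y)
    tail .covers f r c O≤ <R with covers S f r c (≤-trans (≤place′ O t β (f , r)) O≤) <R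
    ... | suc i , cov = i , cov
    ... | zero , f≡ , r≡ , _ , c< = ⊥-elim (<⇒≱ c< (≤-trans (≤-reflexive (trans end≡ (cong-row (place′ O t β) {t} f≡ r≡))) O≤))
    tail .increase i j f≡ r≡ lt = s≤s⁻¹ (increase S (suc i) (suc j) f≡ r≡ lt)

  -- The first tile occupies exactly the columns from the old to the new offset of its row, and the
  -- other tiles lie at or beyond the new offsets. Each condition thus splits into one on the first
  -- tile and one given by induction.
  chain⇒skew : ∀ bs T O → IsChain O bs T → IsSkewTabloid bs T O
  chain⇒skew [] [] O all = record
    { rightFactor = λ ()
    ; below       = λ ρ → ≤-reflexive (All.lookup all (∈-cells ρ))
    ; starts      = λ ()
    ; ends        = λ ()
    ; disjoint    = λ ()
    ; covers      = λ f r c O≤ <R → ⊥-elim (<⇒≱ <R (≤-trans (≤-reflexive (sym (All.lookup all (∈-cells (f , r))))) O≤))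
    ; increase    = λ ()
    }
  chain⇒skew (β ∷ bs) (t ∷ T) O ((mult , column≡) , chain) = S
    where
    ρ = rowOf t
    len = length′ t β
    S′ = chain⇒skew bs T (place′ O t β) chain
    end≡ : toℕ (column t) + len ≡ place′ O t β ρ
    end≡ = trans (cong (_+ len) column≡) (sym (place′-same O t β))
    apart : ∀ {j f r c} → Covered (β ∷ bs) (t ∷ T) zero f r c → ¬ Covered bs T j f r c
    apart {j} (f≡ , r≡ , _ , c<) (f≡′ , r≡′ , ≤c , _) = <⇒≱ c< (≤-trans (≤-trans (≤-reflexive
      (trans end≡ (trans (cong-row (place′ O t β) {t} f≡ r≡) (sym (cong-row (place′ O t β) {Vec.lookup T j} f≡′ r≡′))))) (starts S′ j)) ≤c)
    S : IsSkewTabloid (β ∷ bs) (t ∷ T) O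
    S .rightFactor zero    = mult
    S .rightFactor (suc i) = rightFactor S′ i
    S .below ρ′ = ≤-trans (≤place′ O t β ρ′) (below S′ ρ′)
    S .starts zero    = ≤-reflexive (sym column≡)
    S .starts (suc i) = ≤-trans (≤place′ O t β _) (starts S′ i)
    S .ends zero    = ≤-trans (≤-reflexive end≡) (below S′ ρ)
    S .ends (suc i) = ends S′ i
    S .disjoint zero    zero    f r c x y = refl
    S .disjoint zero    (suc j) f r c x y = ⊥-elim (apart {j} x y)
    S .disjoint (suc i) zero    f r c x y = ⊥-elim (apart {i} y x)
    S .disjoint (suc i) (suc j) f r c x y = cong suc (disjoint S′ i j f r c x y)
    S .covers f r c O≤ <R with place′ O t β (f , r) ≤? toℕ c
    ... | yes ≤c with covers S′ f r c ≤c <R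
    ...   | i , cov = suc i , cov
    S .covers f r c O≤ <R | no ≰c with toSum (ρ ≟ᶜ (f , r))
    ... | inj₁ refl = zero , refl , refl , ≤-trans (≤-reflexive column≡) O≤ , ≤-trans (≰⇒> ≰c) (≤-reflexive (sym end≡))
    ... | inj₂ ≢ρ = ⊥-elim (≰c (≤-trans (≤-reflexive (raise-other O _ ≢ρ)) O≤))
    S .increase zero    zero    f≡ r≡ lt = ⊥-elim (<-irrefl refl lt)
    S .increase zero    (suc j) f≡ r≡ lt = s≤s z≤n
    S .increase (suc i) zero    f≡ r≡ lt = ⊥-elim (<⇒≱ lt (≤-trans (≤-trans (≤-reflexive
      (trans column≡ (sym (cong-row O {Vec.lookup T i} f≡ r≡)))) (≤place′ O t β _)) (starts S′ i)))
    S .increase (suc i) (suc j) f≡ r≡ lt = s≤s (increase S′ i j f≡ r≡ lt)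

  signOf : ∀ {k} → Vec (Tile n) k → ℚ
  signOf []      = 1ℚ
  signOf (t ∷ T) = sign (doubled t) ℚ.* signOf T

  -- In a chain the column of each tile is forced by the current offset. The sum over columns
  -- collapses, and what remains of a tile is its row and its mark, which are the positions summed
  -- over in `fillings`.
  ∑-chains : ∀ bs → All (λ β → 1 ≤ degree β) bs → ∀ O →
    (∑[ T ∈ vectors (tiles n) (length bs) ] 𝟙 (isChain? O bs T) ℚ.* signOf T) ≡ fillings O bs
  ∑-chains [] [] O = trans (ℚ.+-identityʳ _) (ℚ.*-identityʳ (𝟙 (All.all? (λ ρ → O ρ ≟ R ρ) (cells n))))
  ∑-chains (β ∷ bs) (d ∷ ds) O = begin
    (∑[ T ∈ vectors (tiles n) (suc (length bs)) ] 𝟙 (isChain? O (β ∷ bs) T) ℚ.* signOf T)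
      ≡⟨ ∑-cartesianProductWith Vec._∷_ (tiles n) (vectors (tiles n) (length bs)) (λ T → 𝟙 (isChain? O (β ∷ bs) T) ℚ.* signOf T) ⟩
    (∑[ t ∈ tiles n ] ∑[ T ∈ vectors (tiles n) (length bs) ] 𝟙 (isChain? O (β ∷ bs) (t ∷ T)) ℚ.* (sign (doubled t) ℚ.* signOf T))
      ≡⟨ ∑-cong (tiles n) perTile ⟩
    (∑[ t ∈ tiles n ] 𝟙 (toℕ (column t) ≟ O (rowOf t)) ℚ.* X (rowOf t) (doubled t))
      ≡⟨ ∑-tiles n (λ t → 𝟙 (toℕ (column t) ≟ O (rowOf t)) ℚ.* X (rowOf t) (doubled t)) ⟩
    (∑[ b ∈ bools ] ∑[ f ∈ allFin n ] ∑[ r ∈ allFin n ] ∑[ c ∈ allFin n ] 𝟙 (toℕ c ≟ O (f , r)) ℚ.* X (f , r) b)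
      ≡⟨ ∑-cong bools (λ b → ∑-cong (allFin n) λ f → ∑-cong (allFin n) λ r → perRow (f , r) b) ⟩
    (∑[ b ∈ bools ] ∑[ f ∈ allFin n ] ∑[ r ∈ allFin n ] X (f , r) b)
      ≡⟨ ∑-cong bools (λ b → ∑-cartesianProductWith _,_ (allFin n) (allFin n) (λ ρ → X ρ b)) ⟨
    (∑[ b ∈ bools ] ∑[ ρ ∈ cells n ] X ρ b)
      ≡⟨ ∑-swap bools (cells n) (λ b ρ → X ρ b) ⟩
    (∑[ ρ ∈ cells n ] ∑[ b ∈ bools ] X ρ b)
      ≡⟨ ∑-cartesianProductWith _,_ (cells n) bools (λ q → X (proj₁ q) (proj₂ q)) ⟨
    fillings O (β ∷ bs) ∎
    where
    open ≡-Reasoning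
    open +-*-Solver
    X : Cell n → Bool → ℚ
    X ρ b = tileWeight (ρ , b) β ℚ.* fillings (place O (ρ , b) β) bs
    perTile : ∀ t → (∑[ T ∈ vectors (tiles n) (length bs) ] 𝟙 (isChain? O (β ∷ bs) (t ∷ T)) ℚ.* (sign (doubled t) ℚ.* signOf T)) ≡
              𝟙 (toℕ (column t) ≟ O (rowOf t)) ℚ.* X (rowOf t) (doubled t)
    perTile t = begin
      (∑[ T ∈ vectors (tiles n) (length bs) ] 𝟙 (isChain? O (β ∷ bs) (t ∷ T)) ℚ.* (s ℚ.* signOf T))
        ≡⟨ ∑-cong (vectors (tiles n) (length bs)) (λ T → trans
             (cong (ℚ._* (s ℚ.* signOf T)) (trans (𝟙-× (fitsAt? O t β) (isChain? (place′ O t β) bs T))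
               (cong (ℚ._* 𝟙 (isChain? (place′ O t β) bs T)) (𝟙-× (fits? (rowOf t , doubled t) β) (toℕ (column t) ≟ O (rowOf t))))))
             (solve 5 (λ m c k s e → ((m :* c) :* k) :* (s :* e) := (c :* (m :* s)) :* (k :* e)) refl mu co (𝟙 (isChain? (place′ O t β) bs T)) s (signOf T))) ⟩
      (∑[ T ∈ vectors (tiles n) (length bs) ] (co ℚ.* (mu ℚ.* s)) ℚ.* (𝟙 (isChain? (place′ O t β) bs T) ℚ.* signOf T))
        ≡⟨ trans (∑-*ˡ (vectors (tiles n) (length bs)) (co ℚ.* (mu ℚ.* s)) _) (cong ((co ℚ.* (mu ℚ.* s)) ℚ.*_) (∑-chains bs ds (place′ O t β))) ⟩
      (co ℚ.* (mu ℚ.* s)) ℚ.* fillings (place′ O t β) bs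
        ≡⟨ ℚ.*-assoc co (mu ℚ.* s) _ ⟩
      co ℚ.* X (rowOf t) (doubled t) ∎
      where
      s = sign (doubled t)
      mu = 𝟙 (fits? (rowOf t , doubled t) β)
      co = 𝟙 (toℕ (column t) ≟ O (rowOf t))
    perRow : ∀ ρ b → (∑[ c ∈ allFin n ] 𝟙 (toℕ c ≟ O ρ) ℚ.* X ρ b) ≡ X ρ b
    perRow ρ b with O ρ <? n
    ... | yes O<n = trans
      (∑-single (λ c → 𝟙 (toℕ c ≟ O ρ) ℚ.* X ρ b) (Unique.allFin⁺ n) (∈-allFin (Fin.fromℕ< O<n)) (λ {c} _ c≢ →
        trans (cong (ℚ._* X ρ b) (𝟙-no (toℕ c ≟ O ρ) λ eq → c≢ (Fin.toℕ-injective (trans eq (sym (Fin.toℕ-fromℕ< O<n)))))) (ℚ.*-zeroˡ (X ρ b))))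
      (trans (cong (ℚ._* X ρ b) (𝟙-yes (toℕ (Fin.fromℕ< O<n) ≟ O ρ) (Fin.toℕ-fromℕ< O<n))) (ℚ.*-identityˡ (X ρ b)))
    -- There is no column `O ρ` to choose here. As R ρ ≤ n ≤ O ρ, any tile of positive length
    -- overfills the row, so the expected term vanishes too.
    ... | no O≮n = trans (∑-zero (allFin n) λ {c} _ → trans (cong (𝟙 (toℕ c ≟ O ρ) ℚ.*_) X≡0) (ℚ.*-zeroʳ (𝟙 (toℕ c ≟ O ρ)))) (sym X≡0)
      where
      X≡0 : X ρ b ≡ 0ℚ
      X≡0 = trans (cong (tileWeight (ρ , b) β ℚ.*_) (fillings-over bs (∈-cells ρ) (≤-trans (s≤s (≤-trans (R≤n ρ) (≮⇒≥ O≮n)))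
        (≤-trans (≤-trans (≤-reflexive (+-comm 1 (O ρ))) (+-monoʳ-≤ (O ρ) (*-mono-≤ (scale≥1 b) d))) (≤-reflexive (sym (raise-same O ρ (lengthIn (ρ , b) β))))))))
        (ℚ.*-zeroʳ (tileWeight (ρ , b) β))

-- Partitions as multiplicity vectors, and 1/z as a product.

recip-1 : recip 1 ≡ 1ℚ
recip-1 = recip-def 0

recip-* : ∀ j k → recip (j * k) ≡ recip j ℚ.* recip k
recip-* zero    k       = trans recip-0 (sym (trans (cong (ℚ._* recip k) recip-0) (ℚ.*-zeroˡ (recip k))))
recip-* (suc j) zero    = trans (cong recip (*-zeroʳ j)) (trans recip-0 (sym (trans (cong (recip (suc j) ℚ.*_) recip-0) (ℚ.*-zeroʳ (recip (suc j))))))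
recip-* (suc j) (suc k) = ι-cancelˡ (k + j * suc k) (begin
  ι (suc j * suc k) ℚ.* recip (suc j * suc k)                        ≡⟨ ι-recip (k + j * suc k) ⟩
  1ℚ ℚ.* 1ℚ                                                          ≡⟨ cong₂ ℚ._*_ (ι-recip j) (ι-recip k) ⟨
  (ι (suc j) ℚ.* recip (suc j)) ℚ.* (ι (suc k) ℚ.* recip (suc k))    ≡⟨ solve 4 (λ a b c d → (a :* b) :* (c :* d) := (a :* c) :* (b :* d)) refl (ι (suc j)) (recip (suc j)) (ι (suc k)) (recip (suc k)) ⟩
  (ι (suc j) ℚ.* ι (suc k)) ℚ.* (recip (suc j) ℚ.* recip (suc k))    ≡⟨ cong (ℚ._* (recip (suc j) ℚ.* recip (suc k))) (ι-* (suc j) (suc k)) ⟨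
  ι (suc j * suc k) ℚ.* (recip (suc j) ℚ.* recip (suc k))            ∎)
  where
  open ≡-Reasoning
  open +-*-Solver

recipFactor≡recip : ∀ d k → recipFactor d k ≡ recip (d ℕ.^ k * k !)
recipFactor≡recip d zero    = sym recip-1
recipFactor≡recip d (suc k) = begin
  recipFactor d k ℚ.* (recip d ℚ.* recip (suc k))                    ≡⟨ cong (ℚ._* (recip d ℚ.* recip (suc k))) (trans (recipFactor≡recip d k) (recip-* (d ℕ.^ k) (k !))) ⟩
  (recip (d ℕ.^ k) ℚ.* recip (k !)) ℚ.* (recip d ℚ.* recip (suc k))    ≡⟨ solve 4 (λ a b c d → (a :* b) :* (c :* d) := (c :* a) :* (d :* b)) refl (recip (d ℕ.^ k)) (recip (k !)) (recip d) (recip (suc k)) ⟩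
  (recip d ℚ.* recip (d ℕ.^ k)) ℚ.* (recip (suc k) ℚ.* recip (k !))    ≡⟨ cong₂ ℚ._*_ (recip-* d (d ℕ.^ k)) (recip-* (suc k) (k !)) ⟨
  recip (d ℕ.^ suc k) ℚ.* recip (suc k !)                              ≡⟨ recip-* (d ℕ.^ suc k) (suc k !) ⟨
  recip (d ℕ.^ suc k * suc k !)                                        ∎
  where
  open ≡-Reasoning
  open +-*-Solver

count : ℕ → List ℕ → ℕ
count i xs = length (filter (_≟ i) xs)

count-replicate : ∀ k i xs → count i (replicate k i ++ xs) ≡ k + count i xs
count-replicate zero    i xs = refl
count-replicate (suc k) i xs = trans (cong length (List.filter-accept (_≟ i) refl)) (cong suc (count-replicate k i xs))

count-replicate-≢ : ∀ k {i j} xs → j ≢ i → count i (replicate k j ++ xs) ≡ count i xs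
count-replicate-≢ zero    xs j≢i = refl
count-replicate-≢ (suc k) {i} xs j≢i = trans (cong length (List.filter-reject (_≟ i) j≢i)) (count-replicate-≢ k xs j≢i)

count-absent : ∀ {i xs} → All (_< i) xs → count i xs ≡ 0
count-absent {i} <i = cong length (List.filter-none (_≟ i) (All.map <⇒≢ <i))

-- The entries run from part size `j` down to 1, so that `expand` produces weakly decreasing lists
-- and the order agrees with that of `kindsOf`.
multiplicities : ∀ j → List ℕ → Vec ℕ j
multiplicities zero    xs = []
multiplicities (suc j) xs = count (suc j) xs ∷ multiplicities j xs

expand : ∀ {j} → Vec ℕ j → List ℕ
expand {zero}  []      = []
expand {suc j} (k ∷ v) = replicate k (suc j) ++ expand v

expand-≤ : ∀ {j} (v : Vec ℕ j) → All (_≤ j) (expand v)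
expand-≤ []              = []
expand-≤ {suc j} (k ∷ v) = AllP.++⁺ (AllP.replicate⁺ k ≤-refl) (All.map m≤n⇒m≤1+n (expand-≤ v))

expand-≥1 : ∀ {j} (v : Vec ℕ j) → All (1 ≤_) (expand v)
expand-≥1 []              = []
expand-≥1 {suc j} (k ∷ v) = AllP.++⁺ (AllP.replicate⁺ k (s≤s z≤n)) (expand-≥1 v)

linked-∷ : ∀ {x xs} → All (_≤ x) xs → Linked _≥_ xs → Linked _≥_ (x ∷ xs)
linked-∷ []       []       = [-]
linked-∷ (p ∷ _) l@([-])   = p ∷ l
linked-∷ (p ∷ _) l@(_ ∷ _) = p ∷ l

expand-linked : ∀ {j} (v : Vec ℕ j) → Linked _≥_ (expand v)
expand-linked []              = []
expand-linked {suc j} (k ∷ v) = go k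
  where
  go : ∀ k → Linked _≥_ (replicate k (suc j) ++ expand v)
  go zero    = expand-linked v
  go (suc k) = linked-∷ (AllP.++⁺ (AllP.replicate⁺ k ≤-refl) (All.map m≤n⇒m≤1+n (expand-≤ v))) (go k)

multiplicities-replicate : ∀ j k {i} xs → j < i → multiplicities j (replicate k i ++ xs) ≡ multiplicities j xs
multiplicities-replicate zero    k xs j<i = refl
multiplicities-replicate (suc j) k xs j<i =
  cong₂ Vec._∷_ (count-replicate-≢ k xs (≢-sym (<⇒≢ j<i))) (multiplicities-replicate j k xs (<⇒≤ j<i))

multiplicities-expand : ∀ {j} (v : Vec ℕ j) → multiplicities j (expand v) ≡ v
multiplicities-expand []              = refl
multiplicities-expand {suc j} (k ∷ v) = cong₂ Vec._∷_
  (trans (count-replicate k (suc j) (expand v)) (trans (cong (k +_) (count-absent (All.map s≤s (expand-≤ v)))) (+-identityʳ k)))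
  (trans (multiplicities-replicate j k (expand v) ≤-refl) (multiplicities-expand v))

split-maximal : ∀ j {xs} → All (1 ≤_) xs → All (_≤ suc j) xs → Linked _≥_ xs →
  ∃[ k ] ∃[ ys ] (xs ≡ replicate k (suc j) ++ ys × All (1 ≤_) ys × All (_≤ j) ys × Linked _≥_ ys)
split-maximal j {[]} _ _ _ = 0 , [] , refl , [] , [] , []
split-maximal j {x ∷ xs} (p ∷ ps) (q ∷ qs) l with x ≟ suc j
... | no x≢ = 0 , x ∷ xs , refl , p ∷ ps , All.map (λ y≤x → ≤-trans y≤x (s≤s⁻¹ (≤∧≢⇒< q x≢))) (LinkedP.Linked⇒All (λ a b → ≤-trans b a) ≤-refl l) , l
... | yes refl with split-maximal j ps qs (Linked.tail l)
...   | k , ys , refl , rest = suc k , ys , refl , rest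

-- Weak decrease places the copies of the largest allowed part at the front, where they can be split
-- off. With `multiplicities-expand` this identifies partitions of bounded part size with
-- multiplicity vectors.
expand-multiplicities : ∀ j {xs} → All (1 ≤_) xs → All (_≤ j) xs → Linked _≥_ xs → expand (multiplicities j xs) ≡ xs
expand-multiplicities zero {[]}     _        _        _ = refl
expand-multiplicities zero {x ∷ xs} (p ∷ _) (q ∷ _) _ = ⊥-elim (<⇒≱ p q)
expand-multiplicities (suc j) ps qs l with split-maximal j ps qs l
... | k , ys , refl , ps′ , qs′ , l′ = cong₂ (λ i zs → replicate i (suc j) ++ zs)
  (trans (count-replicate k (suc j) ys) (trans (cong (k +_) (count-absent (All.map s≤s qs′))) (+-identityʳ k)))
  (trans (cong expand (multiplicities-replicate j k ys ≤-refl)) (expand-multiplicities j ps′ qs′ l′))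

-- The product `z` with its range detached from the size of the partition, so that all partitions
-- can be given the common range `n`.
zUpTo : ℕ → List ℕ → ℕ
zUpTo j xs = product (map (λ i → suc i ℕ.^ count (suc i) xs * count (suc i) xs !) (upTo j))

zUpTo-suc : ∀ j xs → zUpTo (suc j) xs ≡ zUpTo j xs * (suc j ℕ.^ count (suc j) xs * count (suc j) xs !)
zUpTo-suc j xs = begin
  product (map f (upTo (suc j)))                ≡⟨ cong (product ∘ map f) (List.upTo-∷ʳ j) ⟨
  product (map f (upTo j ++ j ∷ []))            ≡⟨ cong product (List.map-++ f (upTo j) (j ∷ [])) ⟩
  product (map f (upTo j) ++ f j ∷ [])          ≡⟨ product-++ (map f (upTo j)) (f j ∷ []) ⟩
  zUpTo j xs * (f j * 1)                        ≡⟨ cong (zUpTo j xs *_) (*-identityʳ (f j)) ⟩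
  zUpTo j xs * f j                              ∎
  where
  open ≡-Reasoning
  f = λ i → suc i ℕ.^ count (suc i) xs * count (suc i) xs !

zUpTo-+ : ∀ j k {xs} → All (_≤ j) xs → zUpTo (k + j) xs ≡ zUpTo j xs
zUpTo-+ j zero    ≤j = refl
zUpTo-+ j (suc k) {xs} ≤j = begin
  zUpTo (suc (k + j)) xs                                                               ≡⟨ zUpTo-suc (k + j) xs ⟩
  zUpTo (k + j) xs * (suc (k + j) ℕ.^ count (suc (k + j)) xs * count (suc (k + j)) xs !) ≡⟨ cong (λ c → zUpTo (k + j) xs * (suc (k + j) ℕ.^ c * c !)) (count-absent (All.map (λ x≤j → s≤s (≤-trans x≤j (m≤n+m j k))) ≤j)) ⟩
  zUpTo (k + j) xs * 1                                                                 ≡⟨ *-identityʳ _ ⟩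
  zUpTo (k + j) xs                                                                     ≡⟨ zUpTo-+ j k ≤j ⟩
  zUpTo j xs                                                                           ∎
  where open ≡-Reasoning

-- Both the size and `n` bound the parts, and part sizes that do not occur contribute 1. Hence both
-- products agree with the one that runs up to the sum of the two bounds.
z-zUpTo : ∀ n λ′ → All (_≤ n) (parts λ′) → z λ′ ≡ zUpTo n (parts λ′)
z-zUpTo n λ′ ≤n = trans (sym (zUpTo-+ (size λ′) n {parts λ′} (All.tabulate ∈⇒≤sum)))
  (trans (cong (λ j → zUpTo j (parts λ′)) (+-comm n (size λ′))) (zUpTo-+ n (size λ′) {parts λ′} ≤n))

recipWeight : ∀ {j} → Vec ℕ j → ℚ
recipWeight []              = 1ℚ
recipWeight {suc j} (k ∷ v) = recipFactor (suc j) k ℚ.* recipWeight v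

recipWeight-multiplicities : ∀ j xs → recipWeight (multiplicities j xs) ≡ recip (zUpTo j xs)
recipWeight-multiplicities zero    xs = sym recip-1
recipWeight-multiplicities (suc j) xs = begin
  recipFactor (suc j) c ℚ.* recipWeight (multiplicities j xs)  ≡⟨ cong₂ ℚ._*_ (recipFactor≡recip (suc j) c) (recipWeight-multiplicities j xs) ⟩
  recip (suc j ℕ.^ c * c !) ℚ.* recip (zUpTo j xs)               ≡⟨ recip-* (suc j ℕ.^ c * c !) (zUpTo j xs) ⟨
  recip (suc j ℕ.^ c * c ! * zUpTo j xs)                         ≡⟨ cong recip (trans (*-comm _ (zUpTo j xs)) (sym (zUpTo-suc j xs))) ⟩
  recip (zUpTo (suc j) xs)                                     ∎
  where
  open ≡-Reasoning
  c = count (suc j) xs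

-- Sums over types as sums over multisets of blocks.

partition-≡ : ∀ {λ′ μ} → parts λ′ ≡ parts μ → λ′ ≡ μ
partition-≡ {partition xs p d} {partition .xs p′ d′} refl =
  cong₂ (partition xs) (All.irrelevant ≤-irrelevant p p′) (Linked.irrelevant ≤-irrelevant d d′)

toPartition-just : ∀ λ′ → toPartition (parts λ′) ≡ just λ′
toPartition-just (partition xs p d) with All.all? (1 ≤?_) xs | Linked.linked? _≥?_ xs
... | yes _ | yes _ = cong just (partition-≡ refl)
... | yes _ | no ¬d = ⊥-elim (¬d d)
... | no ¬p | _     = ⊥-elim (¬p p)

parts-toPartition : ∀ {xs λ′} → toPartition xs ≡ just λ′ → parts λ′ ≡ xs
parts-toPartition {xs} eq with All.all? (1 ≤?_) xs | Linked.linked? _≥?_ xs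
parts-toPartition refl | yes _ | yes _ = refl

listsUpTo-sound : ∀ {A : Set} {xs : List A} k {ys} → ys ∈ listsUpTo xs k → length ys ≤ k × All (_∈ xs) ys
listsUpTo-sound zero    (here refl) = z≤n , []
listsUpTo-sound (suc k) (here refl) = z≤n , []
listsUpTo-sound {xs = xs} (suc k) (there ys∈) with ∈-cartesianProductWith⁻ _∷_ xs (listsUpTo xs k) ys∈
... | _ , _ , x∈ , zs∈ , refl with listsUpTo-sound k zs∈
...   | l , all = s≤s l , x∈ ∷ all

∈-partitions⁻ : ∀ {n λ′} → λ′ ∈ partitions n → length (parts λ′) ≤ n × All (_≤ n) (parts λ′)
∈-partitions⁻ {n} λ∈ with mapMaybe-sound (listsUpTo (upTo (suc n)) n) λ∈
... | xs , xs∈ , eq with parts-toPartition {xs} eq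
...   | refl with listsUpTo-sound n xs∈
...     | l , all = l , All.map (λ x∈ → s≤s⁻¹ (∈-upTo⁻ x∈)) all

∈-partitions⁺ : ∀ {n λ′} → length (parts λ′) ≤ n → All (_≤ n) (parts λ′) → λ′ ∈ partitions n
∈-partitions⁺ {λ′ = λ′} l ≤n = mapMaybe-complete (toPartition-just λ′)
  (listsUpTo-complete l (All.map (λ x≤n → ∈-upTo⁺ (s≤s x≤n)) ≤n))

partitions-unique : ∀ n → Unique (partitions n)
partitions-unique n = mapMaybe-unique
  (λ {xs} {ys} eq eq′ → trans (sym (parts-toPartition {xs} eq)) (parts-toPartition {ys} eq′)) (listsUpTo-unique (Unique.upTo⁺ _) n)

length≤sum : ∀ {xs} → All (1 ≤_) xs → length xs ≤ sum xs
length≤sum []       = z≤n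
length≤sum (p ∷ ps) = +-mono-≤ p (length≤sum ps)

totalWeight-++ : ∀ bs cs → totalWeight (bs ++ cs) ≡ totalWeight bs + totalWeight cs
totalWeight-++ bs cs = trans (cong sum (List.map-++ blockWeight bs cs)) (sum-++ (map blockWeight bs) (map blockWeight cs))

partBlocks : ℕ → List ℕ → List Block
partBlocks o = map (λ d → block d (suc o))

totalWeight-partBlocks : ∀ o xs → totalWeight (partBlocks o xs) ≡ suc o * sum xs
totalWeight-partBlocks o []       = sym (*-zeroʳ (suc o))
totalWeight-partBlocks o (x ∷ xs) = trans (cong (suc o * x +_) (totalWeight-partBlocks o xs)) (sym (*-distribˡ-+ (suc o) x (sum xs)))

module TypeSums (n : ℕ) where

  open MultisetSums n

  kindsOf : ℕ → ℕ → List Block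
  kindsOf o zero    = []
  kindsOf o (suc j) = block (suc j) (suc o) ∷ kindsOf o j

  -- The offset `o` is the position reached in the vector of components; the multiplicities run from
  -- `suc o` to `o + k`.
  kinds : ℕ → ℕ → List Block
  kinds o zero    = []
  kinds o (suc k) = kindsOf o n ++ kinds (suc o) k

  kindsOf-positive : ∀ o j → All Positive (kindsOf o j)
  kindsOf-positive o zero    = []
  kindsOf-positive o (suc j) = (s≤s z≤n , s≤s z≤n) ∷ kindsOf-positive o j

  kinds-positive : ∀ o k → All Positive (kinds o k)
  kinds-positive o zero    = []
  kinds-positive o (suc k) = AllP.++⁺ (kindsOf-positive o n) (kinds-positive (suc o) k)

  ∑-kindsOf : ∀ o j g → ∑ (kindsOf o j) g ≡ (∑[ d ∈ upTo j ] g (block (suc d) (suc o)))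
  ∑-kindsOf o zero    g = refl
  ∑-kindsOf o (suc j) g = trans (cong (g (block (suc j) (suc o)) ℚ.+_) (∑-kindsOf o j g))
    (trans (ℚ.+-comm (g (block (suc j) (suc o))) _) (sym (∑-upTo-∷ʳ j (λ d → g (block (suc d) (suc o))))))

  ∑-kinds : ∀ o k g → ∑ (kinds o k) g ≡ (∑[ r ∈ upTo k ] ∑[ d ∈ upTo n ] g (block (suc d) (suc (o + r))))
  ∑-kinds o zero    g = refl
  ∑-kinds o (suc k) g = begin
    ∑ (kindsOf o n ++ kinds (suc o) k) g
      ≡⟨ ∑-++ (kindsOf o n) (kinds (suc o) k) g ⟩
    ∑ (kindsOf o n) g ℚ.+ ∑ (kinds (suc o) k) g
      ≡⟨ cong₂ ℚ._+_ (∑-kindsOf o n g) (∑-kinds (suc o) k g) ⟩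
    (∑[ d ∈ upTo n ] g (block (suc d) (suc o))) ℚ.+ (∑[ r ∈ upTo k ] ∑[ d ∈ upTo n ] g (block (suc d) (suc (suc o + r))))
      ≡⟨ cong₂ (λ i x → (∑[ d ∈ upTo n ] g (block (suc d) (suc i))) ℚ.+ x) (sym (+-identityʳ o))
           (∑-cong (upTo k) λ r → cong (λ i → ∑[ d ∈ upTo n ] g (block (suc d) (suc i))) (sym (+-suc o r))) ⟩
    (∑[ d ∈ upTo n ] g (block (suc d) (suc (o + 0)))) ℚ.+ (∑[ r ∈ upTo k ] ∑[ d ∈ upTo n ] g (block (suc d) (suc (o + suc r))))
      ≡⟨ ∑-upTo-suc k (λ r → ∑[ d ∈ upTo n ] g (block (suc d) (suc (o + r)))) ⟨
    (∑[ r ∈ upTo (suc k) ] ∑[ d ∈ upTo n ] g (block (suc d) (suc (o + r)))) ∎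
    where open ≡-Reasoning

  multisetSum-kindsOf : ∀ o j H → multisetSum (kindsOf o j) H ≡ (∑[ v ∈ vectors (upTo (suc n)) j ] recipWeight v ℚ.* H (partBlocks o (expand v)))
  multisetSum-kindsOf o zero    H = sym (trans (ℚ.+-identityʳ (1ℚ ℚ.* H [])) (ℚ.*-identityˡ (H [])))
  multisetSum-kindsOf o (suc j) H = sym (begin
    (∑[ v ∈ vectors (upTo (suc n)) (suc j) ] recipWeight v ℚ.* H (partBlocks o (expand v)))
      ≡⟨ ∑-cartesianProductWith Vec._∷_ (upTo (suc n)) (vectors (upTo (suc n)) j) (λ v → recipWeight v ℚ.* H (partBlocks o (expand v))) ⟩
    (∑[ k ∈ upTo (suc n) ] ∑[ v ∈ vectors (upTo (suc n)) j ] recipFactor (suc j) k ℚ.* recipWeight v ℚ.* H (partBlocks o (replicate k (suc j) ++ expand v)))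
      ≡⟨ ∑-cong (upTo (suc n)) (λ k → trans (∑-cong (vectors (upTo (suc n)) j) λ v → trans (ℚ.*-assoc (recipFactor (suc j) k) (recipWeight v) _)
           (cong (λ bs → recipFactor (suc j) k ℚ.* (recipWeight v ℚ.* H bs)) (trans (List.map-++ _ (replicate k (suc j)) (expand v))
             (cong (_++ partBlocks o (expand v)) (List.map-replicate _ k (suc j))))))
           (trans (∑-*ˡ (vectors (upTo (suc n)) j) (recipFactor (suc j) k) _) (cong (recipFactor (suc j) k ℚ.*_)
             (sym (multisetSum-kindsOf o j (λ bs → H (replicate k (block (suc j) (suc o)) ++ bs))))))) ⟩
    multisetSum (kindsOf o (suc j)) H ∎)
    where open ≡-Reasoning

  -- Multiplicity vectors with entries up to `n` may describe more than `n` parts, which no member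
  -- of `partitions n` has. Such vectors have weight above `n`, so this condition removes the
  -- discrepancy.
  Vanishing : (List Block → ℚ) → Set
  Vanishing H = ∀ bs → n < totalWeight bs → H bs ≡ 0ℚ

  ∑-partitions : ∀ o H → Vanishing H →
    (∑[ λ′ ∈ partitions n ] recip (z λ′) ℚ.* H (partBlocks o (parts λ′))) ≡ multisetSum (kindsOf o n) H
  ∑-partitions o H H≡0 = begin
    (∑[ λ′ ∈ partitions n ] recip (z λ′) ℚ.* H (partBlocks o (parts λ′)))
      ≡⟨ ∑-cong-∈ (partitions n) (λ {λ′} λ∈ → cong₂ (λ x xs → x ℚ.* H (partBlocks o xs))
           (trans (cong recip (z-zUpTo n λ′ (proj₂ (∈-partitions⁻ λ∈)))) (sym (recipWeight-multiplicities n (parts λ′)))) (sym (recover λ∈))) ⟩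
    (∑[ λ′ ∈ partitions n ] f (φ λ′))
      ≡⟨ ∑-reindex (Vec.≡-dec _≟_) {f = f} φ (vectors-unique (Unique.upTo⁺ (suc n)) n) (partitions-unique n)
           (λ λ∈ μ∈ eq → partition-≡ (trans (sym (recover λ∈)) (trans (cong expand eq) (recover μ∈)))) into onto ⟨
    (∑[ v ∈ vectors (upTo (suc n)) n ] f v)
      ≡⟨ multisetSum-kindsOf o n H ⟨
    multisetSum (kindsOf o n) H ∎
    where
    open ≡-Reasoning
    φ : Partition → Vec ℕ n
    φ λ′ = multiplicities n (parts λ′)
    f : Vec ℕ n → ℚ
    f v = recipWeight v ℚ.* H (partBlocks o (expand v))
    recover : ∀ {λ′} → λ′ ∈ partitions n → expand (φ λ′) ≡ parts λ′
    recover {λ′} λ∈ = expand-multiplicities n (positive λ′) (proj₂ (∈-partitions⁻ λ∈)) (decreasing λ′)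
    multiplicities-∈ : ∀ j xs → length xs ≤ n → VecAll.All (_∈ upTo (suc n)) (multiplicities j xs)
    multiplicities-∈ zero    xs l = VecAll.[]
    multiplicities-∈ (suc j) xs l = ∈-upTo⁺ (s≤s (≤-trans (List.length-filter (_≟ suc j) xs) l)) VecAll.∷ multiplicities-∈ j xs l
    into : ∀ {λ′} → λ′ ∈ partitions n → φ λ′ ∈ vectors (upTo (suc n)) n
    into {λ′} λ∈ = vectors-complete (multiplicities-∈ n (parts λ′) (proj₁ (∈-partitions⁻ λ∈)))
    onto : ∀ {v} → v ∈ vectors (upTo (suc n)) n → (∃[ λ′ ] (λ′ ∈ partitions n × v ≡ φ λ′)) ⊎ f v ≡ 0ℚ
    onto {v} _ with length (expand v) ≤? n
    ... | yes ≤n = inj₁ (partition (expand v) (expand-≥1 v) (expand-linked v) , ∈-partitions⁺ ≤n (expand-≤ v) , sym (multiplicities-expand v))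
    ... | no ≰n  = inj₂ (trans (cong (recipWeight v ℚ.*_) (H≡0 (partBlocks o (expand v))
                     (≤-trans (≰⇒> ≰n) (≤-trans (length≤sum (expand-≥1 v)) (≤-trans (m≤m+n _ (o * sum (expand v))) (≤-reflexive (sym (totalWeight-partBlocks o (expand v)))))))))
                     (ℚ.*-zeroʳ (recipWeight v)))

  blocksFrom : ∀ {k} → ℕ → Vec Partition k → List Block
  blocksFrom o []       = []
  blocksFrom o (λ′ ∷ v) = partBlocks o (parts λ′) ++ blocksFrom (suc o) v

  zProduct : ∀ {k} → Vec Partition k → ℕ
  zProduct []       = 1
  zProduct (λ′ ∷ v) = z λ′ * zProduct v

  weightFrom : ∀ {k} → ℕ → Vec Partition k → ℕ
  weightFrom o []       = 0
  weightFrom o (λ′ ∷ v) = suc o * size λ′ + weightFrom (suc o) v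

  totalWeight-blocksFrom : ∀ {k} o (v : Vec Partition k) → totalWeight (blocksFrom o v) ≡ weightFrom o v
  totalWeight-blocksFrom o []       = refl
  totalWeight-blocksFrom o (λ′ ∷ v) = trans (totalWeight-++ (partBlocks o (parts λ′)) (blocksFrom (suc o) v))
    (cong₂ _+_ (totalWeight-partBlocks o (parts λ′)) (totalWeight-blocksFrom (suc o) v))

  ∑-vectors : ∀ o k H → Vanishing H →
    (∑[ v ∈ vectors (partitions n) k ] recip (zProduct v) ℚ.* H (blocksFrom o v)) ≡ multisetSum (kinds o k) H
  ∑-vectors o zero    H H≡0 = trans (ℚ.+-identityʳ (recip 1 ℚ.* H [])) (trans (cong (ℚ._* H []) recip-1) (ℚ.*-identityˡ (H [])))
  ∑-vectors o (suc k) H H≡0 = begin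
    (∑[ v ∈ vectors (partitions n) (suc k) ] recip (zProduct v) ℚ.* H (blocksFrom o v))
      ≡⟨ ∑-cartesianProductWith Vec._∷_ (partitions n) (vectors (partitions n) k) (λ v → recip (zProduct v) ℚ.* H (blocksFrom o v)) ⟩
    (∑[ λ′ ∈ partitions n ] ∑[ v ∈ vectors (partitions n) k ] recip (z λ′ * zProduct v) ℚ.* H (partBlocks o (parts λ′) ++ blocksFrom (suc o) v))
      ≡⟨ ∑-cong (partitions n) (λ λ′ → trans (∑-cong (vectors (partitions n) k) λ v → trans
           (cong (ℚ._* H (partBlocks o (parts λ′) ++ blocksFrom (suc o) v)) (recip-* (z λ′) (zProduct v))) (ℚ.*-assoc (recip (z λ′)) (recip (zProduct v)) _))
           (trans (∑-*ˡ (vectors (partitions n) k) (recip (z λ′)) _) (cong (recip (z λ′) ℚ.*_)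
             (∑-vectors (suc o) k (λ cs → H (partBlocks o (parts λ′) ++ cs)) (vanishing-++ (partBlocks o (parts λ′))))))) ⟩
    (∑[ λ′ ∈ partitions n ] recip (z λ′) ℚ.* H′ (partBlocks o (parts λ′)))
      ≡⟨ ∑-partitions o H′ (λ bs n< → multisetSum-zero {Q = Positive} (kinds-positive (suc o) k) λ cs _ →
           H≡0 (bs ++ cs) (≤-trans n< (≤-trans (m≤m+n (totalWeight bs) (totalWeight cs)) (≤-reflexive (sym (totalWeight-++ bs cs)))))) ⟩
    multisetSum (kindsOf o n) H′
      ≡⟨ multisetSum-++ (kindsOf o n) (kinds (suc o) k) H ⟨
    multisetSum (kinds o (suc k)) H ∎
    where
    open ≡-Reasoning
    -- The larger multiplicities are summed out first. Vanishing is inherited because appending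
    -- blocks never lowers the weight.
    H′ : List Block → ℚ
    H′ bs = multisetSum (kinds (suc o) k) (λ cs → H (bs ++ cs))
    vanishing-++ : ∀ bs → Vanishing (λ cs → H (bs ++ cs))
    vanishing-++ bs cs n< = H≡0 (bs ++ cs) (≤-trans n< (≤-trans (m≤n+m (totalWeight cs) (totalWeight bs)) (≤-reflexive (sym (totalWeight-++ bs cs)))))

/-recip : ∀ p k .{{_ : NonZero k}} → p ℚ./ k ≡ (p ℚ./ 1) ℚ.* recip k
/-recip p (suc k) = trans (/-split p k) (cong ((p ℚ./ 1) ℚ.*_) (sym (recip-def k)))

concatMap-allFin-suc : ∀ {A : Set} k (f : Fin (suc k) → List A) → concatMap f (allFin (suc k)) ≡ f zero ++ concatMap (f ∘ suc) (allFin k)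
concatMap-allFin-suc k f = cong (f zero ++_) (trans (cong (concatMap f) (sym (List.map-tabulate (λ i → i) suc))) (List.concatMap-map f suc (allFin k)))

map-allFin-suc : ∀ {A : Set} k (f : Fin (suc k) → A) → map f (allFin (suc k)) ≡ f zero ∷ map (f ∘ suc) (allFin k)
map-allFin-suc k f = cong (f zero ∷_) (trans (List.map-tabulate suc f) (sym (List.map-tabulate (λ i → i) (f ∘ suc))))

module _ {n : ℕ} where
  open TypeSums n
  open MultisetSums n

  blocks-from : ∀ {k} o (v : Vec Partition k) →
    concatMap (λ i → map (λ d → block d (suc (o + toℕ i))) (parts (Vec.lookup v i))) (allFin k) ≡ blocksFrom o v
  blocks-from o [] = refl
  blocks-from {suc k} o (λ′ ∷ v) = trans (concatMap-allFin-suc k _) (cong₂ _++_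
    (cong (λ i → partBlocks i (parts λ′)) (+-identityʳ o))
    (trans (List.concatMap-cong (λ i → cong (λ j → partBlocks j (parts (Vec.lookup v i))) (+-suc o (toℕ i))) (allFin k)) (blocks-from (suc o) v)))

  weight-from : ∀ {k} o (v : Vec Partition k) →
    sum (map (λ i → suc (o + toℕ i) * size (Vec.lookup v i)) (allFin k)) ≡ weightFrom o v
  weight-from o [] = refl
  weight-from {suc k} o (λ′ ∷ v) = trans (cong sum (map-allFin-suc k (λ i → suc (o + toℕ i) * size (Vec.lookup (λ′ ∷ v) i)))) (cong₂ _+_
    (cong (λ i → suc i * size λ′) (+-identityʳ o))
    (trans (sum-map-cong (allFin k) (λ i → cong (λ j → suc j * size (Vec.lookup v i)) (+-suc o (toℕ i)))) (weight-from (suc o) v)))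

  zProduct-from : ∀ {k} (v : Vec Partition k) → product (map (λ i → z (Vec.lookup v i)) (allFin k)) ≡ zProduct v
  zProduct-from [] = refl
  zProduct-from {suc k} (λ′ ∷ v) = trans (cong product (map-allFin-suc k (λ i → z (Vec.lookup (λ′ ∷ v) i)))) (cong (z λ′ *_) (zProduct-from v))

  toTyp-just : ∀ (v : Vec Partition n) (w : weight v ≡ n) → toTyp v ≡ just (typ v w)
  toTyp-just v w with weight v ≟ n
  ... | yes w′ = cong (just ∘ typ v) (≡-irrelevant w′ w)
  ... | no ¬w  = ⊥-elim (¬w w)

  toTyp-nothing : ∀ (v : Vec Partition n) → weight v ≢ n → toTyp v ≡ nothing
  toTyp-nothing v ¬w with weight v ≟ n
  ... | yes w = ⊥-elim (¬w w)
  ... | no _  = refl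

  blocksFrom-degree : ∀ {k} o (v : Vec Partition k) → All (λ β → 1 ≤ degree β) (blocksFrom o v)
  blocksFrom-degree o []       = []
  blocksFrom-degree o (λ′ ∷ v) = AllP.++⁺ (AllP.map⁺ (positive λ′)) (blocksFrom-degree (suc o) v)

  blocks-degree : (τ : Typ n) → All (λ β → 1 ≤ degree β) (blocks τ)
  blocks-degree τ = subst (All (λ β → 1 ≤ degree β)) (sym (blocks-from 0 (components τ))) (blocksFrom-degree 0 (components τ))

  -- Vectors of partitions whose weight is not `n` are not types, and there `g` vanishes. The sum
  -- may therefore run over all vectors and factor through their components.
  ∑-types : ∀ (g : List Block → ℚ) → (∀ bs → totalWeight bs ≢ n → g bs ≡ 0ℚ) →
    (∑[ τ ∈ types n ] recip (z⊗ τ) ℚ.* g (blocks τ)) ≡ multisetSum (kinds 0 n) g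
  ∑-types g g≡0 = begin
    (∑[ τ ∈ types n ] recip (z⊗ τ) ℚ.* g (blocks τ))
      ≡⟨ ∑-mapMaybe toTyp (vectors (partitions n) n) (λ τ → recip (z⊗ τ) ℚ.* g (blocks τ)) ⟩
    (∑[ v ∈ vectors (partitions n) n ] maybe′ (λ τ → recip (z⊗ τ) ℚ.* g (blocks τ)) 0ℚ (toTyp v))
      ≡⟨ ∑-cong (vectors (partitions n) n) perVector ⟩
    (∑[ v ∈ vectors (partitions n) n ] recip (zProduct v) ℚ.* g (blocksFrom 0 v))
      ≡⟨ ∑-vectors 0 n g (λ bs n< → g≡0 bs (≢-sym (<⇒≢ n<))) ⟩
    multisetSum (kinds 0 n) g ∎
    where
    open ≡-Reasoning
    perVector : ∀ v → maybe′ (λ τ → recip (z⊗ τ) ℚ.* g (blocks τ)) 0ℚ (toTyp v) ≡ recip (zProduct v) ℚ.* g (blocksFrom 0 v)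
    perVector v with toSum (weight v ≟ n)
    ... | inj₁ w = trans (cong (maybe′ (λ τ → recip (z⊗ τ) ℚ.* g (blocks τ)) 0ℚ) (toTyp-just v w))
                     (cong₂ (λ x bs → recip x ℚ.* g bs) (zProduct-from v) (blocks-from 0 v))
    ... | inj₂ ¬w = trans (cong (maybe′ (λ τ → recip (z⊗ τ) ℚ.* g (blocks τ)) 0ℚ) (toTyp-nothing v ¬w)) (sym (trans (cong (recip (zProduct v) ℚ.*_) (g≡0 (blocksFrom 0 v) λ eq → ¬w (trans (weight-from 0 v)
                    (trans (sym (totalWeight-blocksFrom 0 v)) eq)))) (ℚ.*-zeroʳ (recip (zProduct v)))))

-- The rows of σ and the final comparison.

nth≤sum : ∀ xs i → nth xs i ≤ sum xs
nth≤sum []       i       = z≤n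
nth≤sum (x ∷ xs) zero    = m≤m+n x (sum xs)
nth≤sum (x ∷ xs) (suc i) = ≤-trans (nth≤sum xs i) (m≤n+m (sum xs) x)

sum-nth : ∀ k xs → length xs ≤ k → sum (map (λ r → nth xs (toℕ r)) (allFin k)) ≡ sum xs
sum-nth k       []         _ = sum-map-zero (allFin k) (λ _ → refl)
sum-nth (suc k) (x ∷ xs) l = trans (cong sum (map-allFin-suc k (λ r → nth (x ∷ xs) (toℕ r)))) (cong (x +_) (sum-nth k xs (s≤s⁻¹ l)))

sum-cartesianProduct : ∀ {A B : Set} (xs : List A) (ys : List B) (f : A × B → ℕ) →
  sum (map f (cartesianProduct xs ys)) ≡ sum (map (λ x → sum (map (λ y → f (x , y)) ys)) xs)
sum-cartesianProduct []       ys f = refl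
sum-cartesianProduct (x ∷ xs) ys f = trans (cong sum (List.map-++ f (map (x ,_) ys) _)) (trans (sum-++ (map f (map (x ,_) ys)) _)
  (cong₂ _+_ (cong sum (sym (List.map-∘ ys))) (sum-cartesianProduct xs ys f)))

sum-map-* : ∀ {A : Set} c (xs : List A) (f : A → ℕ) → sum (map (λ x → c * f x) xs) ≡ c * sum (map f xs)
sum-map-* c []       f = sym (*-zeroʳ c)
sum-map-* c (x ∷ xs) f = trans (cong (c * f x +_) (sum-map-* c xs f)) (sym (*-distribˡ-+ c (f x) _))

module _ {n : ℕ} (σ : Typ n) where

  rowLengths : Cell n → ℕ
  rowLengths ρ = rowLength σ (proj₁ ρ) (proj₂ ρ)

  size≤n : ∀ f → size (component σ f) ≤ n
  size≤n f = ≤-trans (m≤m+n _ _) (≤-trans (∈⇒≤sum (∈-map⁺ (λ k → suc (toℕ k) * size (component σ k)) (∈-allFin f))) (≤-reflexive (weight≡n σ)))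

  length-parts≤n : ∀ f → length (parts (component σ f)) ≤ n
  length-parts≤n f = ≤-trans (length≤sum (positive (component σ f))) (size≤n f)

  rowLengths≤n : ∀ ρ → rowLengths ρ ≤ n
  rowLengths≤n (f , r) = ≤-trans (nth≤sum (parts (component σ f)) (toℕ r)) (size≤n f)

  -- A component has at most `n` parts, so its `n` row slots include them all; the remaining slots
  -- have length 0.
  rowLengths-weight : sum (map (λ ρ → suc (toℕ (proj₁ ρ)) * rowLengths ρ) (cells n)) ≡ n
  rowLengths-weight = trans (sum-cartesianProduct (allFin n) (allFin n) (λ ρ → suc (toℕ (proj₁ ρ)) * rowLengths ρ))
    (trans (sum-map-cong (allFin n) (λ f → trans (sum-map-* (suc (toℕ f)) (allFin n) (λ r → rowLengths (f , r)))
      (cong (suc (toℕ f) *_) (sum-nth n (parts (component σ f)) (length-parts≤n f))))) (weight≡n σ))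

  open SkewTabloids rowLengths rowLengths≤n
  open Placements _≟ᶜ_ (cells n) (cells-unique n) (λ ρ → suc (toℕ (proj₁ ρ))) rowLengths using (fillings; fillings-weight; weightOf)

  noCells : Cell n → ℕ
  noCells _ = 0

  weightOf-noCells : weightOf noCells ≡ 0
  weightOf-noCells = sum-map-zero (cells n) (λ {ρ} _ → *-zeroʳ (suc (toℕ (proj₁ ρ))))

  module _ (τ : Typ n) where

    tabloid⇒skew : ∀ {T} → IsTabloid σ τ T → IsSkewTabloid (blocks τ) T noCells
    tabloid⇒skew (rightFactor , inDiagram , disjoint , covers , increase) = record
      { rightFactor = rightFactor
      ; below       = λ _ → z≤n
      ; starts      = λ _ → z≤n
      ; ends        = inDiagram
      ; disjoint    = disjoint
      ; covers      = λ f r c _ → covers f r c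
      ; increase    = increase
      }

    skew⇒tabloid : ∀ {T} → IsSkewTabloid (blocks τ) T noCells → IsTabloid σ τ T
    skew⇒tabloid S = rightFactor , ends , disjoint , (λ f r c → covers f r c z≤n) , increase
      where open IsSkewTabloid S

    signOf-ℓ₂ : ∀ {k} (T : Vec (Tile n) k) → (-1ℤ ^ ℓ₂ T) ℚ./ 1 ≡ signOf T
    signOf-ℓ₂ []                     = refl
    signOf-ℓ₂ (tile false _ _ _ ∷ T) = trans (signOf-ℓ₂ T) (sym (ℚ.*-identityˡ (signOf T)))
    signOf-ℓ₂ (tile true  _ _ _ ∷ T) = trans (/1-* -1ℤ (-1ℤ ^ ℓ₂ T)) (cong (ℚ.- 1ℚ ℚ.*_) (signOf-ℓ₂ T))

    ∑-tabloids : (∑[ T ∈ PTᵒᵈᵒᵘᵇ σ τ ] (-1ℤ ^ ℓ₂ T) /z⊗ τ) ≡ recip (z⊗ τ) ℚ.* fillings noCells (blocks τ)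
    ∑-tabloids = begin
      (∑[ T ∈ PTᵒᵈᵒᵘᵇ σ τ ] (-1ℤ ^ ℓ₂ T) /z⊗ τ)
        ≡⟨ ∑-cong (PTᵒᵈᵒᵘᵇ σ τ) (λ T → trans (/-recip (-1ℤ ^ ℓ₂ T) (z⊗ τ) {{z⊗≢0 τ}})
             (trans (cong (ℚ._* recip (z⊗ τ)) (signOf-ℓ₂ T)) (ℚ.*-comm (signOf T) (recip (z⊗ τ))))) ⟩
      (∑[ T ∈ PTᵒᵈᵒᵘᵇ σ τ ] recip (z⊗ τ) ℚ.* signOf T)
        ≡⟨ ∑-*ˡ (PTᵒᵈᵒᵘᵇ σ τ) (recip (z⊗ τ)) signOf ⟩
      recip (z⊗ τ) ℚ.* ∑ (PTᵒᵈᵒᵘᵇ σ τ) signOf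
        ≡⟨ cong (recip (z⊗ τ) ℚ.*_) (begin
             ∑ (PTᵒᵈᵒᵘᵇ σ τ) signOf
               ≡⟨ ∑-filter (isTabloid? σ τ) (vectors (tiles n) (length (blocks τ))) signOf ⟩
             (∑[ T ∈ vectors (tiles n) (length (blocks τ)) ] 𝟙 (isTabloid? σ τ T) ℚ.* signOf T)
               ≡⟨ ∑-cong (vectors (tiles n) (length (blocks τ))) (λ T → cong (ℚ._* signOf T)
                    (𝟙-⇔ (isTabloid? σ τ T) (isChain? noCells (blocks τ) T)
                      (λ isT → skew⇒chain (blocks τ) (blocks-degree τ) T noCells (tabloid⇒skew isT))
                      (λ chain → skew⇒tabloid (chain⇒skew (blocks τ) T noCells chain)))) ⟩
             (∑[ T ∈ vectors (tiles n) (length (blocks τ)) ] 𝟙 (isChain? noCells (blocks τ) T) ℚ.* signOf T)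
               ≡⟨ ∑-chains (blocks τ) (blocks-degree τ) noCells ⟩
             fillings noCells (blocks τ) ∎) ⟩
      recip (z⊗ τ) ℚ.* fillings noCells (blocks τ) ∎
      where open ≡-Reasoning

  module _ {a b : ℕ} where
    open Convolution {a} {b}
    open Substitution {a} {b}
    open Newton {a} {b}
    open Products {a} {b}
    open TypeSums n
    open MultisetSums n
    open FillingExpansion _≟ᶜ_ (cells n) (cells-unique n) (toℕ ∘ proj₁) rowLengths n rowLengths-weight
      (kinds 0 n) (kinds-positive 0 n) (∑-kinds 0 n) {a} {b}

    ∏-++ : ∀ {I : Set} (is js : List I) X → ∏ (is ++ js) X ≗ ∏ is X ⊛ ∏ js X
    ∏-++ []       js X e = sym (⊛-identityˡ (∏ js X) e)
    ∏-++ (i ∷ is) js X e = trans (⊛-congˡ (X i) (∏-++ is js X) e) (sym (⊛-assoc (X i) (∏ is X) (∏ js X) e))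

    ∏-map : ∀ {I J : Set} (h : I → J) is (X : J → Monomial a b → ℚ) → ∏ (map h is) X ≗ ∏ is (X ∘ h)
    ∏-map h []       X e = refl
    ∏-map h (i ∷ is) X e = ⊛-congˡ (X (h i)) (∏-map h is X) e

    ∏-cartesianProduct : ∀ {I J : Set} (is : List I) (js : List J) X → ∏ (cartesianProduct is js) X ≗ ∏ is (λ i → ∏ js (λ j → X (i , j)))
    ∏-cartesianProduct []       js X e = refl
    ∏-cartesianProduct (i ∷ is) js X e = trans (∏-++ (map (i ,_) js) (cartesianProduct is js) X e)
      (⊛-cong (∏-map (i ,_) js X) (∏-cartesianProduct is js X) e)

    ∏-allFin-suc : ∀ k (X : Fin (suc k) → Monomial a b → ℚ) → ∏ (allFin (suc k)) X ≗ X zero ⊛ ∏ (allFin k) (X ∘ suc)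
    ∏-allFin-suc k X = ⊛-congˡ (X zero) λ e → trans (cong (λ is → ∏ is X e) (sym (List.map-tabulate (λ i → i) suc))) (∏-map suc (allFin k) X e)

    blockProduct-++ : ∀ F bs cs → (λ (e : Monomial a b) → blockProduct F (bs ++ cs) e) ≗ (λ y → blockProduct F bs y) ⊛ (λ y → blockProduct F cs y)
    blockProduct-++ F []       cs e = sym (⊛-identityˡ (blockProduct F cs) e)
    blockProduct-++ F (β ∷ bs) cs e = trans (⊛-congˡ (blockSeries F β) (blockProduct-++ F bs cs) e)
      (sym (⊛-assoc (blockSeries F β) (blockProduct F bs) (blockProduct F cs) e))

    blockProduct-concatMap : ∀ F {I : Set} (h : I → List Block) is →
      (λ (e : Monomial a b) → blockProduct F (concatMap h is) e) ≗ ∏ is (λ i y → blockProduct F (h i) y)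
    blockProduct-concatMap F h []       e = refl
    blockProduct-concatMap F h (i ∷ is) e = trans (blockProduct-++ F (h i) (concatMap h is) e)
      (⊛-congˡ (blockProduct F (h i)) (blockProduct-concatMap F h is) e)

    -- Row slots beyond the last part have length 0 and contribute E⁺_0 = 1, so the product over all
    -- slots reduces to the product over the parts.
    E∸-rows : ∀ f k xs → length xs ≤ k →
      ∏ (allFin k) (λ r → pow (suc f) (E∸ (nth xs (toℕ r)) 0)) ≗ λ y → blockProduct E⁺ (map (λ d → block d (suc f)) xs) y
    E∸-rows f k       []         _ = ∏-1 (allFin k) (λ _ y → trans (pow-cong (suc f) (E∸-diagonal 0) y) (pow-1ˢ f y))
    E∸-rows f (suc k) (x ∷ xs) l e = trans (∏-allFin-suc k (λ r → pow (suc f) (E∸ (nth (x ∷ xs) (toℕ r)) 0)) e)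
      (⊛-cong (pow-cong (suc f) (E∸-0 x)) (E∸-rows f k xs (s≤s⁻¹ l)) e)

    eProduct-noCells : ∀ e → eProduct noCells e ≡ (E⁺ ⟦ σ ⟧) e
    eProduct-noCells e = trans (∏-cartesianProduct (allFin n) (allFin n) (rowSeries noCells) e)
      (trans (∏-cong (allFin n) (λ {f} _ → E∸-rows (toℕ f) n (parts (component σ f)) (length-parts≤n f)) e)
        (sym (blockProduct-concatMap E⁺ (λ k → map (λ d → block d (suc (toℕ k))) (parts (component σ k))) (allFin n) e)))

    E⁺-expansion : ∀ (e : Monomial a b) → (E⁺ ⟦ σ ⟧) e ≡ (∑[ τ ∈ types n ] (∑[ T ∈ PTᵒᵈᵒᵘᵇ σ τ ] (-1ℤ ^ ℓ₂ T) /z⊗ τ) ℚ.* (P ⟦ τ ⟧) e)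
    E⁺-expansion e = begin
      (E⁺ ⟦ σ ⟧) e
        ≡⟨ eProduct-noCells e ⟨
      eProduct noCells e
        ≡⟨ pExpansion≡eProduct (missing noCells) noCells ≤-refl e ⟨
      multisetSum (kinds 0 n) (λ bs → fillings noCells bs ℚ.* blockProduct P bs e)
        -- The rows start empty and σ has weight `n`, so a content of any other weight admits no
        -- filling.
        ≡⟨ ∑-types (λ bs → fillings noCells bs ℚ.* blockProduct P bs e) (λ bs ≢n → trans
             (cong (ℚ._* blockProduct P bs e) (fillings-weight bs λ eq → ≢n (sym (trans (sym rowLengths-weight) (trans eq (cong (_+ totalWeight bs) weightOf-noCells))))))
             (ℚ.*-zeroˡ (blockProduct P bs e))) ⟨
      (∑[ τ ∈ types n ] recip (z⊗ τ) ℚ.* (fillings noCells (blocks τ) ℚ.* (P ⟦ τ ⟧) e))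
        ≡⟨ ∑-cong (types n) (λ τ → trans (sym (ℚ.*-assoc (recip (z⊗ τ)) (fillings noCells (blocks τ)) _)) (cong (ℚ._* (P ⟦ τ ⟧) e) (sym (∑-tabloids τ)))) ⟩
      (∑[ τ ∈ types n ] (∑[ T ∈ PTᵒᵈᵒᵘᵇ σ τ ] (-1ℤ ^ ℓ₂ T) /z⊗ τ) ℚ.* (P ⟦ τ ⟧) e) ∎
      where open ≡-Reasoning

theorem47 : ∀ n (σ : Typ n) →
    IsPExpansion n (E⁺ ⟦ σ ⟧) (λ τ → ∑[ T ∈ PTᵒᵈᵒᵘᵇ σ τ ] (-1ℤ ^ ℓ₂ T) /z⊗ τ)
theorem47 n σ = E⁺-expansion σ
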